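{- For any constant $\epsilon>0$, the following holds. If Subset Steiner CDS with unit edge costs (or with unit node weights) admits approximation ratio $\alpha(n)$ on instances with $n$ nodes, then the Group Steiner Tree problem with arbitrary edge costs admits approximation ratio $\alpha\left(|E|(n+k)/\epsilon\right)+\epsilon$ on instances consisting of a graph with $n$ nodes and edge set $E$, and $k$ groups.
   Context: Graphs are finite and undirected; costs and weights are non-negative. A problem admits ratio $\alpha$ if it has a polynomial-time algorithm that on every feasible instance outputs a feasible solution of value at most $\alpha$ times the optimum. It is assumed that a ratio $\alpha(n)$ for a given problem is an increasing function of the number $n$ of nodes. Subset Steiner CDS: given a graph $G=(V,E)$, a partition $Q,R$ of $V$, and edge costs or node weights, find a minimum cost/weight subtree $H=(V_H,E_H)$ of $G$ such that $V_H\subseteq Q$ and $V_H$ dominates $R$ (i.e. every $r\in R$ has a neighbor in $V_H$). In the unit edge costs version the number of edges of $H$ is minimized; in the unit node weights version the number of nodes of $H$ is minimized. Group Steiner Tree (GST): given a graph $G=(V,E)$ with edge costs and a collection $\mathcal{S}$ of groups (subsets) of $V$, find a minimum cost subtree $H$ of $G$ that contains at least one node from every group.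
   Formalization: The constant ε and the edge costs of the Group Steiner Tree instances are taken to be rational numbers (the ratio α itself may take real values). -}

module Defs where

open import Algebra.Properties.Monoid.Sum using (sum)
open import Data.Bool.Base using (Bool; true; false; if_then_else_)
open import Data.Empty using (⊥)
open import Data.Fin.Base using (Fin; toℕ) renaming (_<_ to _<ᶠ_)
open import Data.Fin.Subset using (Subset; ∁; _⊆_; Nonempty) renaming (_∈_ to _∈ˢ_; ∣_∣ to card)
open import Data.Fin.Subset.Properties using (_∈?_)
open import Data.Integer.Base using (+_)
open import Data.List.Base using (List; []; _∷_; tabulate)
open import Data.List.Relation.Unary.Unique.Propositional using (Unique)
open import Data.Nat.Base using (ℕ; zero; suc) renaming (_+_ to _+ⁿ_; _*_ to _*ⁿ_; _^_ to _^ⁿ_; _≤_ to _≤ⁿ_)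
open import Data.Nat.Binary.Base using (ℕᵇ; 2[1+_]; 1+[2_]; fromℕ)
open import Data.Product.Base using (∃; ∃-syntax; _×_; _,_; proj₁; proj₂)
open import Data.Rational.Base using (ℚ; 0ℚ; 1ℚ; _+_; _-_; -_; _*_; _÷_; _≤_; _<_; _/_; Positive; ↥_; ↧ₙ_)
open import Data.Rational.Properties using (+-0-monoid; +-assoc; +-inverseˡ; +-inverseʳ; +-identityʳ; +-monoˡ-<; <-cmp; <-dense; <-trans; <-irrefl; <-respʳ-≡; <-respˡ-≡; pos⇒nonZero; positive⁻¹; negative⁻¹; +-monoʳ-<)
open import Data.Sum.Base using (_⊎_; inj₁; inj₂)
open import Data.Vec.Base using (toList)
open import Function.Definitions using (Injective)
open import Relation.Binary.Definitions using (tri<; tri≈; tri>)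
open import Relation.Binary.PropositionalEquality using (_≡_; _≢_; refl; sym; trans; cong; subst)
open import Relation.Nullary using (¬_; does)
import Data.Integer.Base as ℤ

-- Dedekind cuts of ℚ.
record ℝ : Set₁ where
  field
    Lower Upper   : ℚ → Set
    lower-inhab   : ∃ Lower
    upper-inhab   : ∃ Upper
    lower-closed  : ∀ {p q} → p < q → Lower q → Lower p
    upper-closed  : ∀ {p q} → p < q → Upper p → Upper q
    lower-open    : ∀ {p} → Lower p → ∃[ q ] p < q × Lower q
    upper-open    : ∀ {q} → Upper q → ∃[ p ] p < q × Upper p
    disjoint      : ∀ {q} → Lower q → Upper q → ⊥
    located       : ∀ {p q} → p < q → Lower p ⊎ Upper q

open ℝ using (Lower; Upper)

infix 4 _≤ʳ_
_≤ʳ_ : ℝ → ℝ → Set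
x ≤ʳ y = ∀ q → Lower x q → Lower y q

private
  p-1<p : ∀ p → p - 1ℚ < p
  p-1<p p = <-respʳ-≡ (+-identityʳ p) (+-monoʳ-< p (negative⁻¹ (- 1ℚ)))

  p<p+1 : ∀ p → p < p + 1ℚ
  p<p+1 p = <-respˡ-≡ (+-identityʳ p) (+-monoʳ-< p (positive⁻¹ 1ℚ))

  p+r-r : ∀ p r → (p + r) - r ≡ p
  p+r-r p r = trans (+-assoc p r (- r)) (trans (cong (λ z → p + z) (+-inverseʳ r)) (+-identityʳ p))

  p-r+r : ∀ p r → (p - r) + r ≡ p
  p-r+r p r = trans (+-assoc p (- r) r) (trans (cong (λ z → p + z) (+-inverseˡ r)) (+-identityʳ p))

fromℚ : ℚ → ℝ
fromℚ r = record
  { Lower        = λ q → q < r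
  ; Upper        = λ q → r < q
  ; lower-inhab  = r - 1ℚ , p-1<p r
  ; upper-inhab  = r + 1ℚ , p<p+1 r
  ; lower-closed = <-trans
  ; upper-closed = λ p<q r<p → <-trans r<p p<q
  ; lower-open   = λ p<r → <-dense p<r
  ; upper-open   = λ r<q → let p , r<p , p<q = <-dense r<q in p , p<q , r<p
  ; disjoint     = λ q<r r<q → <-irrefl refl (<-trans q<r r<q)
  ; located      = loc
  }
  where
  loc : ∀ {p q} → p < q → (p < r) ⊎ (r < q)
  loc {p} p<q with <-cmp p r
  ... | tri< p<r _ _ = inj₁ p<r
  ... | tri≈ _ p≡r _ = inj₂ (<-respˡ-≡ p≡r p<q)
  ... | tri> _ _ r<p = inj₂ (<-trans r<p p<q)

infixl 6 _+ʳ_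
_+ʳ_ : ℝ → ℚ → ℝ
x +ʳ r = record
  { Lower        = λ q → Lower x (q - r)
  ; Upper        = λ q → Upper x (q - r)
  ; lower-inhab  = up (ℝ.lower-inhab x)
  ; upper-inhab  = up (ℝ.upper-inhab x)
  ; lower-closed = λ p<q → ℝ.lower-closed x (+-monoˡ-< (- r) p<q)
  ; upper-closed = λ p<q → ℝ.upper-closed x (+-monoˡ-< (- r) p<q)
  ; lower-open   = λ {p} l → let q , p-r<q , l′ = ℝ.lower-open x l in
      q + r , <-respˡ-≡ (p-r+r p r) (+-monoˡ-< r p-r<q) , subst (Lower x) (sym (p+r-r q r)) l′
  ; upper-open   = λ {q} u → let p , p<q-r , u′ = ℝ.upper-open x u in
      p + r , <-respʳ-≡ (p-r+r q r) (+-monoˡ-< r p<q-r) , subst (Upper x) (sym (p+r-r p r)) u′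
  ; disjoint     = ℝ.disjoint x
  ; located      = λ p<q → ℝ.located x (+-monoˡ-< (- r) p<q)
  }
  where
  up : ∀ {P : ℚ → Set} → ∃ P → ∃ λ q → P (q - r)
  up {P} (q , Pq) = q + r , subst P (sym (p+r-r q r)) Pq

-- v ≤[ ρ · o ] says v ≤ ρ · o, for rational o ≥ 0: in that case ρ · o is
-- the infimum of q · o over the rationals q > ρ.
_≤[_·_] : ℚ → ℝ → ℚ → Set
v ≤[ ρ · o ] = ∀ q → Upper ρ q → v ≤ q * o

infixr 5 _∙_
data Val : Set where
  nil : Val
  _∙_ : Val → Val → Val

size : Val → ℕ
size nil     = 1
size (a ∙ b) = suc (size a +ⁿ size b)

hdᵛ tlᵛ : Val → Val
hdᵛ nil     = nil
hdᵛ (a ∙ b) = a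
tlᵛ nil     = nil
tlᵛ (a ∙ b) = b

-- While-programs on binary trees: essentially N. D. Jones's language I (WHILE
-- with a single variable), written with combinators.  With unit cost per
-- elementary operation, polynomial time in it coincides with polynomial time
-- on Turing machines: trees can be stored as shared DAGs, so that duplicating
-- a tree takes constant time, and no operation inspects more than the root
-- (Jones, Computability and Complexity, MIT Press 1997).
infixr 4 _⨾_
data Prog : Set where
  skip const-nil hd tl : Prog
  _⨾_   : Prog → Prog → Prog
  cons  : Prog → Prog → Prog
  cond  : Prog → Prog → Prog → Prog
  while : Prog → Prog → Prog

-- p ⊢ x ⇓ y [ t ] : on input x, program p halts with output y after t steps.
-- The value nil is "false", every other value is "true".
infix 3 _⊢_⇓_[_]
data _⊢_⇓_[_] : Prog → Val → Val → ℕ → Set where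
  skip       : ∀ {x} → skip ⊢ x ⇓ x [ 1 ]
  const-nil  : ∀ {x} → const-nil ⊢ x ⇓ nil [ 1 ]
  hd         : ∀ {x} → hd ⊢ x ⇓ hdᵛ x [ 1 ]
  tl         : ∀ {x} → tl ⊢ x ⇓ tlᵛ x [ 1 ]
  seq        : ∀ {p q x y z s t} →
               p ⊢ x ⇓ y [ s ] → q ⊢ y ⇓ z [ t ] →
               p ⨾ q ⊢ x ⇓ z [ suc (s +ⁿ t) ]
  cons       : ∀ {p q x y z s t} →
               p ⊢ x ⇓ y [ s ] → q ⊢ x ⇓ z [ t ] →
               cons p q ⊢ x ⇓ y ∙ z [ suc (s +ⁿ t) ]
  cond-true  : ∀ {b p q x c d y s t} →
               b ⊢ x ⇓ c ∙ d [ s ] → p ⊢ x ⇓ y [ t ] →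
               cond b p q ⊢ x ⇓ y [ suc (s +ⁿ t) ]
  cond-false : ∀ {b p q x y s t} →
               b ⊢ x ⇓ nil [ s ] → q ⊢ x ⇓ y [ t ] →
               cond b p q ⊢ x ⇓ y [ suc (s +ⁿ t) ]
  while-stop : ∀ {b p x s} →
               b ⊢ x ⇓ nil [ s ] →
               while b p ⊢ x ⇓ x [ suc s ]
  while-step : ∀ {b p x c d y z s t u} →
               b ⊢ x ⇓ c ∙ d [ s ] → p ⊢ x ⇓ y [ t ] → while b p ⊢ y ⇓ z [ u ] →
               while b p ⊢ x ⇓ z [ suc (s +ⁿ t +ⁿ u) ]

-- Since size (enc i) ≥ 1, the bounds c · sizeᵈ dominate all polynomials.
RunsInPolyTime : Prog → {I : Set} → (I → Val) → Set
RunsInPolyTime p {I} enc =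
  ∃[ c ] ∃[ d ] ∀ (i : I) →
    ∃[ y ] ∃[ t ] (p ⊢ enc i ⇓ y [ t ]) × t ≤ⁿ c *ⁿ size (enc i) ^ⁿ d

encList : {A : Set} → (A → Val) → List A → Val
encList f []       = nil
encList f (a ∷ as) = f a ∙ encList f as

-- Unary; used for the number of nodes and for node names only, which are
-- bounded by the size of the graph.
encUnary : ℕ → Val
encUnary zero    = nil
encUnary (suc n) = nil ∙ encUnary n

encBinary : ℕᵇ → Val
encBinary ℕᵇ.zero  = nil
encBinary 2[1+ b ] = nil ∙ encBinary b
encBinary 1+[2 b ] = (nil ∙ nil) ∙ encBinary b

-- Only meant for q ≥ 0: the sign is dropped.
encℚ : ℚ → Val
encℚ q = encBinary (fromℕ ℤ.∣ ↥ q ∣) ∙ encBinary (fromℕ (↧ₙ q))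

encBool : Bool → Val
encBool false = nil
encBool true  = nil ∙ nil

encSubset : ∀ {n} → Subset n → Val
encSubset s = encList encBool (toList s)

-- Finite simple undirected graphs with nodes Fin n and edges Fin m.  The
-- unordered pair of ends of an edge is listed with its smaller element first.
record Graph : Set where
  field
    n m       : ℕ
    ends      : Fin m → Fin n × Fin n
    ordered   : ∀ e → proj₁ (ends e) <ᶠ proj₂ (ends e)
    injective : Injective _≡_ _≡_ ends

  Node Edge : Set
  Node = Fin n
  Edge = Fin m

  Joins : Edge → Node → Node → Set
  Joins e u v = ends e ≡ (u , v) ⊎ ends e ≡ (v , u)

  Adjacent : Node → Node → Set
  Adjacent u v = ∃[ e ] Joins e u v

  data Walk (F : Subset m) : Node → Node → Set where
    stop : ∀ {u} → Walk F u u
    step : ∀ {u v w} (e : Edge) → e ∈ˢ F → Joins e u v → Walk F v w → Walk F u w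

  edgesOf : ∀ {F u v} → Walk F u v → List Edge
  edgesOf stop           = []
  edgesOf (step e _ _ w) = e ∷ edgesOf w

  -- All nodes of the walk except its last one.
  nodesOf : ∀ {F u v} → Walk F u v → List Node
  nodesOf stop                   = []
  nodesOf (step {u = u} _ _ _ w) = u ∷ nodesOf w

  IsCycle : ∀ {F u} → Walk F u u → Set
  IsCycle w = edgesOf w ≢ [] × Unique (edgesOf w) × Unique (nodesOf w)

  record Subgraph : Set where
    field
      V : Subset n
      E : Subset m

  nodeCount edgeCount : Subgraph → ℕ
  nodeCount H = card (Subgraph.V H)
  edgeCount H = card (Subgraph.E H)

  record IsSubtree (H : Subgraph) : Set where
    open Subgraph H
    field
      ends-in   : ∀ e → e ∈ˢ E → proj₁ (ends e) ∈ˢ V × proj₂ (ends e) ∈ˢ V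
      nonempty  : Nonempty V
      connected : ∀ u v → u ∈ˢ V → v ∈ˢ V → Walk E u v
      acyclic   : ∀ u (w : Walk E u u) → ¬ IsCycle w

  encSubgraph : Subgraph → Val
  encSubgraph H = encSubset (Subgraph.V H) ∙ encSubset (Subgraph.E H)

  encNode : Node → Val
  encNode v = encUnary (toℕ v)

  encEdge : Edge → Val
  encEdge e = encNode (proj₁ (ends e)) ∙ encNode (proj₂ (ends e))

record MinimizationProblem : Set₁ where
  field
    Instance    : Set
    Solution    : Instance → Set
    Feasible    : (I : Instance) → Solution I → Set
    value       : (I : Instance) → Solution I → ℚ
    encInstance : Instance → Val
    encSolution : (I : Instance) → Solution I → Val

  FeasibleInstance : Instance → Set
  FeasibleInstance I = ∃[ S ] Feasible I S

  Optimal : (I : Instance) → Solution I → Set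
  Optimal I S = Feasible I S × (∀ T → Feasible I T → value I S ≤ value I T)

AdmitsRatio : (P : MinimizationProblem) → (MinimizationProblem.Instance P → ℝ) → Set
AdmitsRatio P ρ =
  ∃[ p ] RunsInPolyTime p encInstance ×
    (∀ I → FeasibleInstance I →
      ∃[ S ] (∃[ t ] p ⊢ encInstance I ⇓ encSolution I S [ t ]) ×
             Feasible I S ×
             (∀ O → Optimal I O → value I S ≤[ ρ I · value I O ]))
  where open MinimizationProblem P

fromℕℚ : ℕ → ℚ
fromℕℚ k = + k / 1

record CDSInstance : Set where
  field
    graph : Graph
    Q     : Subset (Graph.n graph)

  open Graph graph public

  R : Subset n
  R = ∁ Q

  record IsSteinerCDS (H : Subgraph) : Set where
    open Subgraph H
    field
      subtree   : IsSubtree H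
      inside    : V ⊆ Q
      dominates : ∀ r → r ∈ˢ R → ∃[ v ] v ∈ˢ V × Adjacent r v

SubsetSteinerCDS : ((I : CDSInstance) → CDSInstance.Subgraph I → ℕ) → MinimizationProblem
SubsetSteinerCDS measure = record
  { Instance    = CDSInstance
  ; Solution    = CDSInstance.Subgraph
  ; Feasible    = CDSInstance.IsSteinerCDS
  ; value       = λ I H → fromℕℚ (measure I H)
  ; encInstance = λ I → let open CDSInstance I in
      encUnary n ∙ encList encEdge (tabulate (λ e → e)) ∙ encSubset Q
  ; encSolution = CDSInstance.encSubgraph
  }

UnitEdgeCostsCDS UnitNodeWeightsCDS : MinimizationProblem
UnitEdgeCostsCDS   = SubsetSteinerCDS CDSInstance.edgeCount
UnitNodeWeightsCDS = SubsetSteinerCDS CDSInstance.nodeCount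

record GSTInstance : Set where
  field
    graph       : Graph
    cost        : Fin (Graph.m graph) → ℚ
    nonnegative : ∀ e → 0ℚ ≤ cost e
    k           : ℕ
    group       : Fin k → Subset (Graph.n graph)

  open Graph graph public

  totalCost : Subgraph → ℚ
  totalCost H = sum +-0-monoid (λ e → if does (e ∈? Subgraph.E H) then cost e else 0ℚ)

  record IsGroupSteinerTree (H : Subgraph) : Set where
    open Subgraph H
    field
      subtree : IsSubtree H
      hits    : ∀ i → ∃[ v ] v ∈ˢ group i × v ∈ˢ V

GroupSteinerTree : MinimizationProblem
GroupSteinerTree = record
  { Instance    = GSTInstance
  ; Solution    = GSTInstance.Subgraph
  ; Feasible    = GSTInstance.IsGroupSteinerTree
  ; value       = GSTInstance.totalCost
  ; encInstance = λ I → let open GSTInstance I in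
      encUnary n
      ∙ encList (λ e → encEdge e ∙ encℚ (cost e)) (tabulate (λ e → e))
      ∙ encList encSubset (tabulate group)
  ; encSolution = GSTInstance.encSubgraph
  }

-- A ratio is a function of the number of nodes; it is given on all
-- non-negative rationals since it gets evaluated at non-integral arguments.
-- Increasing is meant in the weak sense, so that constant ratios are included.
record IsRatioFunction (α : ℚ → ℝ) : Set where
  field
    at-least-one : ∀ x → 0ℚ ≤ x → fromℚ 1ℚ ≤ʳ α x
    increasing   : ∀ x y → 0ℚ ≤ x → x ≤ y → α x ≤ʳ α y

infixl 7 _÷⁺_
_÷⁺_ : (p q : ℚ) .{{_ : Positive q}} → ℚ
p ÷⁺ q = _÷_ p q {{pos⇒nonZero q}}

{-# OPTIONS --safe #-}

-- Guess the largest cost M of an edge of an optimal tree O, drop the edges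
-- that cost more, and give every other edge e the length ⌈K c(e)/M⌉ - 1, where
-- K = ⌈r/ε⌉ and r = min(|E|, n) bounds the number of edges of a tree.  Contract
-- the edges of length 0, replace the others by paths of that length, and add
-- one node of R per group, adjacent to the members of the group.  Rounding down
-- keeps the error additive: K c(T) ≤ M (length(T) + r) for every tree T, and
-- r M ≤ ε K M ≤ ε K c(O).  Since the rounding is strict on the edge of cost M,
-- M (length(O) + 1) ≤ K c(O), so that the tree of O in the new graph is cheap
-- whether its edges or its nodes are counted.  The new graph has
-- n + k + |E| (K - 2) ≤ |E| (n + k)/ε nodes, except if K = 1; but then all
-- lengths are 0 and the ratio α plays no role.  Of the trees obtained for the
-- different M, the one with the least M (length(T) + r) is returned.

module Submission where

open import Defs
import Algebra.Properties.Monoid.Sum as MonoidSum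
open import Data.Bool.Base using (Bool; true; false; if_then_else_; not; _∧_; _∨_; T)
open import Data.Bool.ListAction using (and; or)
open import Data.Bool.Properties using (T?)
open import Data.Empty using (⊥; ⊥-elim)
open import Data.Fin.Base using (Fin; toℕ; fromℕ<; zero; suc)
open import Data.Fin.Properties using (toℕ<n; toℕ-fromℕ<; toℕ-injective)
open import Data.Fin.Subset using (Subset) renaming (_∈_ to _∈ˢ_; ∣_∣ to card)
open import Data.Fin.Subset.Properties using (_∈?_; drop-there; x∈∁p⇒x∉p; x∉p⇒x∈∁p)
import Data.Integer.Base as ℤ
import Data.Integer.Properties as ℤ
open import Data.List.Base using (List; []; _∷_; _++_; _ʳ++_; length; map; foldl; foldr; reverse; drop; replicate; applyUpTo; upTo; filterᵇ; cartesianProduct; tabulate)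
open import Data.List.Membership.Propositional using (_∈_)
open import Data.List.Membership.Propositional.Properties using (∈-filter⁺; ∈-filter⁻; ∈-map⁺; ∈-map⁻; ∈-cartesianProduct⁺; ∈-cartesianProduct⁻; ∈-upTo⁺; ∈-upTo⁻; ∈-tabulate⁺; ∈-tabulate⁻)
open import Data.List.Properties using (reverse-foldr; reverse-involutive; map-upTo; length-applyUpTo; length-tabulate; map-tabulate; tabulate-cong)
open import Data.List.Relation.Unary.All as All using (All; []; _∷_)
open import Data.List.Relation.Unary.All.Properties using (all-filter)
open import Data.List.Relation.Unary.AllPairs using ([]; _∷_)
open import Data.List.Relation.Unary.Any using (here; there)
open import Data.List.Relation.Unary.Unique.Propositional using (Unique)
open import Data.List.Relation.Unary.Unique.Propositional.Properties using (map⁺; filter⁺; cartesianProduct⁺; upTo⁺)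
open import Data.Nat using (_≡ᵇ_; _≟_)
open import Data.Nat.Base hiding (_/_; _≡ᵇ_; less; compare)
open import Data.Nat.Base using () renaming (_+_ to _+ⁿ_; _*_ to _*ⁿ_)
open import Data.Nat.Binary.Base as ℕᵇ using (ℕᵇ; 2[1+_]; 1+[2_]; fromℕ)
open import Data.Nat.Binary.Properties using (toℕ-fromℕ)
open import Data.Nat.ListAction using (sum)
open import Data.Nat.Properties hiding (_≟_)
open import Data.Nat.Solver using (module +-*-Solver)
open import Data.Product.Base using (Σ; ∃; ∃-syntax; _×_; _,_; proj₁; proj₂)
open import Data.Product.Properties using (,-injective)
open import Data.Rational.Base as ℚ using (ℚ; 0ℚ; 1ℚ; ↥_; ↧ₙ_; toℚᵘ; Positive; nonNegative; positive)
  renaming (_+_ to _+q_; _*_ to _*q_; _≤_ to _≤q_; _<_ to _<q_; _-_ to _-q_)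
import Data.Rational.Properties as ℚP
open import Data.Rational.Unnormalised.Base as ℚᵘ using (mkℚᵘ; *≡*; *≤*; *<*)
import Data.Rational.Unnormalised.Properties as ℚᵘP
open import Data.Sum.Base as ⊎ using (_⊎_; inj₁; inj₂; swap)
open import Data.Unit.Base using (⊤; tt)
open import Data.Vec.Base as Vec using (toList; []; _∷_)
open import Data.Vec.Properties using ([]=⇒lookup; lookup⇒[]=)
open import Function.Base using (_∘_; flip; id)
open import Relation.Binary.Definitions using (tri<; tri≈; tri>)
open import Relation.Binary.PropositionalEquality hiding (J)
open import Relation.Nullary using (¬_; yes; no; Dec; does)
open import Relation.Nullary.Decidable using (decidable-stable)

-- Polynomial-time programs

-- The assumed program is a black box: it may return any CDS tree within its ratio, and nothing is
-- known about its output on infeasible instances. Hence thresholds for which no component of the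
-- kept edges meets all groups are discarded before any call. A returned tree may enter a path from
-- both ends without traversing it; an edge is taken back only if its whole path is covered. No
-- connection is lost, since a walk that leaves a path at the far end has used all of it. The new
-- graph has to be simple, while several edges of length 1 may join the same two classes;
-- attributing each new edge to one owner keeps lengths in both graphs comparable. Running time has
-- to be exhibited in the WHILE language, so costs are only ever compared, as cross-multiplied
-- multiples, and lengths are found by linear search, whose range is polynomial because ε is fixed.
-- Finally, the ratio is real and optima are not computed: the estimates are made for each rational
-- above the ratio, and the optimum of a CDS instance exists only under a double negation, which the
-- decidable order of the rationals removes.

data Pol : Set where
  con     : ℕ → Pol
  X       : Pol
  _⊕_ _⊛_ : Pol → Pol → Pol

infixl 6 _⊕_
infixl 7 _⊛_

⟪_⟫ : Pol → ℕ → ℕ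
⟪ con c ⟫ s = c
⟪ X ⟫     s = s
⟪ P ⊕ Q ⟫ s = ⟪ P ⟫ s + ⟪ Q ⟫ s
⟪ P ⊛ Q ⟫ s = ⟪ P ⟫ s * ⟪ Q ⟫ s

-- Coefficients are natural numbers, so monotonicity is structural. It is what turns a bound in the
-- size of an intermediate value into a bound in the size of the input.
⟪⟫-mono : ∀ P {s t} → s ≤ t → ⟪ P ⟫ s ≤ ⟪ P ⟫ t
⟪⟫-mono (con c) _ = ≤-refl
⟪⟫-mono X       h = h
⟪⟫-mono (P ⊕ Q) h = +-mono-≤ (⟪⟫-mono P h) (⟪⟫-mono Q h)
⟪⟫-mono (P ⊛ Q) h = *-mono-≤ (⟪⟫-mono P h) (⟪⟫-mono Q h)

_∘ᵖ_ : Pol → Pol → Pol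
con c   ∘ᵖ R = con c
X       ∘ᵖ R = R
(P ⊕ Q) ∘ᵖ R = (P ∘ᵖ R) ⊕ (Q ∘ᵖ R)
(P ⊛ Q) ∘ᵖ R = (P ∘ᵖ R) ⊛ (Q ∘ᵖ R)

⟪⟫-∘ : ∀ P R s → ⟪ P ∘ᵖ R ⟫ s ≡ ⟪ P ⟫ (⟪ R ⟫ s)
⟪⟫-∘ (con c) R s = refl
⟪⟫-∘ X       R s = refl
⟪⟫-∘ (P ⊕ Q) R s = cong₂ _+_ (⟪⟫-∘ P R s) (⟪⟫-∘ Q R s)
⟪⟫-∘ (P ⊛ Q) R s = cong₂ _*_ (⟪⟫-∘ P R s) (⟪⟫-∘ Q R s)

pow-mono : ∀ {s d e} → 1 ≤ s → d ≤ e → s ^ d ≤ s ^ e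
pow-mono {suc s} _ d≤e = ^-monoʳ-≤ (suc s) d≤e

-- Gives the form required by `RunsInPolyTime`; `1 ≤ s` allows terms of different degree to be
-- raised to a common one.
pol-bound : ∀ P → ∃[ c ] ∃[ d ] ∀ s → 1 ≤ s → ⟪ P ⟫ s ≤ c * s ^ d
pol-bound (con c) = c , 0 , λ s _ → ≤-reflexive (sym (*-identityʳ c))
pol-bound X       = 1 , 1 , λ s _ → ≤-reflexive (sym (trans (+-identityʳ (s * 1)) (*-identityʳ s)))
pol-bound (P ⊕ Q) with pol-bound P | pol-bound Q
... | c , d , p | c′ , d′ , q = c + c′ , d + d′ , λ s 1≤s → begin
    ⟪ P ⟫ s + ⟪ Q ⟫ s                  ≤⟨ +-mono-≤ (p s 1≤s) (q s 1≤s) ⟩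
    c * s ^ d + c′ * s ^ d′            ≤⟨ +-mono-≤ (*-monoʳ-≤ c (pow-mono 1≤s (m≤m+n d d′)))
                                                   (*-monoʳ-≤ c′ (pow-mono 1≤s (m≤n+m d′ d))) ⟩
    c * s ^ (d + d′) + c′ * s ^ (d + d′) ≡⟨ *-distribʳ-+ (s ^ (d + d′)) c c′ ⟨
    (c + c′) * s ^ (d + d′)            ∎
  where open ≤-Reasoning
pol-bound (P ⊛ Q) with pol-bound P | pol-bound Q
... | c , d , p | c′ , d′ , q = c * c′ , d + d′ , λ s 1≤s → begin
    ⟪ P ⟫ s * ⟪ Q ⟫ s                  ≤⟨ *-mono-≤ (p s 1≤s) (q s 1≤s) ⟩
    (c * s ^ d) * (c′ * s ^ d′)        ≡⟨ [m*n]*[o*p]≡[m*o]*[n*p] c (s ^ d) c′ (s ^ d′) ⟩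
    (c * c′) * (s ^ d * s ^ d′)        ≡⟨ cong (c * c′ *_) (^-distribˡ-+-* s d d′) ⟨
    (c * c′) * s ^ (d + d′)            ∎
  where open ≤-Reasoning

-- The converse direction: makes the bound of the assumed program a `Pol`.
monomial : ℕ → ℕ → Pol
monomial c zero    = con c
monomial c (suc d) = X ⊛ monomial c d

⟪monomial⟫ : ∀ c d s → ⟪ monomial c d ⟫ s ≡ c * s ^ d
⟪monomial⟫ c zero    s = sym (*-identityʳ c)
⟪monomial⟫ c (suc d) s = begin
  s * ⟪ monomial c d ⟫ s ≡⟨ cong (s *_) (⟪monomial⟫ c d s) ⟩
  s * (c * s ^ d)        ≡⟨ *-assoc s c (s ^ d) ⟨
  s * c * s ^ d          ≡⟨ cong (_* s ^ d) (*-comm s c) ⟩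
  c * s * s ^ d          ≡⟨ *-assoc c s (s ^ d) ⟩
  c * (s * s ^ d)        ∎
  where open ≡-Reasoning

size≥1 : ∀ v → 1 ≤ size v
size≥1 nil     = ≤-refl
size≥1 (a ∙ b) = s≤s z≤n

infix 3 _⊢_⇓_≤[_]
_⊢_⇓_≤[_] : Prog → Val → Val → ℕ → Set
p ⊢ x ⇓ y ≤[ T ] = ∃[ t ] (p ⊢ x ⇓ y [ t ]) × t ≤ T

relax : ∀ {p x y S T} → S ≤ T → p ⊢ x ⇓ y ≤[ S ] → p ⊢ x ⇓ y ≤[ T ]
relax S≤T (t , r , t≤S) = t , r , ≤-trans t≤S S≤T

seq′ : ∀ {p q x y z S T} → p ⊢ x ⇓ y ≤[ S ] → q ⊢ y ⇓ z ≤[ T ] → p ⨾ q ⊢ x ⇓ z ≤[ suc (S + T) ]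
seq′ (s , r , s≤) (t , r′ , t≤) = _ , seq r r′ , s≤s (+-mono-≤ s≤ t≤)

cons′ : ∀ {p q x y z S T} → p ⊢ x ⇓ y ≤[ S ] → q ⊢ x ⇓ z ≤[ T ] → cons p q ⊢ x ⇓ y ∙ z ≤[ suc (S + T) ]
cons′ (s , r , s≤) (t , r′ , t≤) = _ , cons r r′ , s≤s (+-mono-≤ s≤ t≤)

ifᵛ : Val → Val → Val → Val
ifᵛ nil     a b = b
ifᵛ (_ ∙ _) a b = a

-- One polynomial bounds both the running time and the size of the output:
-- because trees are shared, the latter does not follow from the former.
record Computes {D : Set} (i o : D → Val) : Set where
  constructor computes
  field
    prog  : Prog
    pol   : Pol
    run   : ∀ d → prog ⊢ i d ⇓ o d ≤[ ⟪ pol ⟫ (size (i d)) ]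
    small : ∀ d → size (o d) ≤ ⟪ pol ⟫ (size (i d))

open Computes

module _ {D : Set} where

  idᶜ : {i : D → Val} → Computes i i
  idᶜ {i} = computes skip X (λ d → 1 , skip , size≥1 (i d)) (λ d → ≤-refl)

  infixr 9 _∘ᶜ_
  _∘ᶜ_ : {i x o : D → Val} → Computes x o → Computes i x → Computes i o
  _∘ᶜ_ {i} {x} {o} (computes q Q rq sq) (computes p P rp sp) =
    computes (p ⨾ q) (con 1 ⊕ (P ⊕ (Q ∘ᵖ P)))
      (λ d → relax (s≤s (+-monoʳ-≤ _ (subst (_ ≤_) (sym (⟪⟫-∘ Q P _)) (⟪⟫-mono Q (sp d))))) (seq′ (rp d) (rq d)))
      (λ d → begin
        size (o d)                          ≤⟨ sq d ⟩
        ⟪ Q ⟫ (size (x d))                  ≤⟨ ⟪⟫-mono Q (sp d) ⟩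
        ⟪ Q ⟫ (⟪ P ⟫ (size (i d)))          ≡⟨ ⟪⟫-∘ Q P _ ⟨
        ⟪ Q ∘ᵖ P ⟫ (size (i d))             ≤⟨ m≤n+m _ _ ⟩
        ⟪ P ⟫ (size (i d)) + ⟪ Q ∘ᵖ P ⟫ (size (i d)) ≤⟨ n≤1+n _ ⟩
        suc (⟪ P ⟫ (size (i d)) + ⟪ Q ∘ᵖ P ⟫ (size (i d))) ∎)
    where open ≤-Reasoning

  nilᶜ : {i : D → Val} → Computes i (λ _ → nil)
  nilᶜ = computes const-nil (con 1) (λ d → 1 , const-nil , ≤-refl) (λ d → ≤-refl)

  hdᶜ : {i o : D → Val} → Computes i o → Computes i (hdᵛ ∘ o)
  hdᶜ {i} {o} c = prim ∘ᶜ c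
    where
    hd≤ : ∀ v → size (hdᵛ v) ≤ size v
    hd≤ nil     = ≤-refl
    hd≤ (a ∙ b) = m≤n⇒m≤1+n (m≤m+n _ _)
    prim : Computes o (hdᵛ ∘ o)
    prim = computes hd X (λ d → 1 , hd , size≥1 _) (λ d → hd≤ (o d))

  tlᶜ : {i o : D → Val} → Computes i o → Computes i (tlᵛ ∘ o)
  tlᶜ {i} {o} c = prim ∘ᶜ c
    where
    tl≤ : ∀ v → size (tlᵛ v) ≤ size v
    tl≤ nil     = ≤-refl
    tl≤ (a ∙ b) = m≤n⇒m≤1+n (m≤n+m _ _)
    prim : Computes o (tlᵛ ∘ o)
    prim = computes tl X (λ d → 1 , tl , size≥1 _) (λ d → tl≤ (o d))

  infixr 5 _∙ᶜ_
  _∙ᶜ_ : {i a b : D → Val} → Computes i a → Computes i b → Computes i (λ d → a d ∙ b d)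
  computes p P rp sp ∙ᶜ computes q Q rq sq =
    computes (cons p q) (con 1 ⊕ (P ⊕ Q)) (λ d → cons′ (rp d) (rq d)) (λ d → s≤s (+-mono-≤ (sp d) (sq d)))

  ifᶜ : {i b x y : D → Val} → Computes i b → Computes i x → Computes i y →
        Computes i (λ d → ifᵛ (b d) (x d) (y d))
  ifᶜ {i} {b} {x} {y} (computes c C rc sc) (computes p P rp sp) (computes q Q rq sq) =
    computes (cond c p q) (con 1 ⊕ (C ⊕ (P ⊕ Q))) runs smalls
    where
    runs : ∀ d → cond c p q ⊢ i d ⇓ ifᵛ (b d) (x d) (y d) ≤[ _ ]
    runs d with b d | rc d
    ... | nil   | t , r , t≤ = let u , r′ , u≤ = rq d in
      _ , cond-false r r′ , s≤s (+-mono-≤ t≤ (≤-trans u≤ (m≤n+m _ _)))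
    ... | _ ∙ _ | t , r , t≤ = let u , r′ , u≤ = rp d in
      _ , cond-true r r′ , s≤s (+-mono-≤ t≤ (≤-trans u≤ (m≤m+n _ _)))
    smalls : ∀ d → size (ifᵛ (b d) (x d) (y d)) ≤ suc (⟪ C ⟫ (size (i d)) + (⟪ P ⟫ (size (i d)) + ⟪ Q ⟫ (size (i d))))
    smalls d with b d
    ... | nil   = m≤n⇒m≤1+n (≤-trans (sq d) (m≤n⇒m≤o+n (⟪ C ⟫ (size (i d))) (m≤n+m _ (⟪ P ⟫ (size (i d))))))
    ... | _ ∙ _ = m≤n⇒m≤1+n (≤-trans (sp d) (m≤n⇒m≤o+n (⟪ C ⟫ (size (i d))) (m≤m+n _ (⟪ Q ⟫ (size (i d))))))

  infixl 4 _≗ᶜ_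
  _≗ᶜ_ : {i o o′ : D → Val} → Computes i o → (∀ d → o d ≡ o′ d) → Computes i o′
  computes p P r s ≗ᶜ eq = computes p P
    (λ d → subst (λ v → p ⊢ _ ⇓ v ≤[ _ ]) (eq d) (r d))
    (λ d → subst (λ v → size v ≤ _) (eq d) (s d))

  -- A program sees encodings only. So the domain may be exchanged for one that carries more, such
  -- as a feasibility proof or a whole instance, which the encoding does not show.
  reindex : {D′ : Set} {i o : D → Val} (f : D′ → D) → Computes i o → Computes (i ∘ f) (o ∘ f)
  reindex f (computes p P r s) = computes p P (r ∘ f) (s ∘ f)

runs-in-poly-time : {I : Set} {enc o : I → Val} (c : Computes enc o) → RunsInPolyTime (prog c) enc
runs-in-poly-time {enc = enc} {o} (computes p P r s) with pol-bound P
... | c , d , b = c , d , λ i → let t , e , t≤ = r i in o i , t , e , ≤-trans t≤ (b (size (enc i)) (size≥1 (enc i)))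

-- Loops over lists: running time and size of the accumulator

length≤size : ∀ {A : Set} (f : A → Val) xs → length xs ≤ size (encList f xs)
length≤size f []       = z≤n
length≤size f (x ∷ xs) = s≤s (≤-trans (length≤size f xs) (m≤n+m _ _))

list≤state : ∀ s l e → size l ≤ size ((s ∙ l) ∙ e)
list≤state s l e = m≤n⇒m≤1+n (m≤n⇒m≤n+o (size e) (m≤n⇒m≤1+n (m≤n+m (size l) (size s))))

head≤state : ∀ s l e → size s ≤ size ((s ∙ l) ∙ e)
head≤state s l e = m≤n⇒m≤1+n (m≤n⇒m≤n+o (size e) (m≤n⇒m≤1+n (m≤m+n (size s) (size l))))

-- Iterating a polynomial body can produce values of exponential size, so the accumulator needs a
-- bound of its own. As `bounded` speaks of all lists, it applies to the prefix processed so far.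
-- The environment `e d` is carried along unchanged.
module _ {D A S : Set} (e : D → Val) (eA : A → Val) (eS : S → Val) (f : D → S → A → S)
         (body : Computes {D × S × A} (λ (d , s , a) → eS s ∙ (eA a ∙ e d)) (λ (d , s , a) → eS (f d s a)))
         (B : Pol)
         (bounded : ∀ d s as → size (eS (foldl (f d) s as)) ≤
                      ⟪ B ⟫ (size ((eS s ∙ encList eA as) ∙ e d)))
         where

  private
    P = pol body
    test : Prog
    test = hd ⨾ tl
    -- (s ∙ (a ∙ as)) ∙ e  ↦  (f s a ∙ as) ∙ e
    iteration : Prog
    iteration = cons (cons (cons (hd ⨾ hd) (cons (hd ⨾ tl ⨾ hd) tl) ⨾ prog body) (hd ⨾ tl ⨾ tl)) tl

    state : D → S → List A → Val
    state d s as = (eS s ∙ encList eA as) ∙ e d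

    iterate-once : ∀ d s a as → iteration ⊢ state d s (a ∷ as) ⇓ state d (f d s a) as
              ≤[ 24 + ⟪ P ⟫ (size (eS s ∙ (eA a ∙ e d))) ]
    iterate-once d s a as with run body (d , s , a)
    ... | t , r , t≤ =
      -- Apart from the body, rearranging the state takes exactly 20 steps; 24 is a generous bound.
      _ , cons (cons (seq (cons (seq hd hd) (cons (seq hd (seq tl hd)) tl)) r) (seq hd (seq tl tl))) tl
        , ≤-trans (≤-reflexive (time t)) (+-mono-≤ {20} {24} (m≤m+n 20 4) t≤)
      where
      time : ∀ t → suc (suc (12 + t + 5) + 1) ≡ 20 + t
      time t = cong suc (trans (+-comm (suc (12 + t + 5)) 1) (cong (2 +_) (+-comm (12 + t) 5)))

    -- The body is bounded only on the states that this run meets; its time may grow with the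
    -- accumulator.
    data Within (T : ℕ) (d : D) : S → List A → Set where
      []  : ∀ {s} → Within T d s []
      _∷_ : ∀ {s a as} → ⟪ P ⟫ (size (eS s ∙ (eA a ∙ e d))) ≤ T → Within T d (f d s a) as → Within T d s (a ∷ as)

    loop : ∀ {T U} → 24 + T ≤ U → ∀ d s as → Within T d s as →
           while test iteration ⊢ state d s as ⇓ state d (foldl (f d) s as) [] ≤[ 4 + length as * (4 + U) ]
    loop T≤U d s []       []       = _ , while-stop (seq hd tl) , ≤-refl
    loop {T} {U} T≤U d s (a ∷ as) (b ∷ bs) =
      let t , r , t≤ = iterate-once d s a as ; u , r′ , u≤ = loop T≤U d (f d s a) as bs in
      _ , while-step (seq hd tl) r r′ , (begin
        4 + t + u                                        ≤⟨ +-mono-≤ (+-monoʳ-≤ 4 (≤-trans t≤ (≤-trans (+-monoʳ-≤ 24 b) T≤U))) u≤ ⟩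
        (4 + U) + (4 + length as * (4 + U))              ≡⟨ +-assoc (4 + U) 4 _ ⟨
        (4 + U + 4) + length as * (4 + U)                ≡⟨ cong (_+ length as * (4 + U)) (+-comm (4 + U) 4) ⟩
        4 + ((4 + U) + length as * (4 + U))              ∎)
      where open ≤-Reasoning

    within : ∀ T d s as → (∀ pre a post → as ≡ pre ++ a ∷ post →
               ⟪ P ⟫ (size (eS (foldl (f d) s pre) ∙ (eA a ∙ e d))) ≤ T) → Within T d s as
    within T d s []       h = []
    within T d s (a ∷ as) h = h [] a as refl ∷ within T d (f d s a) as (λ pre a′ post eq → h (a ∷ pre) a′ post (cong (a ∷_) eq))

    prefix-size : ∀ pre (a : A) post → size (encList eA pre) ≤ size (encList eA (pre ++ a ∷ post))
    prefix-size []        a post = s≤s z≤n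
    prefix-size (b ∷ pre) a post = s≤s (+-monoʳ-≤ (size (eA b)) (prefix-size pre a post))

    elem-size : ∀ pre (a : A) post → size (eA a) ≤ size (encList eA (pre ++ a ∷ post))
    elem-size []        a post = m≤n⇒m≤1+n (m≤m+n (size (eA a)) _)
    elem-size (b ∷ pre) a post = m≤n⇒m≤1+n (m≤n⇒m≤o+n (size (eA b)) (elem-size pre a post))

    -- Bounds the argument of the loop body by the size of the initial state.
    Body : Pol
    Body = P ∘ᵖ (con 1 ⊕ (B ⊕ (con 1 ⊕ (X ⊕ X))))

    body-bound : ∀ d s as pre a post → as ≡ pre ++ a ∷ post →
                 ⟪ P ⟫ (size (eS (foldl (f d) s pre) ∙ (eA a ∙ e d))) ≤ ⟪ Body ⟫ (size (state d s as))
    body-bound d s as pre a post refl = begin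
      ⟪ P ⟫ (suc (size (eS (foldl (f d) s pre)) + suc (size (eA a) + size (e d))))
        ≤⟨ ⟪⟫-mono P (s≤s (+-mono-≤ (≤-trans (bounded d s pre) (⟪⟫-mono B shorter)) (s≤s (+-mono-≤ elem env)))) ⟩
      ⟪ P ⟫ (suc (⟪ B ⟫ N + suc (N + N)))
        ≡⟨ ⟪⟫-∘ P (con 1 ⊕ (B ⊕ (con 1 ⊕ (X ⊕ X)))) N ⟨
      ⟪ Body ⟫ N ∎
      where
      open ≤-Reasoning
      N = size (state d s (pre ++ a ∷ post))
      shorter : size (state d s pre) ≤ N
      shorter = s≤s (+-monoˡ-≤ _ (s≤s (+-monoʳ-≤ (size (eS s)) (prefix-size pre a post))))
      env : size (e d) ≤ N
      env = m≤n⇒m≤1+n (m≤n+m (size (e d)) (size (eS s ∙ encList eA (pre ++ a ∷ post))))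
      elem : size (eA a) ≤ N
      elem = ≤-trans (elem-size pre a post) (list≤state (eS s) _ (e d))

  foldlᶜ : Computes {D × S × List A} (λ (d , s , as) → (eS s ∙ encList eA as) ∙ e d)
                                     (λ (d , s , as) → eS (foldl (f d) s as))
  foldlᶜ = computes (while test iteration ⨾ hd ⨾ hd) (con 8 ⊕ (X ⊛ (con 4 ⊕ (con 24 ⊕ Body)) ⊕ B)) runs
    (λ (d , s , as) → ≤-trans (bounded d s as) (m≤n⇒m≤o+n 8 (m≤n+m _ (size (state d s as) * (4 + (24 + ⟪ Body ⟫ (size (state d s as))))))))
    where
    open ≤-Reasoning
    runs : ∀ x → _
    runs (d , s , as) with loop ≤-refl d s as (within _ d s as (body-bound d s as))
    ... | t , r , t≤ = _ , seq r (seq hd hd) , (begin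
        suc (t + 3)                                     ≤⟨ s≤s (+-monoˡ-≤ 3 t≤) ⟩
        suc (4 + length as * U + 3)                     ≡⟨ +-comm (5 + length as * U) 3 ⟩
        8 + length as * U                               ≤⟨ +-monoʳ-≤ 8 (*-monoˡ-≤ U len) ⟩
        8 + N * U                                       ≤⟨ +-monoʳ-≤ 8 (m≤m+n _ _) ⟩
        8 + (N * U + ⟪ B ⟫ N)                           ∎)
      where
      N = size (state d s as)
      U = 4 + (24 + ⟪ Body ⟫ N)
      len : length as ≤ N
      len = ≤-trans (length≤size eA as) (list≤state (eS s) _ (e d))

size-ʳ++ : ∀ {A : Set} (f : A → Val) xs ys → size (encList f (xs ʳ++ ys)) ≤ size (encList f xs) + size (encList f ys)
size-ʳ++ f []       ys = n≤1+n _
size-ʳ++ f (x ∷ xs) ys = begin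
  size (encList f (xs ʳ++ x ∷ ys))                                     ≤⟨ size-ʳ++ f xs (x ∷ ys) ⟩
  size (encList f xs) + suc (size (f x) + size (encList f ys))         ≡⟨ +-suc _ _ ⟩
  suc (size (encList f xs) + (size (f x) + size (encList f ys)))       ≡⟨ cong suc (+-assoc (size (encList f xs)) _ _) ⟨
  suc (size (encList f xs) + size (f x) + size (encList f ys))         ≡⟨ cong (λ z → suc (z + size (encList f ys))) (+-comm (size (encList f xs)) _) ⟩
  suc (size (f x) + size (encList f xs)) + size (encList f ys)         ∎
  where open ≤-Reasoning

foldl-flip-∷ : ∀ {A : Set} (xs ys : List A) → foldl (flip _∷_) ys xs ≡ xs ʳ++ ys
foldl-flip-∷ []       ys = refl
foldl-flip-∷ (x ∷ xs) ys = foldl-flip-∷ xs (x ∷ ys)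

reverseᶜ : ∀ {A : Set} (f : A → Val) → Computes (encList f) (encList f ∘ reverse)
reverseᶜ f = reindex (λ xs → tt , [] , xs) loop ∘ᶜ ((nilᶜ ∙ᶜ idᶜ) ∙ᶜ nilᶜ) ≗ᶜ λ xs → cong (encList f) (foldl-flip-∷ xs [])
  where
  loop = foldlᶜ {D = ⊤} (λ _ → nil) f (encList f) (λ _ → flip _∷_)
           (hdᶜ (tlᶜ idᶜ) ∙ᶜ hdᶜ idᶜ) X
           (λ _ ys xs → ≤-trans (≤-reflexive (cong (size ∘ encList f) (foldl-flip-∷ xs ys)))
              (≤-trans (size-ʳ++ f xs ys) (≤-trans (≤-reflexive (+-comm (size (encList f xs)) _))
                (m≤n⇒m≤1+n (m≤n⇒m≤n+o 1 (n≤1+n (size (encList f ys) + size (encList f xs))))))))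

-- If a step adds an amount that depends on the element and the environment but not on the
-- accumulator, the increments merely sum up. All loops of the term language below are justified by
-- this criterion.
foldl-additive : ∀ {A S : Set} (eA : A → Val) (eS : S → Val) (f : S → A → S) (P : Pol) N →
                 (∀ s a → size (eS (f s a)) ≤ size (eS s) + ⟪ P ⟫ (size (eA a) + N)) →
                 ∀ s as → size (eS (foldl f s as)) ≤ size (eS s) + length as * ⟪ P ⟫ (size (encList eA as) + N)
foldl-additive eA eS f P N h s []       = ≤-reflexive (sym (+-identityʳ _))
foldl-additive eA eS f P N h s (a ∷ as) = begin
  size (eS (foldl f (f s a) as))                                         ≤⟨ foldl-additive eA eS f P N h (f s a) as ⟩
  size (eS (f s a)) + length as * ⟪ P ⟫ (size (encList eA as) + N)       ≤⟨ +-mono-≤ (h s a) (*-monoʳ-≤ (length as) (⟪⟫-mono P (+-monoˡ-≤ N (m≤n⇒m≤1+n (m≤n+m _ (size (eA a)))))))  ⟩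
  size (eS s) + ⟪ P ⟫ (size (eA a) + N) + length as * Y                  ≤⟨ +-monoˡ-≤ _ (+-monoʳ-≤ (size (eS s)) (⟪⟫-mono P (+-monoˡ-≤ N (m≤n⇒m≤1+n (m≤m+n (size (eA a)) _))))) ⟩
  size (eS s) + Y + length as * Y                                        ≡⟨ +-assoc (size (eS s)) Y _ ⟩
  size (eS s) + (Y + length as * Y)                                      ∎
  where
  open ≤-Reasoning
  Y = ⟪ P ⟫ (size (encList eA (a ∷ as)) + N)

foldlᶜ⁺ : ∀ {D A S : Set} (e : D → Val) (eA : A → Val) (eS : S → Val) (f : D → S → A → S) →
          Computes {D × S × A} (λ (d , s , a) → eS s ∙ (eA a ∙ e d)) (λ (d , s , a) → eS (f d s a)) →
          (P : Pol) → (∀ d s a → size (eS (f d s a)) ≤ size (eS s) + ⟪ P ⟫ (size (eA a) + size (e d))) →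
          Computes {D × S × List A} (λ (d , s , as) → (eS s ∙ encList eA as) ∙ e d)
                                    (λ (d , s , as) → eS (foldl (f d) s as))
foldlᶜ⁺ e eA eS f body P h = foldlᶜ e eA eS f body (X ⊕ X ⊛ P)
  (λ d s as → ≤-trans (foldl-additive eA eS (f d) P (size (e d)) (h d) s as)
    (+-mono-≤ (head≤state (eS s) (encList eA as) (e d))
      (*-mono-≤ (≤-trans (length≤size eA as) (list≤state (eS s) _ (e d)))
                (⟪⟫-mono P (m≤n⇒m≤1+n (+-monoˡ-≤ (size (e d)) (m≤n⇒m≤1+n (m≤n+m _ (size (eS s))))))))))

-- Stated for bare encodings and not for terms of the language, because it has to map the assumed
-- program over a list of CDS instances, which are not data of any `Ty`.
mapᶜ : ∀ {D : Set} {i o : D → Val} → Computes i o → Computes (encList i) (encList o)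
mapᶜ {D} {i} {o} c =
  reindex (λ xs → tt , [] , xs) loop ∘ᶜ ((nilᶜ ∙ᶜ reverseᶜ i) ∙ᶜ nilᶜ)
  ≗ᶜ λ xs → cong (encList o) (trans (sym (foldl-reverse xs)) (reverse-involutive xs))
  where
  foldl-reverse : ∀ (xs : List D) → reverse (reverse xs) ≡ foldl (flip _∷_) [] (reverse xs)
  foldl-reverse xs = sym (foldl-flip-∷ (reverse xs) [])
  loop : Computes {⊤ × List D × List D} (λ (_ , s , xs) → (encList o s ∙ encList i (reverse xs)) ∙ nil)
                                        (λ (_ , s , xs) → encList o (foldl (flip _∷_) s (reverse xs)))
  loop = reindex (λ (u , s , xs) → u , s , reverse xs)
    (foldlᶜ⁺ (λ _ → nil) i (encList o) (λ _ → flip _∷_)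
      (reindex (λ (_ , _ , a) → a) c ∘ᶜ hdᶜ (tlᶜ idᶜ) ∙ᶜ hdᶜ idᶜ) (con 1 ⊕ pol c)
      (λ _ s a → ≤-trans (≤-reflexive (cong suc (+-comm (size (o a)) _)))
        (≤-trans (≤-reflexive (sym (+-suc (size (encList o s)) _)))
          (+-monoʳ-≤ (size (encList o s)) (s≤s (≤-trans (small c a) (⟪⟫-mono (pol c) (m≤m+n _ _))))))))

-- A language of polynomial-time functions

iter : {A : Set} → (A → A) → A → ℕ → A
iter f s zero    = s
iter f s (suc n) = f (iter f s n)

-- The value n means that there is no such i < n.
find : ℕ → (ℕ → Bool) → ℕ
find zero    p = 0
find (suc n) p = if p 0 then 0 else suc (find n (p ∘ suc))

headOr : {A : Set} → A → List A → A
headOr d []      = d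
headOr d (x ∷ _) = x

nth : {A : Set} → A → List A → ℕ → A
nth d xs i = headOr d (drop i xs)

-- `nat` is unary, so a loop may run as often as any `nat` says. Numbers that can be exponential in
-- the input, such as costs, are kept as lists of `bool`.
data Ty : Set where
  bool nat : Ty
  list     : Ty → Ty
  _⊗_      : Ty → Ty → Ty

infixr 6 _⊗_

⟦_⟧ : Ty → Set
⟦ bool ⟧   = Bool
⟦ nat ⟧    = ℕ
⟦ list τ ⟧ = List ⟦ τ ⟧
⟦ σ ⊗ τ ⟧  = ⟦ σ ⟧ × ⟦ τ ⟧

enc : ∀ τ → ⟦ τ ⟧ → Val
enc bool     b       = encBool b
enc nat      n       = encUnary n
enc (list τ) xs      = encList (enc τ) xs
enc (σ ⊗ τ)  (x , y) = enc σ x ∙ enc τ y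

∣_∣ : ∀ {τ} → ⟦ τ ⟧ → ℕ
∣_∣ {τ} x = size (enc τ x)

Env : List Ty → Set
Env []      = ⊤
Env (τ ∷ Γ) = ⟦ τ ⟧ × Env Γ

encEnv : ∀ {Γ} → Env Γ → Val
encEnv {[]}    tt      = nil
encEnv {τ ∷ Γ} (x , γ) = enc τ x ∙ encEnv γ

-- Terms carry their own polynomial-time programs, so that the algorithm is
-- written, and reasoned about, as an ordinary function.
record Fn (Γ : List Ty) (τ : Ty) : Set where
  constructor fn
  field
    fun   : Env Γ → ⟦ τ ⟧
    compᶠ : Computes (encEnv {Γ}) (enc τ ∘ fun)

open Fn public

private variable
  Γ Δ   : List Ty
  σ τ : Ty

-- Only the program of `F` is retained. The function `f` is what the correctness proofs see, so it
-- can be written in the most convenient form.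
as : (f : Env Γ → ⟦ τ ⟧) (F : Fn Γ τ) → (∀ γ → fun F γ ≡ f γ) → Fn Γ τ
as {τ = τ} f F eq = fn f (compᶠ F ≗ᶜ λ γ → cong (enc τ) (eq γ))

wk : Fn Γ τ → Fn (σ ∷ Γ) τ
wk (fn f c) = fn (f ∘ proj₂) (reindex proj₂ c ∘ᶜ (tlᶜ idᶜ ≗ᶜ λ _ → refl))

v0 : Fn (τ ∷ Γ) τ
v0 = fn proj₁ (hdᶜ idᶜ)

v1 : Fn (σ ∷ τ ∷ Γ) τ
v1 = wk v0

v2 : ∀ {α β} → Fn (α ∷ β ∷ τ ∷ Γ) τ
v2 = wk v1

v3 : ∀ {α β γ} → Fn (α ∷ β ∷ γ ∷ τ ∷ Γ) τ
v3 = wk v2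

v4 : ∀ {α β γ δ} → Fn (α ∷ β ∷ γ ∷ δ ∷ τ ∷ Γ) τ
v4 = wk v3

v5 : ∀ {α β γ δ ε} → Fn (α ∷ β ∷ γ ∷ δ ∷ ε ∷ τ ∷ Γ) τ
v5 = wk v4

v6 : ∀ {α β γ δ ε ζ} → Fn (α ∷ β ∷ γ ∷ δ ∷ ε ∷ ζ ∷ τ ∷ Γ) τ
v6 = wk v5

infixr 5 _,,_
data Args (Γ : List Ty) : List Ty → Set where
  ·    : Args Γ []
  _,,_ : Fn Γ τ → Args Γ Δ → Args Γ (τ ∷ Δ)

eval : Args Γ Δ → Env Γ → Env Δ
eval ·         γ = tt
eval (F ,, Fs) γ = fun F γ , eval Fs γ

evalᶜ : (Fs : Args Γ Δ) → Computes (encEnv {Γ}) (encEnv ∘ eval Fs)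
evalᶜ ·         = nilᶜ
evalᶜ (F ,, Fs) = compᶠ F ∙ᶜ evalᶜ Fs

infix 9 _$_
_$_ : Fn Δ τ → Args Γ Δ → Fn Γ τ
F $ Fs = fn (fun F ∘ eval Fs) (reindex (eval Fs) (compᶠ F) ∘ᶜ evalᶜ Fs)

infixr 4 _&_
_&_ : Fn Γ σ → Fn Γ τ → Fn Γ (σ ⊗ τ)
F & G = fn (λ γ → fun F γ , fun G γ) (compᶠ F ∙ᶜ compᶠ G)

fstF : Fn Γ (σ ⊗ τ) → Fn Γ σ
fstF F = fn (proj₁ ∘ fun F) (hdᶜ (compᶠ F) ≗ᶜ λ _ → refl)

sndF : Fn Γ (σ ⊗ τ) → Fn Γ τ
sndF F = fn (proj₂ ∘ fun F) (tlᶜ (compᶠ F) ≗ᶜ λ _ → refl)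

falseF trueF : Fn Γ bool
falseF = fn (λ _ → false) nilᶜ
trueF  = fn (λ _ → true) (nilᶜ ∙ᶜ nilᶜ)

nilF : Fn Γ (list τ)
nilF = fn (λ _ → []) nilᶜ

infixr 5 _∷F_
_∷F_ : Fn Γ τ → Fn Γ (list τ) → Fn Γ (list τ)
F ∷F G = fn (λ γ → fun F γ ∷ fun G γ) (compᶠ F ∙ᶜ compᶠ G)

sucF : Fn Γ nat → Fn Γ nat
sucF F = fn (suc ∘ fun F) (nilᶜ ∙ᶜ compᶠ F)

litF : ℕ → Fn Γ nat
litF zero    = fn (λ _ → 0) nilᶜ
litF (suc n) = sucF (litF n)

constF : ℕ → Fn Γ nat
constF n = as (λ _ → n) (litF n) (lit≡ n)
  where
  lit≡ : ∀ n (γ : Env Γ) → fun (litF {Γ} n) γ ≡ n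
  lit≡ zero    γ = refl
  lit≡ (suc n) γ = cong suc (lit≡ n γ)

ifF : Fn Γ bool → Fn Γ τ → Fn Γ τ → Fn Γ τ
ifF {τ = τ} B F G = fn (λ γ → if fun B γ then fun F γ else fun G γ)
  (ifᶜ (compᶠ B) (compᶠ F) (compᶠ G) ≗ᶜ λ γ → encIf (fun B γ) (fun F γ) (fun G γ))
  where
  encIf : ∀ b x y → ifᵛ (encBool b) (enc τ x) (enc τ y) ≡ enc τ (if b then x else y)
  encIf false x y = refl
  encIf true  x y = refl

headOrF : Fn Γ τ → Fn Γ (list τ) → Fn Γ τ
headOrF {τ = τ} D F = fn (λ γ → headOr (fun D γ) (fun F γ))
  (ifᶜ (compᶠ F) (hdᶜ (compᶠ F)) (compᶠ D) ≗ᶜ λ γ → encHead (fun D γ) (fun F γ))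
  where
  encHead : ∀ d xs → ifᵛ (encList (enc τ) xs) (hdᵛ (encList (enc τ) xs)) (enc τ d) ≡ enc τ (headOr d xs)
  encHead d []       = refl
  encHead d (x ∷ xs) = refl

tailF : Fn Γ (list τ) → Fn Γ (list τ)
tailF {τ = τ} F = fn (drop 1 ∘ fun F) (tlᶜ (compᶠ F) ≗ᶜ λ γ → encTail (fun F γ))
  where
  encTail : ∀ xs → tlᵛ (encList (enc τ) xs) ≡ encList (enc τ) (drop 1 xs)
  encTail []       = refl
  encTail (x ∷ xs) = refl

predF : Fn Γ nat → Fn Γ nat
predF F = fn (pred ∘ fun F) (tlᶜ (compᶠ F) ≗ᶜ λ γ → encPred (fun F γ))
  where
  encPred : ∀ n → tlᵛ (encUnary n) ≡ encUnary (pred n)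
  encPred zero    = refl
  encPred (suc n) = refl

-- A unary number and a list of that many `false` have literally the same encoding. This turns loops
-- over numbers into folds over lists.
unitsF : Fn Γ nat → Fn Γ (list bool)
unitsF F = fn (λ γ → replicate (fun F γ) false) (compᶠ F ≗ᶜ λ γ → encUnits (fun F γ))
  where
  encUnits : ∀ n → encUnary n ≡ encList encBool (replicate n false)
  encUnits zero    = refl
  encUnits (suc n) = cong (nil ∙_) (encUnits n)

Growth : Fn (τ ∷ σ ∷ Γ) τ → Pol → Set
Growth {τ} {σ} {Γ} F P = ∀ (γ : Env Γ) (s : ⟦ τ ⟧) (a : ⟦ σ ⟧) →
  ∣_∣ {τ} (fun F (s , a , γ)) ≤ ∣_∣ {τ} s + ⟪ P ⟫ (∣_∣ {σ} a + size (encEnv γ))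

foldlF : Fn Γ (list σ) → Fn Γ τ → (F : Fn (τ ∷ σ ∷ Γ) τ) (P : Pol) → Growth F P → Fn Γ τ
foldlF {Γ} {σ} {τ} L S F P g = fn (λ γ → foldl (λ s a → fun F (s , a , γ)) (fun S γ) (fun L γ))
  (reindex (λ γ → γ , fun S γ , fun L γ)
     (foldlᶜ⁺ (encEnv {Γ}) (enc σ) (enc τ) (λ γ s a → fun F (s , a , γ))
        (reindex (λ (γ , s , a) → s , a , γ) (compᶠ F)) P g)
   ∘ᶜ ((compᶠ S ∙ᶜ compᶠ L) ∙ᶜ idᶜ))

reverseF : Fn Γ (list τ) → Fn Γ (list τ)
reverseF {τ = τ} F = fn (reverse ∘ fun F) (reindex (fun F) (reverseᶜ (enc τ)) ∘ᶜ compᶠ F)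

foldrF : Fn Γ (list σ) → Fn Γ τ → (F : Fn (τ ∷ σ ∷ Γ) τ) (P : Pol) → Growth F P → Fn Γ τ
foldrF L S F P g = as (λ γ → foldr (λ a s → fun F (s , a , γ)) (fun S γ) (fun L γ))
  (foldlF (reverseF L) S F P g)
  (λ γ → trans (sym (reverse-foldr _ _ (reverse (fun L γ)))) (cong (foldr _ _) (reverse-involutive (fun L γ))))

iterF : Fn Γ nat → Fn Γ τ → (F : Fn (τ ∷ Γ) τ) (P : Pol) →
        (∀ γ s → ∣_∣ {τ} (fun F (s , γ)) ≤ ∣_∣ {τ} s + ⟪ P ⟫ (size (encEnv γ))) → Fn Γ τ
iterF {Γ} {τ} N S F P g = as (λ γ → iter (λ s → fun F (s , γ)) (fun S γ) (fun N γ))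
  (foldrF (unitsF N) S (fn (λ (s , a , γ) → fun F (s , γ)) (reindex (λ (s , a , γ) → s , γ) (compᶠ F) ∘ᶜ (hdᶜ idᶜ ∙ᶜ tlᶜ (tlᶜ idᶜ)))) P
    (λ γ s a → ≤-trans (g γ s) (+-monoʳ-≤ (∣_∣ {τ} s) (⟪⟫-mono P (m≤n+m _ (∣_∣ {bool} a))))))
  (λ γ → iterate (λ s → fun F (s , γ)) (fun S γ) (fun N γ))
  where
  iterate : ∀ (f : ⟦ τ ⟧ → ⟦ τ ⟧) s n → foldr (λ _ → f) s (replicate n false) ≡ iter f s n
  iterate f s zero    = refl
  iterate f s (suc n) = cong f (iterate f s n)

size-encUnary : ∀ n → size (encUnary n) ≡ suc (n * 2)
size-encUnary zero    = refl
size-encUnary (suc n) = cong (2 +_) (size-encUnary n)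

n≤size-encUnary : ∀ n → n ≤ size (encUnary n)
n≤size-encUnary n = ≤-trans (m≤m*n n 2) (≤-trans (n≤1+n _) (≤-reflexive (sym (size-encUnary n))))

size-encUnary-mono : ∀ {m n} → m ≤ n → size (encUnary m) ≤ size (encUnary n)
size-encUnary-mono {m} {n} m≤n rewrite size-encUnary m | size-encUnary n = s≤s (*-monoˡ-≤ 2 m≤n)

addF : Fn Γ nat → Fn Γ nat → Fn Γ nat
addF F G = as (λ γ → fun F γ + fun G γ)
  (iterF F G (sucF v0) (con 2) (λ γ s → ≤-reflexive (+-comm 2 (∣_∣ {nat} s))))
  (λ γ → lem (fun F γ) (fun G γ))
  where
  lem : ∀ m n → iter suc n m ≡ m + n
  lem zero    n = refl
  lem (suc m) n = cong suc (lem m n)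

monusF : Fn Γ nat → Fn Γ nat → Fn Γ nat
monusF F G = as (λ γ → fun F γ ∸ fun G γ)
  (iterF G F (predF v0) (con 0) (λ γ s → m≤n⇒m≤n+o 0 (size-encUnary-mono (pred[n]≤n {s}))))
  (λ γ → lem (fun F γ) (fun G γ))
  where
  lem : ∀ m n → iter pred m n ≡ m ∸ n
  lem m zero    = refl
  lem m (suc n) = trans (cong pred (lem m n)) (pred[m∸n]≡m∸[1+n] m n)

size-+ : ∀ m n → size (encUnary (m + n)) ≤ size (encUnary n) + size (encUnary m)
size-+ m n = ≤-trans (≤-reflexive (trans (size-encUnary (m + n)) (cong suc (*-distribʳ-+ 2 m n))))
  (≤-trans (≤-reflexive (trans (cong suc (+-comm (m * 2) (n * 2))) (cong (_+ m * 2) (sym (size-encUnary n)))))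
           (+-monoʳ-≤ (size (encUnary n)) (≤-trans (n≤1+n _) (≤-reflexive (sym (size-encUnary m))))))

mulF : Fn Γ nat → Fn Γ nat → Fn Γ nat
mulF F G = as (λ γ → fun F γ * fun G γ)
  (iterF F (litF 0) (addF (wk G) v0) (pol (compᶠ G))
    (λ γ s → ≤-trans (size-+ (fun G γ) s) (+-monoʳ-≤ (∣_∣ {nat} s) (small (compᶠ G) γ))))
  (λ γ → lem (fun F γ) (fun G γ))
  where
  lem : ∀ m n → iter (n +_) 0 m ≡ m * n
  lem zero    n = refl
  lem (suc m) n = cong (n +_) (lem m n)

notF : Fn Γ bool → Fn Γ bool
notF F = as (not ∘ fun F) (ifF F falseF trueF) (λ γ → lem (fun F γ))
  where
  lem : ∀ b → (if b then false else true) ≡ not b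
  lem false = refl
  lem true  = refl

infixr 6 _∧F_
infixr 5 _∨F_
_∧F_ _∨F_ : Fn Γ bool → Fn Γ bool → Fn Γ bool
F ∧F G = as (λ γ → fun F γ ∧ fun G γ) (ifF F G falseF) (λ γ → lem (fun F γ) (fun G γ))
  where
  lem : ∀ a b → (if a then b else false) ≡ a ∧ b
  lem false b = refl
  lem true  b = refl
F ∨F G = as (λ γ → fun F γ ∨ fun G γ) (ifF F trueF G) (λ γ → lem (fun F γ) (fun G γ))
  where
  lem : ∀ a b → (if a then true else b) ≡ a ∨ b
  lem false b = refl
  lem true  b = refl

ltF : Fn Γ nat → Fn Γ nat → Fn Γ bool
ltF F G = as (λ γ → fun F γ <ᵇ fun G γ) (positiveF (monusF G F)) (λ γ → lem (fun F γ) (fun G γ))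
  where
  encPositive : ∀ n → ifᵛ (encUnary n) (encBool true) (encBool false) ≡ encBool (0 <ᵇ n)
  encPositive zero    = refl
  encPositive (suc n) = refl
  positiveF : Fn Γ nat → Fn Γ bool
  positiveF F = fn (λ γ → 0 <ᵇ fun F γ) (ifᶜ (compᶠ F) (nilᶜ ∙ᶜ nilᶜ) nilᶜ ≗ᶜ λ γ → encPositive (fun F γ))
  lem : ∀ m n → (0 <ᵇ n ∸ m) ≡ (m <ᵇ n)
  lem zero    n       = refl
  lem (suc m) zero    = refl
  lem (suc m) (suc n) = lem m n

eqF : Fn Γ nat → Fn Γ nat → Fn Γ bool
eqF F G = as (λ γ → fun F γ ≡ᵇ fun G γ) (notF (ltF F G) ∧F notF (ltF G F)) (λ γ → lem (fun F γ) (fun G γ))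
  where
  lem : ∀ m n → not (m <ᵇ n) ∧ not (n <ᵇ m) ≡ (m ≡ᵇ n)
  lem zero    zero    = refl
  lem zero    (suc n) = refl
  lem (suc m) zero    = refl
  lem (suc m) (suc n) = lem m n

lengthF : Fn Γ (list τ) → Fn Γ nat
lengthF F = as (length ∘ fun F)
  (foldrF F (litF 0) (sucF v0) (con 2) (λ γ s a → ≤-reflexive (+-comm 2 (∣_∣ {nat} s))))
  (λ γ → lem (fun F γ))
  where
  lem : ∀ {A : Set} (xs : List A) → foldr (λ _ → suc) 0 xs ≡ length xs
  lem []       = refl
  lem (x ∷ xs) = cong suc (lem xs)

mapF : Fn Γ (list σ) → Fn (σ ∷ Γ) τ → Fn Γ (list τ)
mapF {Γ} {σ} {τ} L F = as (λ γ → map (λ x → fun F (x , γ)) (fun L γ))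
  (foldrF L nilF (wk F ∷F v0) (con 1 ⊕ (pol (compᶠ F) ∘ᵖ (con 1 ⊕ X)))
    (λ γ s a → begin
       suc (∣_∣ {τ} (fun F (a , γ)) + ∣_∣ {list τ} s)  ≡⟨ cong suc (+-comm (∣_∣ {τ} (fun F (a , γ))) _) ⟩
       suc (∣_∣ {list τ} s + ∣_∣ {τ} (fun F (a , γ)))  ≡⟨ +-suc _ _ ⟨
       ∣_∣ {list τ} s + suc (∣_∣ {τ} (fun F (a , γ)))  ≤⟨ +-monoʳ-≤ (∣_∣ {list τ} s) (s≤s (small (compᶠ F) (a , γ))) ⟩
       ∣_∣ {list τ} s + suc (⟪ pol (compᶠ F) ⟫ (suc (∣_∣ {σ} a + size (encEnv γ))))
         ≡⟨ cong (λ z → ∣_∣ {list τ} s + suc z) (⟪⟫-∘ (pol (compᶠ F)) (con 1 ⊕ X) _) ⟨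
       _ ∎))
  (λ γ → lem (λ x → fun F (x , γ)) (fun L γ))
  where
  open ≤-Reasoning
  lem : ∀ {A B : Set} (f : A → B) xs → foldr (λ a s → f a ∷ s) [] xs ≡ map f xs
  lem f []       = refl
  lem f (x ∷ xs) = cong (f x ∷_) (lem f xs)

filterF : Fn Γ (list σ) → Fn (σ ∷ Γ) bool → Fn Γ (list σ)
filterF {Γ} {σ} L F = as (λ γ → filterᵇ (λ x → fun F (x , γ)) (fun L γ))
  (foldrF L nilF (ifF (wk F) (v1 ∷F v0) v0) (con 1 ⊕ X) grows)
  (λ γ → lem (λ x → fun F (x , γ)) (fun L γ))
  where
  grows : Growth {list σ} {σ} {Γ} (ifF (wk F) (v1 ∷F v0) v0) (con 1 ⊕ X)
  grows γ s a with fun F (a , γ)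
  ... | true  = ≤-trans (≤-reflexive (trans (cong suc (+-comm (∣_∣ {σ} a) _)) (sym (+-suc (∣_∣ {list σ} s) _))))
                        (+-monoʳ-≤ (∣_∣ {list σ} s) (s≤s (m≤m+n _ _)))
  ... | false = m≤m+n _ _
  lem : ∀ {A : Set} (p : A → Bool) xs → foldr (λ a s → if p a then a ∷ s else s) [] xs ≡ filterᵇ p xs
  lem p []       = refl
  lem p (x ∷ xs) with p x
  ... | true  = cong (x ∷_) (lem p xs)
  ... | false = lem p xs

upToF : Fn Γ nat → Fn Γ (list nat)
upToF {Γ} N = as (λ γ → upTo (fun N γ))
  -- The list is built from its last entry downwards: the length of what is already there determines
  -- the next number to put in front.
  (iterF N nilF (monusF (wk N) (sucF (lengthF v0)) ∷F v0) (con 1 ⊕ pol (compᶠ N))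
    (λ γ s → begin
      suc (size (encUnary (fun N γ ∸ suc (length s))) + ∣_∣ {list nat} s)
        ≤⟨ s≤s (+-monoˡ-≤ _ (≤-trans (size-encUnary-mono (m∸n≤m (fun N γ) (suc (length s)))) (small (compᶠ N) γ))) ⟩
      suc (⟪ pol (compᶠ N) ⟫ (size (encEnv γ)) + ∣_∣ {list nat} s)  ≡⟨ +-comm (suc (⟪ pol (compᶠ N) ⟫ (size (encEnv γ)))) _ ⟩
      ∣_∣ {list nat} s + suc (⟪ pol (compᶠ N) ⟫ (size (encEnv γ)))  ∎))
  (λ γ → lem (fun N γ))
  where
  open ≤-Reasoning
  countdown : ℕ → List ℕ → List ℕ
  countdown n s = (n ∸ suc (length s)) ∷ s
  partial : ∀ n k → k ≤ n → iter (countdown n) [] k ≡ applyUpTo (n ∸ k +_) k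
  partial n zero    _   = refl
  partial n (suc k) k<n with iter (countdown n) [] k | partial n k (<⇒≤ k<n)
  ... | ._ | refl = cong₂ _∷_
    (trans (cong (λ z → n ∸ suc z) (length-applyUpTo _ k)) (sym (+-identityʳ _)))
    (ext k (λ i → trans (cong (_+ i) (sym (m∸suc k<n))) (sym (+-suc (n ∸ suc k) i))))
    where
    m∸suc : ∀ {n k} → k < n → suc (n ∸ suc k) ≡ n ∸ k
    m∸suc (s≤s {n = n} k≤n) = sym (+-∸-assoc 1 k≤n)
    ext : ∀ {f g : ℕ → ℕ} k → (∀ i → f i ≡ g i) → applyUpTo f k ≡ applyUpTo g k
    ext zero    eq = refl
    ext (suc k) eq = cong₂ _∷_ (eq 0) (ext k (eq ∘ suc))
  lem : ∀ n → iter (countdown n) [] n ≡ upTo n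
  lem n = trans (partial n n ≤-refl) (cong (λ z → applyUpTo (z +_) n) (n∸n≡0 n))

tabF : Fn Γ nat → Fn (nat ∷ Γ) τ → Fn Γ (list τ)
tabF N F = as (λ γ → applyUpTo (λ i → fun F (i , γ)) (fun N γ)) (mapF (upToF N) F) (λ γ → map-upTo _ (fun N γ))

encBool≤3 : ∀ b → size (encBool b) ≤ 3
encBool≤3 false = s≤s z≤n
encBool≤3 true  = ≤-refl

boolGrowth : (F : Fn (bool ∷ σ ∷ Γ) bool) → Growth F (con 3)
boolGrowth F γ s a = ≤-trans (encBool≤3 (fun F (s , a , γ))) (m≤n+m 3 _)

orF andF : Fn Γ (list bool) → Fn Γ bool
orF  F = foldrF F falseF (v1 ∨F v0) (con 3) (boolGrowth (v1 ∨F v0))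
andF F = foldrF F trueF (v1 ∧F v0) (con 3) (boolGrowth (v1 ∧F v0))

sumF : Fn Γ (list nat) → Fn Γ nat
sumF F = foldrF F (litF 0) (addF v1 v0) X
  (λ γ s a → ≤-trans (size-+ a s) (+-monoʳ-≤ (∣_∣ {nat} s) (m≤m+n _ _)))

findF : Fn Γ nat → Fn (nat ∷ Γ) bool → Fn Γ nat
findF N F = as (λ γ → find (fun N γ) (λ i → fun F (i , γ)))
  (foldrF (tabF N F) (litF 0) (ifF v1 (litF 0) (sucF v0)) (con 2) grows)
  (λ γ → lem (fun N γ) (λ i → fun F (i , γ)))
  where
  grows : Growth {nat} {bool} {Γ} (ifF v1 (litF 0) (sucF v0)) (con 2)
  grows γ s true  = ≤-trans (size≥1 (encUnary s)) (m≤m+n _ 2)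
  grows γ s false = ≤-reflexive (+-comm 2 (∣_∣ {nat} s))
  lem : ∀ n p → foldr (λ b s → if b then 0 else suc s) 0 (applyUpTo p n) ≡ find n p
  lem zero    p = refl
  lem (suc n) p = cong (if p 0 then 0 else_) (cong suc (lem n (p ∘ suc)))

size-drop1 : ∀ {A : Set} (f : A → Val) xs → size (encList f (drop 1 xs)) ≤ size (encList f xs)
size-drop1 f []       = ≤-refl
size-drop1 f (x ∷ xs) = m≤n⇒m≤1+n (m≤n+m _ _)

nthF : Fn Γ τ → Fn Γ (list τ) → Fn Γ nat → Fn Γ τ
nthF {τ = τ} D L N = as (λ γ → nth (fun D γ) (fun L γ) (fun N γ))
  (headOrF D (iterF N L (tailF v0) (con 0) (λ γ s → m≤n⇒m≤n+o 0 (size-drop1 (enc τ) s))))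
  (λ γ → cong (headOr (fun D γ)) (lem (fun L γ) (fun N γ)))
  where
  drop1-drop : ∀ {A : Set} n (xs : List A) → drop 1 (drop n xs) ≡ drop (suc n) xs
  drop1-drop zero    xs       = refl
  drop1-drop (suc n) []       = refl
  drop1-drop (suc n) (x ∷ xs) = drop1-drop n xs
  lem : ∀ {A : Set} (xs : List A) n → iter (drop 1) xs n ≡ drop n xs
  lem xs zero    = refl
  lem xs (suc n) = trans (cong (drop 1) (lem xs n)) (drop1-drop n xs)

size-++ : ∀ {A : Set} (f : A → Val) xs ys → size (encList f (xs ++ ys)) ≤ size (encList f ys) + size (encList f xs)
size-++ f []       ys = m≤m+n _ _
size-++ f (x ∷ xs) ys = begin
  suc (size (f x) + size (encList f (xs ++ ys)))                       ≤⟨ s≤s (+-monoʳ-≤ (size (f x)) (size-++ f xs ys)) ⟩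
  suc (size (f x) + (size (encList f ys) + size (encList f xs)))       ≡⟨ cong suc (+-assoc (size (f x)) _ _) ⟨
  suc (size (f x) + size (encList f ys) + size (encList f xs))         ≡⟨ cong (λ z → suc (z + size (encList f xs))) (+-comm (size (f x)) _) ⟩
  suc (size (encList f ys) + size (f x) + size (encList f xs))         ≡⟨ cong suc (+-assoc (size (encList f ys)) _ _) ⟩
  suc (size (encList f ys) + (size (f x) + size (encList f xs)))       ≡⟨ +-suc _ _ ⟨
  size (encList f ys) + suc (size (f x) + size (encList f xs))         ∎
  where open ≤-Reasoning

appendF : Fn Γ (list τ) → Fn Γ (list τ) → Fn Γ (list τ)
appendF {τ = τ} F G = as (λ γ → fun F γ ++ fun G γ)
  (foldrF F G (v1 ∷F v0) (con 1 ⊕ X)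
    (λ γ s a → ≤-trans (≤-reflexive (trans (cong suc (+-comm (∣_∣ {τ} a) _)) (sym (+-suc (∣_∣ {list τ} s) _))))
                        (+-monoʳ-≤ (∣_∣ {list τ} s) (s≤s (m≤m+n _ _)))))
  (λ γ → lem (fun F γ) (fun G γ))
  where
  lem : ∀ {A : Set} (xs ys : List A) → foldr _∷_ ys xs ≡ xs ++ ys
  lem []       ys = refl
  lem (x ∷ xs) ys = cong (x ∷_) (lem xs ys)

productF : Fn Γ (list σ) → Fn Γ (list τ) → Fn Γ (list (σ ⊗ τ))
productF {Γ} {σ} {τ} F G = as (λ γ → cartesianProduct (fun F γ) (fun G γ))
  (foldrF F nilF (appendF (wk row) v0) (pol (compᶠ row) ∘ᵖ (con 1 ⊕ X))
    (λ γ s a → ≤-trans (size-++ (enc (σ ⊗ τ)) (fun row (a , γ)) s)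
      (+-monoʳ-≤ (∣_∣ {list (σ ⊗ τ)} s) (≤-trans (small (compᶠ row) (a , γ))
        (≤-reflexive (sym (⟪⟫-∘ (pol (compᶠ row)) (con 1 ⊕ X) _)))))))
  (λ γ → lem (fun F γ) (fun G γ))
  where
  row : Fn (σ ∷ Γ) (list (σ ⊗ τ))
  row = mapF (wk G) (v1 & v0)
  lem : ∀ {A B : Set} (xs : List A) (ys : List B) → foldr (λ a s → map (λ y → a , y) ys ++ s) [] xs ≡ cartesianProduct xs ys
  lem []       ys = refl
  lem (x ∷ xs) ys = cong (map (x ,_) ys ++_) (lem xs ys)

-- Booleans, bounded search and sums

true≢false : {A : Set} {b : Bool} → b ≡ true → b ≡ false → A
true≢false refl ()

bool? : ∀ b → b ≡ true ⊎ b ≡ false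
bool? true  = inj₁ refl
bool? false = inj₂ refl

bool-ext : ∀ {a b} → (a ≡ true → b ≡ true) → (b ≡ true → a ≡ true) → a ≡ b
bool-ext {true}  {b}     f g = sym (f refl)
bool-ext {false} {true}  f g = g refl
bool-ext {false} {false} f g = refl

not-true : ∀ {b} → not b ≡ true → b ≡ false
not-true {false} _ = refl

not-intro : ∀ {b} → b ≡ false → not b ≡ true
not-intro refl = refl

not-false : ∀ {b} → not b ≡ false → b ≡ true
not-false {true} _ = refl

∧-true : ∀ {a b} → a ∧ b ≡ true → a ≡ true × b ≡ true
∧-true {true} h = refl , h

∧-intro : ∀ {a b} → a ≡ true → b ≡ true → a ∧ b ≡ true
∧-intro refl h = h

∨-true : ∀ {a b} → a ∨ b ≡ true → a ≡ true ⊎ b ≡ true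
∨-true {true}  h = inj₁ refl
∨-true {false} h = inj₂ h

∨-introˡ : ∀ {a b} → a ≡ true → a ∨ b ≡ true
∨-introˡ refl = refl

∨-introʳ : ∀ {a b} → b ≡ true → a ∨ b ≡ true
∨-introʳ {true}  h = refl
∨-introʳ {false} h = h

T→≡ : ∀ {b} → T b → b ≡ true
T→≡ {true} _ = refl

≡→T : ∀ {b} → b ≡ true → T b
≡→T refl = tt

<ᵇ-true : ∀ {m n} → (m <ᵇ n) ≡ true → m < n
<ᵇ-true {m} {n} h = <ᵇ⇒< m n (≡→T h)

<ᵇ-intro : ∀ {m n} → m < n → (m <ᵇ n) ≡ true
<ᵇ-intro h = T→≡ (<⇒<ᵇ h)

<ᵇ-false : ∀ {m n} → (m <ᵇ n) ≡ false → n ≤ m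
<ᵇ-false h = ≮⇒≥ λ m<n → true≢false (<ᵇ-intro m<n) h

≥-intro : ∀ {m n} → n ≤ m → (m <ᵇ n) ≡ false
≥-intro {m} {n} h with bool? (m <ᵇ n)
... | inj₁ t = ⊥-elim (<⇒≱ (<ᵇ-true t) h)
... | inj₂ f = f

≡ᵇ-true : ∀ {m n} → (m ≡ᵇ n) ≡ true → m ≡ n
≡ᵇ-true {m} {n} h = ≡ᵇ⇒≡ m n (≡→T h)

≡ᵇ-intro : ∀ {m n} → m ≡ n → (m ≡ᵇ n) ≡ true
≡ᵇ-intro {m} {n} h = T→≡ (≡⇒≡ᵇ m n h)

≡ᵇ-false : ∀ {m n} → (m ≡ᵇ n) ≡ false → m ≢ n
≡ᵇ-false f e = true≢false (≡ᵇ-intro e) f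

≢-intro : ∀ {m n} → m ≢ n → (m ≡ᵇ n) ≡ false
≢-intro {m} {n} h with bool? (m ≡ᵇ n)
... | inj₁ t = ⊥-elim (h (≡ᵇ-true t))
... | inj₂ f = f

find≤ : ∀ n p → find n p ≤ n
find≤ zero    p = z≤n
find≤ (suc n) p with p 0
... | true  = z≤n
... | false = s≤s (find≤ n (p ∘ suc))

find-true : ∀ n p → find n p < n → p (find n p) ≡ true
find-true (suc n) p h with bool? (p 0)
... | inj₁ t rewrite t = t
find-true (suc n) p h | inj₂ f rewrite f = find-true n (p ∘ suc) (≤-pred h)

find-min : ∀ n p i → i < find n p → p i ≡ false
find-min (suc n) p i h with bool? (p 0)
... | inj₁ t rewrite t with () ← h
find-min (suc n) p zero    h | inj₂ f = f
find-min (suc n) p (suc i) h | inj₂ f rewrite f = find-min n (p ∘ suc) i (≤-pred h)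

find-first : ∀ n p i → p i ≡ true → find n p ≤ i
find-first n p i h = ≮⇒≥ λ lt → true≢false h (find-min n p i lt)

find-found : ∀ n p i → i < n → p i ≡ true → find n p < n × p (find n p) ≡ true
find-found n p i i<n h = lt , find-true n p lt
  where lt = ≤-<-trans (find-first n p i h) i<n

find-cong : ∀ n {p q} → (∀ i → i < n → p i ≡ q i) → find n p ≡ find n q
find-cong zero    h = refl
find-cong (suc n) {p} {q} h rewrite h 0 (s≤s z≤n) | find-cong n {p ∘ suc} {q ∘ suc} (λ i i<n → h (suc i) (s≤s i<n)) = refl

drop-[] : ∀ {A : Set} i → drop {A = A} i [] ≡ []
drop-[] zero    = refl
drop-[] (suc i) = refl

nth-[] : ∀ {A : Set} (d : A) i → nth d [] i ≡ d
nth-[] d i = cong (headOr d) (drop-[] i)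

nth-applyUpTo : ∀ {A : Set} (d : A) f n {i} → i < n → nth d (applyUpTo f n) i ≡ f i
nth-applyUpTo d f (suc n) {zero}  h = refl
nth-applyUpTo d f (suc n) {suc i} h = nth-applyUpTo d (f ∘ suc) n (≤-pred h)

nth-beyond : ∀ {A : Set} (d : A) xs i → length xs ≤ i → nth d xs i ≡ d
nth-beyond d []       i       h = nth-[] d i
nth-beyond d (x ∷ xs) (suc i) h = nth-beyond d xs i (≤-pred h)

nth-tabulate : ∀ {A : Set} (d : A) n (f : Fin n → A) i → nth d (tabulate f) (toℕ i) ≡ f i
nth-tabulate d (suc n) f zero    = refl
nth-tabulate d (suc n) f (suc i) = nth-tabulate d n (f ∘ suc) i

infixl 10 _!_
_!_ : List Bool → ℕ → Bool
xs ! i = nth false xs i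

!-applyUpTo : ∀ f n {i} → i < n → applyUpTo f n ! i ≡ f i
!-applyUpTo = nth-applyUpTo false

!-bounded : ∀ xs {i} → xs ! i ≡ true → i < length xs
!-bounded xs {i} h = ≰⇒> λ le → true≢false h (nth-beyond false xs i le)

applyUpTo-ext : ∀ {A : Set} (f g : ℕ → A) n → (∀ i → i < n → f i ≡ g i) → applyUpTo f n ≡ applyUpTo g n
applyUpTo-ext f g zero    h = refl
applyUpTo-ext f g (suc n) h = cong₂ _∷_ (h 0 (s≤s z≤n)) (applyUpTo-ext (f ∘ suc) (g ∘ suc) n (λ i i<n → h (suc i) (s≤s i<n)))

or-true : ∀ p n → or (applyUpTo p n) ≡ true → ∃[ i ] i < n × p i ≡ true
or-true p (suc n) h with ∨-true {p 0} h
... | inj₁ t = 0 , s≤s z≤n , t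
... | inj₂ r with or-true (p ∘ suc) n r
...   | i , i<n , t = suc i , s≤s i<n , t

or-intro : ∀ p n {i} → i < n → p i ≡ true → or (applyUpTo p n) ≡ true
or-intro p (suc n) {zero}  h t = ∨-introˡ t
or-intro p (suc n) {suc i} h t = ∨-introʳ {p 0} (or-intro (p ∘ suc) n (≤-pred h) t)

and-true : ∀ p n → and (applyUpTo p n) ≡ true → ∀ {i} → i < n → p i ≡ true
and-true p (suc n) h {zero}  _   = proj₁ (∧-true h)
and-true p (suc n) h {suc i} i<n = and-true (p ∘ suc) n (proj₂ (∧-true {p 0} h)) (≤-pred i<n)

and-intro : ∀ p n → (∀ i → i < n → p i ≡ true) → and (applyUpTo p n) ≡ true
and-intro p zero    h = refl
and-intro p (suc n) h = ∧-intro (h 0 (s≤s z≤n)) (and-intro (p ∘ suc) n (λ i i<n → h (suc i) (s≤s i<n)))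

-- Finite sums and counting

Sum : ℕ → (ℕ → ℕ) → ℕ
Sum n f = sum (applyUpTo f n)

ι : Bool → ℕ
ι b = if b then 1 else 0

count : ℕ → (ℕ → Bool) → ℕ
count n p = Sum n (ι ∘ p)

Sum-cong : ∀ n {f g} → (∀ i → i < n → f i ≡ g i) → Sum n f ≡ Sum n g
Sum-cong n {f} {g} h = cong sum (applyUpTo-ext f g n h)

Sum-mono : ∀ n {f g} → (∀ i → i < n → f i ≤ g i) → Sum n f ≤ Sum n g
Sum-mono zero    h = z≤n
Sum-mono (suc n) h = +-mono-≤ (h 0 (s≤s z≤n)) (Sum-mono n (λ i i<n → h (suc i) (s≤s i<n)))

Sum-0 : ∀ n → Sum n (λ _ → 0) ≡ 0
Sum-0 zero    = refl
Sum-0 (suc n) = Sum-0 n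

+-interchange : ∀ a b c d → (a + b) + (c + d) ≡ (a + c) + (b + d)
+-interchange a b c d = trans (+-assoc a b (c + d)) (trans (cong (a +_) (trans (sym (+-assoc b c d)) (trans (cong (_+ d) (+-comm b c)) (+-assoc c b d)))) (sym (+-assoc a c (b + d))))

Sum-+ : ∀ n f g → Sum n (λ i → f i + g i) ≡ Sum n f + Sum n g
Sum-+ zero    f g = refl
Sum-+ (suc n) f g = trans (cong (f 0 + g 0 +_) (Sum-+ n (f ∘ suc) (g ∘ suc))) (+-interchange (f 0) (g 0) _ _)

Sum-swap : ∀ m n (f : ℕ → ℕ → ℕ) → Sum m (λ i → Sum n (f i)) ≡ Sum n (λ j → Sum m (λ i → f i j))
Sum-swap zero    n f = sym (Sum-0 n)
Sum-swap (suc m) n f = trans (cong (Sum n (f 0) +_) (Sum-swap m n (f ∘ suc))) (sym (Sum-+ n (f 0) _))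

Sum-const : ∀ n c → Sum n (λ _ → c) ≡ n * c
Sum-const zero    c = refl
Sum-const (suc n) c = cong (c +_) (Sum-const n c)

Sum-single : ∀ n x → Sum n (λ i → ι (x ≡ᵇ i)) ≤ 1
Sum-single zero    x       = z≤n
Sum-single (suc n) zero    = s≤s (≤-reflexive (Sum-0 n))
Sum-single (suc n) (suc x) = Sum-single n x

term≤Sum : ∀ n f i → i < n → f i ≤ Sum n f
term≤Sum (suc n) f zero    h = m≤m+n _ _
term≤Sum (suc n) f (suc i) h = ≤-trans (term≤Sum n (f ∘ suc) i (≤-pred h)) (m≤n+m _ _)

ι≤1 : ∀ b → ι b ≤ 1
ι≤1 true  = ≤-refl
ι≤1 false = z≤n

ι-mono : ∀ {a b} → (a ≡ true → b ≡ true) → ι a ≤ ι b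
ι-mono {false} h = z≤n
ι-mono {true}  h rewrite h refl = ≤-refl

count≤ : ∀ n p → count n p ≤ n
count≤ n p = ≤-trans (Sum-mono n (λ i _ → ι≤1 (p i))) (≤-reflexive (trans (Sum-const n 1) (*-identityʳ n)))

count-mono : ∀ n {p q} → (∀ i → i < n → p i ≡ true → q i ≡ true) → count n p ≤ count n q
count-mono n h = Sum-mono n (λ i i<n → ι-mono (h i i<n))

count-insert : ∀ n {p q} y → y < n → p y ≡ false → (∀ i → i < n → q i ≡ p i ∨ (i ≡ᵇ y)) → count n q ≡ suc (count n p)
count-insert (suc n) {p} {q} zero _ py h
  rewrite h 0 (s≤s z≤n) | py =
  cong suc (Sum-cong n (λ i i<n → cong ι (trans (h (suc i) (s≤s i<n)) (lem (p (suc i))))))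
  where
  lem : ∀ b → b ∨ false ≡ b
  lem true  = refl
  lem false = refl
count-insert (suc n) {p} {q} (suc y) y<n py h
  rewrite count-insert n {p ∘ suc} {q ∘ suc} y (≤-pred y<n) py (λ i i<n → h (suc i) (s≤s i<n))
        | h 0 (s≤s z≤n) with p 0
... | true  = refl
... | false = refl

-- Double counting: the fibres of o are disjoint.
Sum-fibres : ∀ n J (b : ℕ → Bool) (o : ℕ → ℕ) →
             Sum n (λ i → count J (λ j → b j ∧ (o j ≡ᵇ i))) ≤ count J b
Sum-fibres n J b o = ≤-trans (≤-reflexive (Sum-swap n J _)) (Sum-mono J (λ j _ → lem (b j) (o j)))
  where
  lem : ∀ c x → Sum n (λ i → ι (c ∧ (x ≡ᵇ i))) ≤ ι c
  lem true  x = Sum-single n x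
  lem false x = ≤-reflexive (Sum-0 n)

Sum≤-by-fibres : ∀ n J (b : ℕ → Bool) (o : ℕ → ℕ) (w : ℕ → ℕ) →
                 (∀ i → i < n → w i ≤ count J (λ j → b j ∧ (o j ≡ᵇ i))) → Sum n w ≤ count J b
Sum≤-by-fibres n J b o w h = ≤-trans (Sum-mono n h) (Sum-fibres n J b o)

-- Comparing multiples of rationals

Bits : Set
Bits = List Bool

-- Bijective base 2, as in encBinary: the digits false and true stand for 2 and 1.
val : Bits → ℕ
val []          = 0
val (false ∷ b) = 2 * suc (val b)
val (true ∷ b)  = suc (2 * val b)

-- Binary numerals with arbitrary digits, which spares carries when multiplying.
valᶜ : List ℕ → ℕ
valᶜ []       = 0
valᶜ (c ∷ cs) = c + 2 * valᶜ cs

digits : Bits → List ℕ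
digits = map (λ b → if b then 1 else 2)

valᶜ-digits : ∀ b → valᶜ (digits b) ≡ val b
valᶜ-digits []          = refl
valᶜ-digits (false ∷ b) rewrite valᶜ-digits b = sym (*-suc 2 (val b))
valᶜ-digits (true ∷ b)  rewrite valᶜ-digits b = refl

align : List ℕ → List ℕ → List (ℕ × ℕ)
align []       q       = map (0 ,_) q
align (x ∷ p)  []      = (x , 0) ∷ align p []
align (x ∷ p)  (y ∷ q) = (x , y) ∷ align p q

align-nth : ∀ p q → applyUpTo (λ i → nth 0 p i , nth 0 q i) (length p + (length q ∸ length p)) ≡ align p q
align-nth []      q       = lem q
  where
  lem : ∀ q → applyUpTo (λ i → nth 0 [] i , nth 0 q i) (length q) ≡ map (0 ,_) q
  lem []      = refl
  lem (x ∷ q) = cong ((0 , x) ∷_) (trans (applyUpTo-ext _ _ (length q) (λ i _ → cong (_, nth 0 q i) (sym (nth-[] 0 i)))) (lem q))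
align-nth (x ∷ p) []      = cong ((x , 0) ∷_) (trans (cong₂ applyUpTo′ refl (cong (length p +_) (sym (0∸n≡0 (length p)))))
    (trans (applyUpTo-ext _ _ (length p + (0 ∸ length p)) (λ i _ → cong (nth 0 p i ,_) (sym (nth-[] 0 i)))) (align-nth p [])))
  where
  applyUpTo′ : (ℕ → ℕ × ℕ) → ℕ → List (ℕ × ℕ)
  applyUpTo′ = applyUpTo
align-nth (x ∷ p) (y ∷ q) = cong ((x , y) ∷_) (align-nth p q)

addᶜ : List ℕ → List ℕ → List ℕ
addᶜ p q = map (λ xy → proj₁ xy + proj₂ xy) (align p q)

scaleᶜ : ℕ → List ℕ → List ℕ
scaleᶜ c = map (c *_)

-- Horner's scheme: the lowest digit times `q`, plus twice the product of the remaining digits with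
-- `q`.
mulᶜ : List ℕ → List ℕ → List ℕ
mulᶜ p q = foldr (λ c s → addᶜ (scaleᶜ c q) (0 ∷ s)) [] p

valᶜ-add : ∀ p q → valᶜ (addᶜ p q) ≡ valᶜ p + valᶜ q
valᶜ-add []      []      = refl
valᶜ-add []      (y ∷ q) = cong (λ z → y + 2 * z) (valᶜ-add [] q)
valᶜ-add (x ∷ p) []      rewrite valᶜ-add p [] =
  solve 2 (λ x p → x :+ con 0 :+ con 2 :* (p :+ con 0) := x :+ con 2 :* p :+ con 0) refl x (valᶜ p)
  where open +-*-Solver
valᶜ-add (x ∷ p) (y ∷ q) rewrite valᶜ-add p q =
  solve 4 (λ x y p q → x :+ y :+ con 2 :* (p :+ q) := x :+ con 2 :* p :+ (y :+ con 2 :* q)) refl x y (valᶜ p) (valᶜ q)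
  where open +-*-Solver

valᶜ-scale : ∀ c p → valᶜ (scaleᶜ c p) ≡ c * valᶜ p
valᶜ-scale c []      = sym (*-zeroʳ c)
valᶜ-scale c (x ∷ p) rewrite valᶜ-scale c p =
  solve 3 (λ c x p → c :* x :+ con 2 :* (c :* p) := c :* (x :+ con 2 :* p)) refl c x (valᶜ p)
  where open +-*-Solver

valᶜ-mul : ∀ p q → valᶜ (mulᶜ p q) ≡ valᶜ p * valᶜ q
valᶜ-mul []      q = refl
valᶜ-mul (x ∷ p) q rewrite valᶜ-add (scaleᶜ x q) (0 ∷ mulᶜ p q) | valᶜ-scale x q | valᶜ-mul p q =
  solve 3 (λ x p q → x :* q :+ con 2 :* (p :* q) := (x :+ con 2 :* p) :* q) refl x (valᶜ p) (valᶜ q)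
  where open +-*-Solver

-- Without carries the digits grow, and they are unary. But sizes only add up, so that each row of a
-- product enlarges the accumulator by a bounded amount.
size-addᶜ : ∀ p q → ∣_∣ {list nat} (addᶜ p q) ≤ ∣_∣ {list nat} p + ∣_∣ {list nat} q
size-addᶜ []      []      = s≤s z≤n
size-addᶜ []      (y ∷ q) = ≤-trans (s≤s (+-monoʳ-≤ _ (size-addᶜ [] q))) (≤-reflexive (cong suc (+-suc _ _)))
size-addᶜ (x ∷ p) []      rewrite +-identityʳ x =
  ≤-trans (s≤s (+-monoʳ-≤ (size (encUnary x)) (size-addᶜ p []))) (≤-reflexive (cong suc (sym (+-assoc (size (encUnary x)) _ 1))))
size-addᶜ (x ∷ p) (y ∷ q) = begin
  suc (size (encUnary (x + y)) + ∣_∣ {list nat} (addᶜ p q))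
    ≤⟨ s≤s (+-mono-≤ (size-+ x y) (size-addᶜ p q)) ⟩
  suc (Y + X′ + (P + Q))
    ≡⟨ cong suc (solve 4 (λ y x p q → y :+ x :+ (p :+ q) := x :+ p :+ (y :+ q)) refl Y X′ P Q) ⟩
  suc (X′ + P + (Y + Q))                  ≤⟨ s≤s (+-monoʳ-≤ (X′ + P) (n≤1+n (Y + Q))) ⟩
  suc (X′ + P) + suc (Y + Q)              ∎
  where
  open ≤-Reasoning
  open +-*-Solver
  X′ = size (encUnary x)
  Y  = size (encUnary y)
  P  = ∣_∣ {list nat} p
  Q  = ∣_∣ {list nat} q

digitsF : Fn Γ (list bool) → Fn Γ (list nat)
digitsF F = mapF F (ifF v0 (litF 1) (litF 2))

alignF : Fn Γ (list nat) → Fn Γ (list nat) → Fn Γ (list (nat ⊗ nat))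
alignF F G = as (λ γ → align (fun F γ) (fun G γ))
  (tabF (addF (lengthF F) (monusF (lengthF G) (lengthF F)))
        (nthF (litF 0) (wk F) v0 & nthF (litF 0) (wk G) v0))
  (λ γ → align-nth (fun F γ) (fun G γ))

addᶜF : Fn Γ (list nat) → Fn Γ (list nat) → Fn Γ (list nat)
addᶜF F G = mapF (alignF F G) (addF (fstF v0) (sndF v0))

scaleᶜF : Fn Γ nat → Fn Γ (list nat) → Fn Γ (list nat)
scaleᶜF C F = mapF F (mulF (wk C) v0)

mulᶜF : Fn Γ (list nat) → Fn Γ (list nat) → Fn Γ (list nat)
mulᶜF {Γ} F G = foldrF F nilF (addᶜF (wk row) (litF 0 ∷F v0)) (con 2 ⊕ (pol (compᶠ row) ∘ᵖ (con 1 ⊕ X)))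
  λ γ s a → begin
    ∣_∣ {list nat} (addᶜ (fun row (a , γ)) (0 ∷ s))     ≤⟨ size-addᶜ (fun row (a , γ)) (0 ∷ s) ⟩
    ∣_∣ {list nat} (fun row (a , γ)) + (2 + ∣_∣ {list nat} s) ≤⟨ +-monoˡ-≤ _ (small (compᶠ row) (a , γ)) ⟩
    ⟪ pol (compᶠ row) ⟫ (suc (∣_∣ {nat} a + size (encEnv γ))) + (2 + ∣_∣ {list nat} s)
      ≡⟨ cong (_+ (2 + ∣_∣ {list nat} s)) (⟪⟫-∘ (pol (compᶠ row)) (con 1 ⊕ X) _) ⟨
    ⟪ pol (compᶠ row) ∘ᵖ (con 1 ⊕ X) ⟫ (∣_∣ {nat} a + size (encEnv γ)) + (2 + ∣_∣ {list nat} s)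
      ≡⟨ +-comm _ (2 + ∣_∣ {list nat} s) ⟩
    2 + ∣_∣ {list nat} s + ⟪ pol (compᶠ row) ∘ᵖ (con 1 ⊕ X) ⟫ (∣_∣ {nat} a + size (encEnv γ))
      ≡⟨ cong (_+ ⟪ pol (compᶠ row) ∘ᵖ (con 1 ⊕ X) ⟫ (∣_∣ {nat} a + size (encEnv γ))) (+-comm 2 (∣_∣ {list nat} s)) ⟩
    ∣_∣ {list nat} s + 2 + ⟪ pol (compᶠ row) ∘ᵖ (con 1 ⊕ X) ⟫ (∣_∣ {nat} a + size (encEnv γ))
      ≡⟨ +-assoc (∣_∣ {list nat} s) 2 _ ⟩
    ∣_∣ {list nat} s + (2 + ⟪ pol (compᶠ row) ∘ᵖ (con 1 ⊕ X) ⟫ (∣_∣ {nat} a + size (encEnv γ))) ∎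
  where
  open ≤-Reasoning
  row : Fn (nat ∷ Γ) (list nat)
  row = scaleᶜF v0 (wk G)

-- The floor of n/2, as the least j with n < 2 (j + 1).
half : ℕ → ℕ
half n = find n (λ j → n <ᵇ 2 + (j + j))

halfF : Fn Γ nat → Fn Γ nat
halfF F = findF F (ltF (wk F) (addF (litF 2) (addF v0 v0)))

half-lower : ∀ n → half n + half n ≤ n
half-lower n with half n in eq
... | zero  = z≤n
... | suc h = ≤-trans (≤-reflexive (+-suc (suc h) h)) (<ᵇ-false (find-min n _ h (≤-reflexive (sym eq))))

half-upper : ∀ n → n ≤ suc (half n + half n)
half-upper zero    = z≤n
half-upper (suc n) = ≤-pred (<ᵇ-true (proj₂ (find-found (suc n) (λ j → suc n <ᵇ 2 + (j + j)) n ≤-refl (<ᵇ-intro (s≤s (s≤s (m≤m+n n n)))))))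

-- For s ≤ t the comparison s + 2A < t + 2B amounts to A < B + ⌈(t - s)/2⌉,
-- and for s ≥ t to A + ⌊(s - t)/2⌋ < B.
compareStep : ℕ × ℕ → ℕ × ℕ → ℕ × ℕ
compareStep (α , β) (a , b) = half ((α + a) ∸ (β + b)) , half (suc ((β + b) ∸ (α + a)))

-- The scan starts at the least significant digits. The state holds what is still to be added to the
-- two unread numerals; at the end only these two carries are left to compare.
compareDigits : List (ℕ × ℕ) → ℕ × ℕ → ℕ × ℕ
compareDigits zs s = foldl compareStep s zs

<ᵇ-cong : ∀ {a b c d} → (a < b → c < d) → (c < d → a < b) → (a <ᵇ b) ≡ (c <ᵇ d)
<ᵇ-cong f g = bool-ext (<ᵇ-intro ∘ f ∘ <ᵇ-true) (<ᵇ-intro ∘ g ∘ <ᵇ-true)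

double-<-cancel : ∀ {a b} → a + a < b + b → a < b
double-<-cancel {a} {b} h = ≰⇒> λ b≤a → <⇒≱ h (+-mono-≤ b≤a b≤a)

compareStep-correct : ∀ s t A B → (half (s ∸ t) + A <ᵇ half (suc (t ∸ s)) + B) ≡ (s + 2 * A <ᵇ t + 2 * B)
compareStep-correct s t A B with ≤-total s t
... | inj₁ s≤t rewrite m≤n⇒m∸n≡0 s≤t = <ᵇ-cong forth back
  where
  open ≤-Reasoning
  open +-*-Solver
  d = t ∸ s
  h = half (suc d)
  t≡ : s + d ≡ t
  t≡ = m+[n∸m]≡n s≤t
  forth : A < h + B → s + 2 * A < t + 2 * B
  forth lt = begin
    suc (s + 2 * A)          ≡⟨ solve 2 (λ s a → con 1 :+ (s :+ con 2 :* a) := s :+ (con 1 :+ (a :+ a))) refl s A ⟩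
    s + suc (A + A)          ≤⟨ +-monoʳ-≤ s (≤-pred (≤-trans (≤-reflexive (cong suc (sym (+-suc A A)))) (≤-trans (+-mono-≤ lt lt)
                                 (≤-trans (≤-reflexive (solve 2 (λ h b → h :+ b :+ (h :+ b) := h :+ h :+ con 2 :* b) refl h B)) (+-monoˡ-≤ (2 * B) (half-lower (suc d))))))) ⟩
    s + (d + 2 * B)          ≡⟨ +-assoc s d (2 * B) ⟨
    s + d + 2 * B            ≡⟨ cong (_+ 2 * B) t≡ ⟩
    t + 2 * B                ∎
  back : s + 2 * A < t + 2 * B → A < h + B
  back lt = double-<-cancel (begin
    suc (A + A)              ≡⟨ solve 1 (λ a → con 1 :+ (a :+ a) := con 1 :+ con 2 :* a) refl A ⟩
    suc (2 * A)              ≤⟨ +-cancelˡ-≤ s _ _ (begin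
        s + suc (2 * A)      ≡⟨ +-suc s (2 * A) ⟩
        suc (s + 2 * A)      ≤⟨ lt ⟩
        t + 2 * B            ≡⟨ cong (_+ 2 * B) t≡ ⟨
        s + d + 2 * B        ≡⟨ +-assoc s d (2 * B) ⟩
        s + (d + 2 * B)      ∎) ⟩
    d + 2 * B                ≤⟨ +-monoˡ-≤ (2 * B) (≤-pred (half-upper (suc d))) ⟩
    h + h + 2 * B            ≡⟨ solve 2 (λ h b → h :+ h :+ con 2 :* b := h :+ b :+ (h :+ b)) refl h B ⟩
    h + B + (h + B)          ∎)
... | inj₂ t≤s rewrite m≤n⇒m∸n≡0 t≤s = <ᵇ-cong forth back
  where
  open ≤-Reasoning
  open +-*-Solver
  d = s ∸ t
  h = half d
  s≡ : t + d ≡ s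
  s≡ = m+[n∸m]≡n t≤s
  forth : h + A < B → s + 2 * A < t + 2 * B
  forth lt = begin
    suc (s + 2 * A)          ≡⟨ cong (λ z → suc (z + 2 * A)) s≡ ⟨
    suc (t + d + 2 * A)      ≤⟨ s≤s (+-monoˡ-≤ (2 * A) (+-monoʳ-≤ t (half-upper d))) ⟩
    suc (t + suc (h + h) + 2 * A) ≡⟨ solve 3 (λ t h a → con 1 :+ (t :+ (con 1 :+ (h :+ h)) :+ con 2 :* a) := t :+ ((con 1 :+ (h :+ a)) :+ (con 1 :+ (h :+ a)))) refl t h A ⟩
    t + (suc (h + A) + suc (h + A)) ≤⟨ +-monoʳ-≤ t (+-mono-≤ lt lt) ⟩
    t + (B + B)              ≡⟨ solve 2 (λ t b → t :+ (b :+ b) := t :+ con 2 :* b) refl t B ⟩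
    t + 2 * B                ∎
  back : s + 2 * A < t + 2 * B → h + A < B
  back lt = double-<-cancel (+-cancelˡ-≤ t _ _ (begin
    t + suc (h + A + (h + A)) ≡⟨ solve 3 (λ t h a → t :+ (con 1 :+ (h :+ a :+ (h :+ a))) := con 1 :+ (t :+ (h :+ h) :+ con 2 :* a)) refl t h A ⟩
    suc (t + (h + h) + 2 * A) ≤⟨ s≤s (+-monoˡ-≤ (2 * A) (+-monoʳ-≤ t (half-lower d))) ⟩
    suc (t + d + 2 * A)       ≡⟨ cong (λ z → suc (z + 2 * A)) s≡ ⟩
    suc (s + 2 * A)           ≤⟨ lt ⟩
    t + 2 * B                 ≡⟨ solve 2 (λ t b → t :+ con 2 :* b := t :+ (b :+ b)) refl t B ⟩
    t + (B + B)               ∎))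

compareDigits-correct : ∀ zs α β → let (α′ , β′) = compareDigits zs (α , β) in
  (α′ <ᵇ β′) ≡ (α + valᶜ (map proj₁ zs) <ᵇ β + valᶜ (map proj₂ zs))
compareDigits-correct []             α β rewrite +-identityʳ α | +-identityʳ β = refl
compareDigits-correct ((a , b) ∷ zs) α β =
  trans (compareDigits-correct zs _ _)
    (trans (compareStep-correct (α + a) (β + b) _ _)
      (cong₂ _<ᵇ_ (+-assoc α a _) (+-assoc β b _)))

lessᶜ : List ℕ → List ℕ → Bool
lessᶜ p q = let s = compareDigits (align p q) (0 , 0) in proj₁ s <ᵇ proj₂ s

valᶜ-alignˡ : ∀ p q → valᶜ (map proj₁ (align p q)) ≡ valᶜ p
valᶜ-alignˡ []      []      = refl
valᶜ-alignˡ []      (x ∷ q) rewrite valᶜ-alignˡ [] q = refl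
valᶜ-alignˡ (x ∷ p) []      = cong (λ z → x + 2 * z) (valᶜ-alignˡ p [])
valᶜ-alignˡ (x ∷ p) (y ∷ q) = cong (λ z → x + 2 * z) (valᶜ-alignˡ p q)

valᶜ-alignʳ : ∀ p q → valᶜ (map proj₂ (align p q)) ≡ valᶜ q
valᶜ-alignʳ []      []      = refl
valᶜ-alignʳ []      (y ∷ q) = cong (λ z → y + 2 * z) (valᶜ-alignʳ [] q)
valᶜ-alignʳ (x ∷ p) []      rewrite valᶜ-alignʳ p [] = refl
valᶜ-alignʳ (x ∷ p) (y ∷ q) = cong (λ z → y + 2 * z) (valᶜ-alignʳ p q)

lessᶜ-correct : ∀ p q → lessᶜ p q ≡ (valᶜ p <ᵇ valᶜ q)
lessᶜ-correct p q = trans (compareDigits-correct (align p q) 0 0) (cong₂ _<ᵇ_ (valᶜ-alignˡ p q) (valᶜ-alignʳ p q))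

lessᶜF : Fn Γ (list nat) → Fn Γ (list nat) → Fn Γ bool
lessᶜF {Γ} F G = ltF (fstF states) (sndF states)
  where
  stepF : Fn ((nat ⊗ nat) ∷ (nat ⊗ nat) ∷ Γ) (nat ⊗ nat)
  stepF = halfF (monusF s t) & halfF (sucF (monusF t s))
    where
    s = addF (fstF v0) (fstF v1)
    t = addF (sndF v0) (sndF v1)
  open ≤-Reasoning
  open +-*-Solver
  half≤ : ∀ n → half n ≤ n
  half≤ n = ≤-trans (m≤m+n _ _) (half-lower n)
  -- Halving does not enlarge a number, so a new carry exceeds the sum of the old carry and the
  -- digit by at most 1.
  grows : Growth stepF (Pol.con 3 ⊕ X)
  grows γ (α , β) (a , b) = begin
    suc (size (encUnary (half ((α + a) ∸ (β + b)))) + size (encUnary (half (suc ((β + b) ∸ (α + a))))))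
      ≤⟨ s≤s (+-mono-≤ (≤-trans (size-encUnary-mono (≤-trans (half≤ _) (m∸n≤m (α + a) (β + b)))) (size-+ α a))
                       (≤-trans (size-encUnary-mono (≤-trans (half≤ _) (s≤s (m∸n≤m (β + b) (α + a))))) (+-monoʳ-≤ 2 (size-+ β b)))) ⟩
    suc (u a + u α + (2 + (u b + u β)))
      ≡⟨ solve 4 (λ a α b β → con 1 :+ (a :+ α :+ (con 2 :+ (b :+ β))) := con 1 :+ (α :+ β) :+ (con 2 :+ (a :+ b))) refl (u a) (u α) (u b) (u β) ⟩
    suc (u α + u β) + (2 + (u a + u b))                           ≤⟨ +-monoʳ-≤ (suc (u α + u β)) (+-monoʳ-≤ 2 (≤-trans (n≤1+n _) (≤-trans (n≤1+n _) (m≤m+n _ (size (encEnv γ)))))) ⟩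
    suc (u α + u β) + (3 + (suc (u a + u b) + size (encEnv γ)))   ∎
    where
    u : ℕ → ℕ
    u = λ x → size (encUnary x)
  states : Fn Γ (nat ⊗ nat)
  states = foldlF (alignF F G) (litF 0 & litF 0) stepF (Pol.con 3 ⊕ X) grows

Rat : Set
Rat = Bits × Bits

rat : Ty
rat = list bool ⊗ list bool

-- j·x < i·y, cross-multiplied
scaledLess : ℕ → Rat → ℕ → Rat → Bool
scaledLess j (a , b) i (c , d) = lessᶜ (scaleᶜ j (mulᶜ (digits a) (digits d))) (scaleᶜ i (mulᶜ (digits c) (digits b)))

scaledLess-correct : ∀ j a b i c d → scaledLess j (a , b) i (c , d) ≡ (j * (val a * val d) <ᵇ i * (val c * val b))
scaledLess-correct j a b i c d = trans (lessᶜ-correct (scaleᶜ j (mulᶜ (digits a) (digits d))) (scaleᶜ i (mulᶜ (digits c) (digits b)))) (cong₂ _<ᵇ_ (eq j a d) (eq i c b))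
  where
  eq : ∀ j a d → valᶜ (scaleᶜ j (mulᶜ (digits a) (digits d))) ≡ j * (val a * val d)
  eq j a d rewrite valᶜ-scale j (mulᶜ (digits a) (digits d)) | valᶜ-mul (digits a) (digits d) | valᶜ-digits a | valᶜ-digits d = refl

scaledLessF : Fn Γ nat → Fn Γ rat → Fn Γ nat → Fn Γ rat → Fn Γ bool
scaledLessF J x I y = as (λ γ → scaledLess (fun J γ) (fun x γ) (fun I γ) (fun y γ))
  (lessᶜF (scaleᶜF J (mulᶜF (digitsF (fstF x)) (digitsF (sndF y))))
          (scaleᶜF I (mulᶜF (digitsF (fstF y)) (digitsF (sndF x)))))
  (λ γ → refl)

-- The algorithm

Edges : Set
Edges = List (ℕ × ℕ)

src tgt : Edges → ℕ → ℕ
src es e = proj₁ (nth (0 , 0) es e)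
tgt es e = proj₂ (nth (0 , 0) es e)

crossing : Edges → Bits → Bits → ℕ → Bool
crossing es F V e = F ! e ∧ ((V ! src es e ∧ not (V ! tgt es e)) ∨ (not (V ! src es e) ∧ V ! tgt es e))

addEdge : ℕ → Edges → ℕ → Bits × Bits → Bits × Bits
addEdge n es e (V , E) =
  applyUpTo (λ x → V ! x ∨ ((x ≡ᵇ src es e) ∨ (x ≡ᵇ tgt es e))) n , applyUpTo (λ x → E ! x ∨ (x ≡ᵇ e)) (length es)

nextEdge : Edges → Bits → Bits → ℕ
nextEdge es F V = find (length es) (crossing es F V)

-- Prim's scheme without weights. An edge with exactly one end in the tree cannot close a cycle;
-- when no such edge is left, the step is the identity, so surplus iterations do no harm.
growStep : ℕ → Edges → Bits → Bits × Bits → Bits × Bits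
growStep n es F s =
  if nextEdge es F (proj₁ s) <ᵇ length es then addEdge n es (nextEdge es F (proj₁ s)) s else s

growStart : ℕ → Edges → ℕ → Bits × Bits
growStart n es r = applyUpTo (λ x → x ≡ᵇ r) n , applyUpTo (λ _ → false) (length es)

-- The pair consists of the nodes and the edges of the tree.
grow : ℕ → Edges → Bits → ℕ → Bits × Bits
grow n es F r = iter (growStep n es F) (growStart n es r) n

spanned grown : ℕ → Edges → Bits → ℕ → Bits
spanned n es F r = proj₁ (grow n es F r)
grown   n es F r = proj₂ (grow n es F r)

norm : ℕ → ℕ → ℕ × ℕ
norm x y = if x <ᵇ y then (x , y) else (y , x)

eqPair : ℕ × ℕ → ℕ × ℕ → Bool
eqPair (a , b) (c , d) = (a ≡ᵇ c) ∧ (b ≡ᵇ d)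

-- Nodes 0 … n-1 of the constructed graph are those of the given graph, each
-- class of nodes connected by edges of length 0 being represented by its least
-- element; nodes n … n+k-1 stand for the groups; the inner nodes of the path
-- that replaces edge e are the nodes from n+k+e·L on.
module Reduction (n : ℕ) (es : Edges) (gs : List Bits) (L : ℕ) (kept : ℕ → Bool) (len : ℕ → ℕ) where

  m k N : ℕ
  m = length es
  k = length gs
  N = n + k + m * L

  zeroEdges keptEdges : Bits
  zeroEdges = applyUpTo (λ e → kept e ∧ (len e ≡ᵇ 0)) m
  keptEdges = applyUpTo kept m

  opaque
    rep : ℕ → ℕ
    rep v = find n (λ w → spanned n es zeroEdges v ! w)

    rep-def : ∀ v → rep v ≡ find n (λ w → spanned n es zeroEdges v ! w)
    rep-def v = refl

    pathNode : ℕ → ℕ → ℕ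
    pathNode e i =
      if i ≡ᵇ 0 then rep (src es e) else
      if i ≡ᵇ len e then rep (tgt es e) else
      n + k + (e * L + (i ∸ 1))

    pathNode-def : ∀ e i → pathNode e i ≡
      (if i ≡ᵇ 0 then rep (src es e) else
       if i ≡ᵇ len e then rep (tgt es e) else
       n + k + (e * L + (i ∸ 1)))
    pathNode-def e i = refl

  -- A path between ends that were merged would be closed, and a loop if its length is 1. Such edges
  -- get no path; those of length 0 are among them.
  active : ℕ → Bool
  active e = kept e ∧ not (rep (src es e) ≡ᵇ rep (tgt es e))

  onPath : ℕ → ℕ → ℕ × ℕ → Bool
  onPath e i h = active e ∧ eqPair (norm (pathNode e i) (pathNode e (suc i))) h

  hasEdge : ℕ → ℕ × ℕ → Bool
  hasEdge e h = or (applyUpTo (λ i → onPath e i h) (len e))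

  opaque
    -- Edges of length 1 between the same two classes become one and the same edge of the simple
    -- graph, which is attributed to the first of them. Paths of greater length share no edge with
    -- others, as each of their edges has an inner node as an end.
    owner : ℕ × ℕ → ℕ
    owner h = find m (λ e → hasEdge e h)

    owner-def : ∀ h → owner h ≡ find m (λ e → hasEdge e h)
    owner-def h = refl

    position : ℕ → ℕ × ℕ → ℕ
    position e h = find (len e) (λ i → onPath e i h)

    position-def : ∀ e h → position e h ≡ find (len e) (λ i → onPath e i h)
    position-def e h = refl

  groupEdge : ℕ × ℕ → Bool
  groupEdge (x , y) = not (y <ᵇ n) ∧ ((y <ᵇ n + k) ∧
    or (applyUpTo (λ w → nth [] gs (y ∸ n) ! w ∧ (rep w ≡ᵇ x)) n))

  isEdge : ℕ × ℕ → Bool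
  isEdge h = (proj₁ h <ᵇ proj₂ h) ∧ ((owner h <ᵇ m) ∨ groupEdge h)

  opaque
    -- Filtering all pairs, instead of collecting the edges of the paths, excludes repetitions, as
    -- `Graph` demands.
    cdsEdges : Edges
    cdsEdges = filterᵇ isEdge (cartesianProduct (upTo N) (upTo N))

    cdsEdges-def : cdsEdges ≡ filterᵇ isEdge (cartesianProduct (upTo N) (upTo N))
    cdsEdges-def = refl

  cdsQ : Bits
  cdsQ = applyUpTo (λ x → (x <ᵇ n) ∨ not (x <ᵇ n + k)) N

  covered : Edges → Bits → ℕ → ℕ → Bool
  covered es′ B e i = or (applyUpTo
    (λ j → B ! j ∧ ((owner (nth (0 , 0) es′ j) ≡ᵇ e) ∧ (position e (nth (0 , 0) es′ j) ≡ᵇ i))) (length es′))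

  liftBack : Edges → Bits → Bits
  liftBack es′ B = applyUpTo
    (λ e → kept e ∧ ((len e ≡ᵇ 0) ∨ and (applyUpTo (covered es′ B e) (len e)))) m

  hitsAll : Bits → Bool
  hitsAll V = and (applyUpTo (λ i → or (applyUpTo (λ v → nth [] gs i ! v ∧ V ! v) n)) k)

  root : Bits → ℕ
  root F = find n (λ v → hitsAll (spanned n es F v))

Gst Cds Tree : Set
Gst  = ℕ × List ((ℕ × ℕ) × Rat) × List Bits
Cds  = ℕ × Edges × Bits
Tree = Bits × Bits

rat₀ : Rat
rat₀ = [] , true ∷ []

-- The parameters are the numerator and denominator of ε.
module Algorithm (εₙ εᵈ : ℕ) where

  module _ (g : Gst) where

    nodes : ℕ
    nodes = proj₁ g

    edges : Edges
    edges = map proj₁ (proj₁ (proj₂ g))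

    groups : List Bits
    groups = proj₂ (proj₂ g)

    costs : List Rat
    costs = map proj₂ (proj₁ (proj₂ g))

    cost : ℕ → Rat
    cost e = nth rat₀ costs e

    -- An upper bound on the number of edges of a tree.
    rank : ℕ
    rank = if nodes <ᵇ length edges then nodes else length edges

    -- The longest length of an edge; the edge costs are scaled by (1 + maxLen) / M.
    maxLen : ℕ
    maxLen = find (rank * εᵈ) (λ j → not (suc j * εₙ <ᵇ rank * εᵈ))

    module _ (M : Rat) where

      keep : ℕ → Bool
      keep e = not (scaledLess 1 M 1 (cost e))

      -- The least j with K c(e) ≤ (j + 1) M, which is ⌈K c(e)/M⌉ - 1 without any division; it is 0
      -- if c(e) or M is 0. For a kept edge, K c(e) ≤ K M, so the search range is large enough.
      len : ℕ → ℕ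
      len e = find maxLen (λ j → not (scaledLess (suc j) M (suc maxLen) (cost e)))

      module Red = Reduction nodes edges groups (maxLen ∸ 1) keep len

      cds : Cds
      cds = Red.N , Red.cdsEdges , Red.cdsQ

      feasible : Bool
      feasible = Red.root Red.keptEdges <ᵇ nodes

      -- Grown trees are known to have one node more than edges. Growing the returned tree anew
      -- makes this available for it, in place of a derivation from its connectedness and
      -- acyclicity.
      prune : Edges → Tree → Bits
      prune es′ (V , E) = grown Red.N es′ E (find Red.N (V !_))

      backEdges : Edges → Tree → Bits
      backEdges es′ S = Red.liftBack es′ (prune es′ S)

      opaque
        backTree : Edges → Tree → Tree
        backTree es′ S = grow nodes edges (backEdges es′ S) (Red.root (backEdges es′ S))

        backTree-def : ∀ es′ S → backTree es′ S ≡ grow nodes edges (backEdges es′ S) (Red.root (backEdges es′ S))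
        backTree-def es′ S = refl

      opaque
        score : Tree → ℕ
        score T = Sum (length edges) (λ e → if proj₂ T ! e then len e else 0) + rank

        score-def : ∀ T → score T ≡ Sum (length edges) (λ e → if proj₂ T ! e then len e else 0) + rank
        score-def T = refl

    -- The threshold 0 is added for trees without edges, which have no largest edge cost. The filter
    -- guarantees that the assumed program is asked about feasible instances only.
    thresholds : List Rat
    thresholds = filterᵇ feasible (rat₀ ∷ costs)

    questions : List (Rat × Cds)
    questions = map (λ M → M , cds M) thresholds

    -- The cost of the tree is at most the product of the two numbers, divided by 1 + maxLen.
    Candidate : Set
    Candidate = Rat × ℕ × Tree

    candidate : (Rat × Cds) × Tree → Candidate
    candidate ((M , I) , S) = M , score M (backTree M (proj₁ (proj₂ I)) S) , backTree M (proj₁ (proj₂ I)) S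

    none : Candidate
    none = rat₀ , 0 , [] , []

    noBetter : List Candidate → Candidate → Bool
    noBetter cs c = and (applyUpTo (λ b → not (scaledLess
      (proj₁ (proj₂ (nth none cs b))) (proj₁ (nth none cs b)) (proj₁ (proj₂ c)) (proj₁ c))) (length cs))

    opaque
      bestOf : List Candidate → Tree
      bestOf cs = proj₂ (proj₂ (nth none cs (find (length cs) (λ a → noBetter cs (nth none cs a)))))

      bestOf-def : ∀ cs → bestOf cs ≡ proj₂ (proj₂ (nth none cs (find (length cs) (λ a → noBetter cs (nth none cs a)))))
      bestOf-def cs = refl

    answer : List ((Rat × Cds) × Tree) → Tree
    answer ys = bestOf (map candidate ys)

-- Programs for the algorithm

pair edgesᵗ bits tree gst cdsᵗ : Ty
pair   = nat ⊗ nat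
edgesᵗ = list pair
bits   = list bool
tree   = bits ⊗ bits
gst    = nat ⊗ list (pair ⊗ rat) ⊗ list bits
cdsᵗ   = nat ⊗ edgesᵗ ⊗ bits

letF : Fn Γ σ → Fn (σ ∷ Γ) τ → Fn Γ τ
letF E B = fn (λ γ → fun B (fun E γ , γ)) (reindex (λ γ → fun E γ , γ) (compᶠ B) ∘ᶜ (compᶠ E ∙ᶜ idᶜ))

nthPairF : Fn Γ edgesᵗ → Fn Γ nat → Fn Γ pair
nthPairF = nthF (litF 0 & litF 0)

_!F_ : Fn Γ bits → Fn Γ nat → Fn Γ bool
_!F_ = nthF falseF

srcF tgtF : Fn Γ edgesᵗ → Fn Γ nat → Fn Γ nat
srcF es e = fstF (nthPairF es e)
tgtF es e = sndF (nthPairF es e)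

growCtx : List Ty
growCtx = nat ∷ bits ∷ edgesᵗ ∷ nat ∷ []

crossingC : Fn (nat ∷ bits ∷ bits ∷ edgesᵗ ∷ []) bool
crossingC = as (λ (e , V , F , es , _) → crossing es F V e)
  ((v2 !F v0) ∧F (((v1 !F srcF v3 v0) ∧F notF (v1 !F tgtF v3 v0)) ∨F (notF (v1 !F srcF v3 v0) ∧F (v1 !F tgtF v3 v0))))
  (λ _ → refl)

addEdgeC : Fn (nat ∷ tree ∷ edgesᵗ ∷ nat ∷ []) tree
addEdgeC = as (λ (e , s , es , n , _) → addEdge n es e s)
  (tabF v3 ((fstF v2 !F v0) ∨F (eqF v0 (srcF v3 v1) ∨F eqF v0 (tgtF v3 v1))) &
   tabF (lengthF v2) ((sndF v2 !F v0) ∨F eqF v0 v1))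
  (λ _ → refl)

growStepC : Fn (tree ∷ growCtx) tree
growStepC = as (λ (s , r , F , es , n , _) → growStep n es F s)
  (letF (findF (lengthF v3) (crossingC $ (v0 ,, fstF v1 ,, v3 ,, v4 ,, ·)))
        (ifF (ltF v0 (lengthF v4)) (addEdgeC $ (v0 ,, v1 ,, v4 ,, v5 ,, ·)) v1))
  (λ _ → refl)

size-applyUpTo-bool : ∀ (f : ℕ → Bool) n → size (encList encBool (applyUpTo f n)) ≤ 1 + n * 4
size-applyUpTo-bool f zero    = ≤-refl
size-applyUpTo-bool f (suc n) = s≤s (≤-trans (+-mono-≤ (encBool≤3 (f 0)) (size-applyUpTo-bool (f ∘ suc) n)) (≤-reflexive (+-suc 3 (n * 4))))

-- Every round rewrites the two lists with lengths `n` and `length es`, so the size of the state is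
-- bounded independently of the number of rounds.
growC : Fn growCtx tree
growC = as (λ (r , F , es , n , _) → grow n es F r)
  (iterF v3 (tabF v3 (eqF v0 v1) & tabF (lengthF v2) falseF) growStepC
    (con 3 ⊕ X ⊛ con 4 ⊕ X ⊛ con 4) grows)
  (λ _ → refl)
  where
  grows : ∀ (γ : Env growCtx) s → ∣_∣ {tree} (fun growStepC (s , γ)) ≤ ∣_∣ {tree} s + ⟪ con 3 ⊕ X ⊛ con 4 ⊕ X ⊛ con 4 ⟫ (size (encEnv γ))
  grows γ@(r , F , es , n , _) s with nextEdge es F (proj₁ s) <ᵇ length es
  ... | false = m≤m+n _ _
  ... | true  = ≤-trans (s≤s (+-mono-≤ (size-applyUpTo-bool _ n) (size-applyUpTo-bool _ (length es))))
     (≤-trans (≤-reflexive (cong suc (+-suc (1 + n * 4) (length es * 4))))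
       (≤-trans (+-mono-≤ (+-monoʳ-≤ 3 (*-monoˡ-≤ 4 n≤)) (*-monoˡ-≤ 4 m≤)) (m≤n+m _ (∣_∣ {tree} s))))
    where
    R = encUnary r
    n≤ : n ≤ size (encEnv {growCtx} γ)
    n≤ = ≤-trans (n≤size-encUnary n) (m≤n⇒m≤1+n (m≤n⇒m≤o+n (size R) (m≤n⇒m≤1+n (m≤n⇒m≤o+n (∣_∣ {bits} F) (m≤n⇒m≤1+n (m≤n⇒m≤o+n (∣_∣ {edgesᵗ} es) (m≤n⇒m≤1+n (m≤m+n _ 1))))))))
    m≤ : length es ≤ size (encEnv {growCtx} γ)
    m≤ = ≤-trans (length≤size (enc pair) es) (m≤n⇒m≤1+n (m≤n⇒m≤o+n (size R) (m≤n⇒m≤1+n (m≤n⇒m≤o+n (∣_∣ {bits} F) (m≤n⇒m≤1+n (m≤m+n _ _))))))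

module AlgorithmF (εₙ εᵈ : ℕ) where

  open Algorithm εₙ εᵈ

  edgesC : Fn (gst ∷ []) edgesᵗ
  edgesC = as (λ (g , _) → edges g) (mapF (fstF (sndF v0)) (fstF v0)) (λ _ → refl)

  costsC : Fn (gst ∷ []) (list rat)
  costsC = as (λ (g , _) → costs g) (mapF (fstF (sndF v0)) (sndF v0)) (λ _ → refl)

  edgesF : Fn Γ gst → Fn Γ edgesᵗ
  edgesF G = edgesC $ (G ,, ·)

  groupsF : Fn Γ gst → Fn Γ (list bits)
  groupsF G = sndF (sndF G)

  rat₀F : Fn Γ rat
  rat₀F = nilF & (trueF ∷F nilF)

  costF : Fn Γ gst → Fn Γ nat → Fn Γ rat
  costF G E = nthF rat₀F (costsC $ (G ,, ·)) E

  rankC maxLenC : Fn (gst ∷ []) nat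
  rankC = as (λ (g , _) → rank g) (ifF (ltF (fstF v0) (lengthF (edgesF v0))) (fstF v0) (lengthF (edgesF v0))) (λ _ → refl)
  maxLenC = as (λ (g , _) → maxLen g)
    (letF (mulF rankC (constF εᵈ)) (findF v0 (notF (ltF (mulF (sucF v0) (constF εₙ)) v1)))) (λ _ → refl)

  maxLenF : Fn Γ gst → Fn Γ nat
  maxLenF G = maxLenC $ (G ,, ·)

  keepC : Fn (nat ∷ rat ∷ gst ∷ []) bool
  keepC = as (λ (e , M , g , _) → keep g M e) (notF (scaledLessF (litF 1) v1 (litF 1) (costF v2 v0))) (λ _ → refl)

  lenC : Fn (nat ∷ rat ∷ gst ∷ []) nat
  lenC = as (λ (e , M , g , _) → len g M e)
    (findF (maxLenF v2) (notF (scaledLessF (sucF v0) v2 (sucF (maxLenF v3)) (costF v3 v1)))) (λ _ → refl)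

  module _ (M : Fn Γ rat) (G : Fn Γ gst) where

    mF kF nF NF : Fn Γ nat
    mF = lengthF (edgesF G)
    kF = lengthF (groupsF G)
    nF = fstF G
    NF = addF (addF nF kF) (mulF mF (monusF (maxLenF G) (litF 1)))

    keepF : Fn Γ nat → Fn Γ bool
    keepF E = keepC $ (E ,, M ,, G ,, ·)

    lenF : Fn Γ nat → Fn Γ nat
    lenF E = lenC $ (E ,, M ,, G ,, ·)

  spannedF : Fn Γ nat → Fn Γ edgesᵗ → Fn Γ bits → Fn Γ nat → Fn Γ bits
  spannedF N E F R = fstF (growC $ (R ,, F ,, E ,, N ,, ·))

  zeroEdgesC keptEdgesC : Fn (rat ∷ gst ∷ []) bits
  zeroEdgesC = as (λ (M , g , _) → Red.zeroEdges g M)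
    (tabF (mF v0 v1) (keepF v1 v2 v0 ∧F eqF (lenF v1 v2 v0) (litF 0))) (λ _ → refl)
  keptEdgesC = as (λ (M , g , _) → Red.keptEdges g M) (tabF (mF v0 v1) (keepF v1 v2 v0)) (λ _ → refl)

  repC : Fn (nat ∷ rat ∷ gst ∷ []) nat
  repC = as (λ (v , M , g , _) → Red.rep g M v)
    (findF (nF v1 v2) (spannedF (nF v2 v3) (edgesF v3) (zeroEdgesC $ (v2 ,, v3 ,, ·)) v1 !F v0)) (λ (v , M , g , _) → sym (Red.rep-def g M v))

  repF : Fn Γ rat → Fn Γ gst → Fn Γ nat → Fn Γ nat
  repF M G V = repC $ (V ,, M ,, G ,, ·)

  pathNodeC : Fn (nat ∷ nat ∷ rat ∷ gst ∷ []) nat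
  pathNodeC = as (λ (e , i , M , g , _) → Red.pathNode g M e i)
    (ifF (eqF v1 (litF 0)) (repF v2 v3 (srcF (edgesF v3) v0))
      (ifF (eqF v1 (lenF v2 v3 v0)) (repF v2 v3 (tgtF (edgesF v3) v0))
        (addF (addF (nF v2 v3) (kF v2 v3)) (addF (mulF v0 (monusF (maxLenF v3) (litF 1))) (monusF v1 (litF 1))))))
    (λ (e , i , M , g , _) → sym (Red.pathNode-def g M e i))

  normF : Fn Γ nat → Fn Γ nat → Fn Γ pair
  normF x y = as (λ γ → norm (fun x γ) (fun y γ)) (ifF (ltF x y) (x & y) (y & x)) (λ _ → refl)

  eqPairF : Fn Γ pair → Fn Γ pair → Fn Γ bool
  eqPairF p q = eqF (fstF p) (fstF q) ∧F eqF (sndF p) (sndF q)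

  onPathC : Fn (nat ∷ nat ∷ pair ∷ rat ∷ gst ∷ []) bool
  onPathC = as (λ (e , i , h , M , g , _) → Red.onPath g M e i h)
    ((keepF v3 v4 v0 ∧F notF (eqF (repF v3 v4 (srcF (edgesF v4) v0)) (repF v3 v4 (tgtF (edgesF v4) v0))))
      ∧F eqPairF (normF (pathNodeC $ (v0 ,, v1 ,, v3 ,, v4 ,, ·)) (pathNodeC $ (v0 ,, sucF v1 ,, v3 ,, v4 ,, ·))) v2)
    (λ _ → refl)

  hasEdgeC : Fn (nat ∷ pair ∷ rat ∷ gst ∷ []) bool
  hasEdgeC = as (λ (e , h , M , g , _) → Red.hasEdge g M e h)
    (orF (tabF (lenF v2 v3 v0) (onPathC $ (v1 ,, v0 ,, v2 ,, v3 ,, v4 ,, ·)))) (λ _ → refl)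

  ownerC : Fn (pair ∷ rat ∷ gst ∷ []) nat
  ownerC = as (λ (h , M , g , _) → Red.owner g M h)
    (findF (mF v1 v2) (hasEdgeC $ (v0 ,, v1 ,, v2 ,, v3 ,, ·))) (λ (h , M , g , _) → sym (Red.owner-def g M h))

  positionC : Fn (nat ∷ pair ∷ rat ∷ gst ∷ []) nat
  positionC = as (λ (e , h , M , g , _) → Red.position g M e h)
    (findF (lenF v2 v3 v0) (onPathC $ (v1 ,, v0 ,, v2 ,, v3 ,, v4 ,, ·))) (λ (e , h , M , g , _) → sym (Red.position-def g M e h))

  groupEdgeC : Fn (pair ∷ rat ∷ gst ∷ []) bool
  groupEdgeC = as (λ (h , M , g , _) → Red.groupEdge g M h)
    (notF (ltF (sndF v0) (nF v1 v2)) ∧F (ltF (sndF v0) (addF (nF v1 v2) (kF v1 v2)) ∧F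
      orF (tabF (nF v1 v2) ((nthF nilF (groupsF v3) (monusF (sndF v1) (nF v2 v3)) !F v0) ∧F eqF (repF v2 v3 v0) (fstF v1)))))
    (λ _ → refl)

  cdsEdgesC : Fn (rat ∷ gst ∷ []) edgesᵗ
  cdsEdgesC = as (λ (M , g , _) → Red.cdsEdges g M)
    (filterF (productF (upToF (NF v0 v1)) (upToF (NF v0 v1)))
      (ltF (fstF v0) (sndF v0) ∧F (ltF (ownerC $ (v0 ,, v1 ,, v2 ,, ·)) (mF v1 v2) ∨F (groupEdgeC $ (v0 ,, v1 ,, v2 ,, ·)))))
    (λ (M , g , _) → sym (Red.cdsEdges-def g M))

  cdsC : Fn (rat ∷ gst ∷ []) cdsᵗ
  cdsC = as (λ (M , g , _) → cds g M)
    (NF v0 v1 & (cdsEdgesC & tabF (NF v0 v1) (ltF v0 (nF v1 v2) ∨F notF (ltF v0 (addF (nF v1 v2) (kF v1 v2)))))) (λ _ → refl)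

  hitsAllC : Fn (bits ∷ gst ∷ []) bool
  hitsAllC = as (λ (V , g , _) → Red.hitsAll g rat₀ V)
    (andF (tabF (lengthF (groupsF v1)) (orF (tabF (fstF v2) ((nthF nilF (groupsF v3) v1 !F v0) ∧F (v2 !F v0)))))) (λ _ → refl)

  rootC : Fn (bits ∷ gst ∷ []) nat
  rootC = as (λ (F , g , _) → Red.root g rat₀ F)
    (findF (fstF v1) (hitsAllC $ (spannedF (fstF v2) (edgesF v2) v1 v0 ,, v2 ,, ·))) (λ _ → refl)

  coveredC : Fn (nat ∷ nat ∷ edgesᵗ ∷ bits ∷ rat ∷ gst ∷ []) bool
  coveredC = as (λ (e , i , es′ , B , M , g , _) → Red.covered g M es′ B e i)
    (orF (tabF (lengthF v2) ((v4 !F v0) ∧F (eqF (ownerC $ (nthPairF v3 v0 ,, v5 ,, v6 ,, ·)) v1 ∧F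
      eqF (positionC $ (v1 ,, nthPairF v3 v0 ,, v5 ,, v6 ,, ·)) v2)))) (λ _ → refl)

  backEdgesC : Fn (edgesᵗ ∷ tree ∷ rat ∷ gst ∷ []) bits
  backEdgesC = as (λ (es′ , S , M , g , _) → backEdges g M es′ S)
    (letF (sndF (growC $ (findF (NF v2 v3) (fstF v2 !F v0) ,, sndF v1 ,, v0 ,, NF v2 v3 ,, ·)))
      (tabF (mF v3 v4) (keepF v4 v5 v0 ∧F (eqF (lenF v4 v5 v0) (litF 0) ∨F
        andF (tabF (lenF v4 v5 v0) (coveredC $ (v1 ,, v0 ,, v3 ,, v2 ,, v5 ,, v6 ,, ·)))))))
    (λ _ → refl)

  backTreeC : Fn (edgesᵗ ∷ tree ∷ rat ∷ gst ∷ []) tree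
  backTreeC = as (λ (es′ , S , M , g , _) → backTree g M es′ S)
    (letF backEdgesC (growC $ (rootC $ (v0 ,, v4 ,, ·) ,, v0 ,, edgesF v4 ,, fstF v4 ,, ·))) (λ (es′ , S , M , g , _) → sym (backTree-def g M es′ S))

  scoreC : Fn (tree ∷ rat ∷ gst ∷ []) nat
  scoreC = as (λ (T , M , g , _) → score g M T)
    (addF (sumF (tabF (mF v1 v2) (ifF (sndF v1 !F v0) (lenF v2 v3 v0) (litF 0)))) (rankC $ (v2 ,, ·))) (λ (T , M , g , _) → sym (score-def g M T))

  thresholdsC : Fn (gst ∷ []) (list rat)
  thresholdsC = as (λ (g , _) → thresholds g)
    (filterF (rat₀F ∷F costsC) (ltF (rootC $ (keptEdgesC ,, v1 ,, ·)) (fstF v1))) (λ _ → refl)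

  questionsC : Fn (gst ∷ []) (list (rat ⊗ cdsᵗ))
  questionsC = as (λ (g , _) → questions g) (mapF thresholdsC (v0 & cdsC)) (λ _ → refl)

  candᵗ : Ty
  candᵗ = rat ⊗ (nat ⊗ tree)

  candidateC : Fn (((rat ⊗ cdsᵗ) ⊗ tree) ∷ gst ∷ []) candᵗ
  candidateC = as (λ (y , g , _) → candidate g y)
    (scoredC $ (backTreeC $ (fstF (sndF (sndF (fstF v0))) ,, sndF v0 ,, fstF (fstF v0) ,, v1 ,, ·) ,, fstF (fstF v0) ,, v1 ,, ·))
    (λ _ → refl)
    where
    scoredC : Fn (tree ∷ rat ∷ gst ∷ []) candᵗ
    scoredC = as (λ (T , M , g , _) → M , score g M T , T) (v1 & (scoreC & v0)) (λ _ → refl)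

  noneF : Fn Γ candᵗ
  noneF = rat₀F & (litF 0 & (nilF & nilF))

  noBetterC : Fn (candᵗ ∷ list candᵗ ∷ gst ∷ []) bool
  noBetterC = as (λ (c , cs , g , _) → noBetter g cs c)
    (andF (tabF (lengthF v1) (notF (scaledLessF (fstF (sndF (nthF noneF v2 v0))) (fstF (nthF noneF v2 v0)) (fstF (sndF v1)) (fstF v1)))))
    (λ _ → refl)

  bestOfC : Fn (list candᵗ ∷ gst ∷ []) tree
  bestOfC = as (λ (cs , g , _) → bestOf g cs)
    (sndF (sndF (nthF noneF v0 (findF (lengthF v0) (noBetterC $ (nthF noneF v1 v0 ,, v1 ,, v2 ,, ·))))))
    (λ (cs , g , _) → sym (bestOf-def g cs))

  answerC : Fn (list ((rat ⊗ cdsᵗ) ⊗ tree) ∷ gst ∷ []) tree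
  answerC = as (λ (ys , g , _) → answer g ys)
    (bestOfC $ (mapF v0 (candidateC $ (v0 ,, v2 ,, ·)) ,, v1 ,, ·))
    (λ _ → refl)

-- Growing trees

module Connection (es : Edges) where

  m : ℕ
  m = length es

  Joinsᴺ : ℕ → ℕ → ℕ → Set
  Joinsᴺ e u v = (src es e ≡ u × tgt es e ≡ v) ⊎ (src es e ≡ v × tgt es e ≡ u)

  data Conn (F : Bits) : ℕ → ℕ → Set where
    stop : ∀ {u} → Conn F u u
    step : ∀ {u v w} e → F ! e ≡ true → e < m → Joinsᴺ e u v → Conn F v w → Conn F u w

  trail : ∀ {F u v} → Conn F u v → List ℕ
  trail stop             = []
  trail (step e _ _ _ w) = e ∷ trail w

  join : ∀ {F u v} e → F ! e ≡ true → e < m → Joinsᴺ e u v → Conn F u v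
  join e h e<m j = step e h e<m j stop

  infixr 5 _▷_
  _▷_ : ∀ {F u v w} → Conn F u v → Conn F v w → Conn F u w
  stop             ▷ q = q
  step e h e<m j p ▷ q = step e h e<m j (p ▷ q)

  back : ∀ {F u v} → Conn F u v → Conn F v u
  back stop             = stop
  back (step e h e<m j p) = back p ▷ join e h e<m (swap j)

  Conn-mono : ∀ {F G u v} → (∀ e → e < m → F ! e ≡ true → G ! e ≡ true) → Conn F u v → Conn G u v
  Conn-mono h stop               = stop
  Conn-mono h (step e f e<m j p) = step e (h e e<m f) e<m j (Conn-mono h p)

module Growth (n : ℕ) (es : Edges) (ends< : ∀ e → e < length es → src es e < n × tgt es e < n) (F : Bits) (r : ℕ) (r<n : r < n) where

  open Connection es

  -- `acyclic` excludes all closed trails, more than `IsCycle` asks for, so that the induction need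
  -- not watch repeated nodes. `counts` is kept for the comparison of edge and node measures.
  record Invariant (s : Bits × Bits) : Set where
    V = proj₁ s
    E = proj₂ s
    field
      lengthV   : length V ≡ n
      lengthE   : length E ≡ m
      has-root  : V ! r ≡ true
      reachable : ∀ x → V ! x ≡ true → Conn E r x
      ends∈     : ∀ e → e < m → E ! e ≡ true → V ! src es e ≡ true × V ! tgt es e ≡ true
      E⊆F       : ∀ e → e < m → E ! e ≡ true → F ! e ≡ true
      acyclic   : ∀ u (w : Conn E u u) → Unique (trail w) → trail w ≡ []
      counts    : count n (V !_) ≡ suc (count m (E !_))

    ends∈ʲ : ∀ {e u v} → e < m → E ! e ≡ true → Joinsᴺ e u v → V ! u ≡ true × V ! v ≡ true
    ends∈ʲ e<m h (inj₁ (refl , refl)) = ends∈ _ e<m h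
    ends∈ʲ e<m h (inj₂ (refl , refl)) = proj₂ (ends∈ _ e<m h) , proj₁ (ends∈ _ e<m h)

  open Invariant

  start : Invariant (growStart n es r)
  start = record
    { lengthV   = length-applyUpTo _ n
    ; lengthE   = length-applyUpTo _ m
    ; has-root  = trans (!-applyUpTo _ n r<n) (≡ᵇ-intro {r} refl)
    ; reachable = λ x h → subst (Conn _ r) (sym (isRoot x h)) stop
    ; ends∈     = λ e e<m h → true≢false h (noEdge e e<m)
    ; E⊆F       = λ e e<m h → true≢false h (noEdge e e<m)
    ; acyclic   = λ { u stop _ → refl ; u (step e h e<m _ _) _ → true≢false h (noEdge e e<m) }
    ; counts    = trans (count-insert n {λ _ → false} r r<n refl (λ i i<n → !-applyUpTo _ n i<n))
                    (cong suc (trans (Sum-0 n) (sym (trans (Sum-cong m (λ i i<m → cong ι (noEdge i i<m))) (Sum-0 m)))))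
    }
    where
    noEdge : ∀ e → e < m → applyUpTo (λ _ → false) m ! e ≡ false
    noEdge e e<m = !-applyUpTo (λ _ → false) m e<m
    isRoot : ∀ x → applyUpTo (λ x → x ≡ᵇ r) n ! x ≡ true → x ≡ r
    isRoot x h = ≡ᵇ-true (trans (sym (!-applyUpTo (λ x → x ≡ᵇ r) n x<n)) h)
      where
      x<n : x < n
      x<n = subst (x <_) (length-applyUpTo _ n) (!-bounded _ h)

  ends<ʲ : ∀ {e u v} → e < m → Joinsᴺ e u v → u < n × v < n
  ends<ʲ e<m (inj₁ (refl , refl)) = ends< _ e<m
  ends<ʲ e<m (inj₂ (refl , refl)) = proj₂ (ends< _ e<m) , proj₁ (ends< _ e<m)

  module Extend {s : Bits × Bits} (I : Invariant s) (e : ℕ) (e<m : e < m) (Fe : F ! e ≡ true)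
                {x y : ℕ} (j : Joinsᴺ e x y) (Vx : V I ! x ≡ true) (Vy : V I ! y ≡ false) where

    s′ : Bits × Bits
    s′ = addEdge n es e s

    V′ E′ : Bits
    V′ = proj₁ s′
    E′ = proj₂ s′

    y<n : y < n
    y<n = proj₂ (ends<ʲ e<m j)

    x-or-y : ∀ {z u v} → Joinsᴺ e u v → z ≡ src es e ⊎ z ≡ tgt es e → z ≡ u ⊎ z ≡ v
    x-or-y (inj₁ (p , q)) (inj₁ a) = inj₁ (trans a p)
    x-or-y (inj₁ (p , q)) (inj₂ b) = inj₂ (trans b q)
    x-or-y (inj₂ (p , q)) (inj₁ a) = inj₂ (trans a p)
    x-or-y (inj₂ (p , q)) (inj₂ b) = inj₁ (trans b q)

    an-end : ∀ {z u v} → Joinsᴺ e u v → z ≡ v → z ≡ src es e ⊎ z ≡ tgt es e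
    an-end (inj₁ (p , q)) a = inj₂ (trans a (sym q))
    an-end (inj₂ (p , q)) a = inj₁ (trans a (sym p))

    V′-char : ∀ z → z < n → V′ ! z ≡ V I ! z ∨ (z ≡ᵇ y)
    V′-char z z<n = trans (!-applyUpTo _ n z<n) (bool-ext forth back′)
      where
      forth : V I ! z ∨ ((z ≡ᵇ src es e) ∨ (z ≡ᵇ tgt es e)) ≡ true → V I ! z ∨ (z ≡ᵇ y) ≡ true
      forth h with ∨-true {V I ! z} h
      ... | inj₁ Vz = ∨-introˡ Vz
      ... | inj₂ h′ with x-or-y {z} j (⊎.map (≡ᵇ-true {z}) (≡ᵇ-true {z}) (∨-true {z ≡ᵇ src es e} h′))
      ...   | inj₁ z≡x = ∨-introˡ {V I ! z} {z ≡ᵇ y} (subst (λ z → V I ! z ≡ true) (sym z≡x) Vx)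
      ...   | inj₂ z≡y = ∨-introʳ {V I ! z} (≡ᵇ-intro {z} z≡y)
      back′ : V I ! z ∨ (z ≡ᵇ y) ≡ true → V I ! z ∨ ((z ≡ᵇ src es e) ∨ (z ≡ᵇ tgt es e)) ≡ true
      back′ h with ∨-true {V I ! z} h
      ... | inj₁ Vz = ∨-introˡ Vz
      ... | inj₂ a  with an-end {z} j (≡ᵇ-true {z} a)
      ...   | inj₁ b = ∨-introʳ {V I ! z} (∨-introˡ (≡ᵇ-intro b))
      ...   | inj₂ b = ∨-introʳ {V I ! z} (∨-introʳ {z ≡ᵇ src es e} (≡ᵇ-intro b))

    E′-char : ∀ f → f < m → E′ ! f ≡ E I ! f ∨ (f ≡ᵇ e)
    E′-char f f<m = !-applyUpTo _ m f<m

    V⊆V′ : ∀ z → V I ! z ≡ true → V′ ! z ≡ true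
    V⊆V′ z h = trans (V′-char z (subst (z <_) (lengthV I) (!-bounded _ h))) (∨-introˡ h)

    E⊆E′ : ∀ f → f < m → E I ! f ≡ true → E′ ! f ≡ true
    E⊆E′ f f<m h = trans (E′-char f f<m) (∨-introˡ h)

    V′-elim : ∀ z → V′ ! z ≡ true → V I ! z ≡ true ⊎ z ≡ y
    V′-elim z h with ∨-true {V I ! z} (trans (sym (V′-char z (subst (z <_) (length-applyUpTo _ n) (!-bounded V′ h)))) h)
    ... | inj₁ a = inj₁ a
    ... | inj₂ a = inj₂ (≡ᵇ-true a)

    E′-elim : ∀ f → f < m → E′ ! f ≡ true → E I ! f ≡ true ⊎ f ≡ e
    E′-elim f f<m h with ∨-true {E I ! f} (trans (sym (E′-char f f<m)) h)
    ... | inj₁ a = inj₁ a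
    ... | inj₂ a = inj₂ (≡ᵇ-true a)

    ¬e : E I ! e ≡ false
    ¬e with bool? (E I ! e)
    ... | inj₂ f = f
    ... | inj₁ t = true≢false (proj₂ (ends∈ʲ I e<m t j)) Vy

    E′e : E′ ! e ≡ true
    E′e = trans (E′-char e e<m) (∨-introʳ {E I ! e} (≡ᵇ-intro {e} refl))

    -- The new node is a leaf: edges of the old tree have both ends in the old node set, and `y` is
    -- outside.
    at-y : ∀ {f u v} → f < m → E′ ! f ≡ true → Joinsᴺ f u v → u ≡ y ⊎ v ≡ y → f ≡ e
    at-y {f} f<m h jf uv with E′-elim f f<m h
    ... | inj₂ f≡e = f≡e
    at-y f<m h jf (inj₁ refl) | inj₁ Ef = true≢false (proj₁ (ends∈ʲ I f<m Ef jf)) Vy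
    at-y f<m h jf (inj₂ refl) | inj₁ Ef = true≢false (proj₂ (ends∈ʲ I f<m Ef jf)) Vy

    ends-of-e : ∀ {u v} → Joinsᴺ e u v → u ≡ y ⊎ v ≡ y
    ends-of-e jf = ⊎.map sym sym (x-or-y jf (an-end j refl))

    -- A trail avoiding y at both ends cannot visit the leaf y, as it would use e twice.
    avoids : ∀ {u v} (w : Conn E′ u v) → u ≢ y → v ≢ y → Unique (trail w) →
             Σ (Conn (E I) u v) λ w′ → trail w′ ≡ trail w
    avoids stop _ _ _ = stop , refl
    avoids (step {v = u′} f h f<m jf w) u≢y v≢y (f∉ ∷ uq) with u′ ≟ y
    ... | no u′≢y with E′-elim f f<m h
    ...   | inj₁ Ef = let w′ , eq = avoids w u′≢y v≢y uq in step f Ef f<m jf w′ , cong (f ∷_) eq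
    ...   | inj₂ refl with ends-of-e jf
    ...     | inj₁ a = ⊥-elim (u≢y a)
    ...     | inj₂ a = ⊥-elim (u′≢y a)
    avoids (step f h f<m jf stop) u≢y v≢y (f∉ ∷ uq) | yes refl = ⊥-elim (v≢y refl)
    avoids (step f h f<m jf (step g h′ g<m jg w)) u≢y v≢y ((f≢g ∷ _) ∷ uq) | yes refl =
      ⊥-elim (f≢g (trans (at-y f<m h jf (inj₂ refl)) (sym (at-y g<m h′ jg (inj₁ refl)))))

    -- This settles closed trails that begin at the leaf: their first edge is `e`, and they cannot
    -- return without using it again.
    unreachable : ∀ {u} (w : Conn E′ u y) → u ≢ y → All (e ≢_) (trail w) → ⊥
    unreachable stop u≢y _ = u≢y refl
    unreachable (step {v = u′} f h f<m jf w) u≢y (e≢f ∷ e∉) with u′ ≟ y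
    ... | yes u′≡y = e≢f (sym (at-y f<m h jf (inj₂ u′≡y)))
    ... | no u′≢y  = unreachable w u′≢y e∉

    acyclic′ : ∀ u (w : Conn E′ u u) → Unique (trail w) → trail w ≡ []
    acyclic′ u w uq with u ≟ y
    ... | no u≢y = let w′ , eq = avoids w u≢y u≢y uq in
      trans (sym eq) (acyclic I u w′ (subst Unique (sym eq) uq))
    acyclic′ u stop uq | yes refl = refl
    acyclic′ u (step {v = u′} f h f<m jf w) (f∉ ∷ uq) | yes refl with at-y f<m h jf (inj₁ refl)
    ... | refl = ⊥-elim (unreachable w u′≢y f∉)
      where
      x≢y : x ≢ y
      x≢y eq = true≢false Vx (trans (cong (V I !_) eq) Vy)
      u′≢y : u′ ≢ y
      u′≢y eq with x-or-y jf (an-end (swap j) refl)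
      ... | inj₁ a = x≢y a
      ... | inj₂ a = x≢y (trans a eq)

    extended : Invariant s′
    extended = record
      { lengthV   = length-applyUpTo _ n
      ; lengthE   = length-applyUpTo _ m
      ; has-root  = V⊆V′ r (has-root I)
      ; reachable = reach
      ; ends∈     = ends∈′
      ; E⊆F       = sub
      ; acyclic   = acyclic′
      ; counts    = trans (count-insert n y y<n Vy V′-char)
                      (cong suc (trans (counts I) (sym (count-insert m e e<m ¬e E′-char))))
      }
      where
      reach : ∀ z → V′ ! z ≡ true → Conn E′ r z
      reach z h with V′-elim z h
      ... | inj₁ Vz   = Conn-mono E⊆E′ (reachable I z Vz)
      ... | inj₂ refl = Conn-mono E⊆E′ (reachable I x Vx) ▷ join e E′e e<m j
      V′-intro : ∀ {z} → z ≡ x ⊎ z ≡ y → V′ ! z ≡ true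
      V′-intro (inj₁ eq) = subst (λ z → V′ ! z ≡ true) (sym eq) (V⊆V′ x Vx)
      V′-intro (inj₂ eq) = subst (λ z → V′ ! z ≡ true) (sym eq) (trans (V′-char y y<n) (∨-introʳ {V I ! y} (≡ᵇ-intro {y} refl)))
      ends∈′ : ∀ f → f < m → E′ ! f ≡ true → V′ ! src es f ≡ true × V′ ! tgt es f ≡ true
      ends∈′ f f<m h with E′-elim f f<m h
      ... | inj₁ Ef   = V⊆V′ (src es f) (proj₁ (ends∈ I f f<m Ef)) , V⊆V′ (tgt es f) (proj₂ (ends∈ I f f<m Ef))
      ... | inj₂ refl = V′-intro (x-or-y j (inj₁ refl)) , V′-intro (x-or-y j (inj₂ refl))
      sub : ∀ f → f < m → E′ ! f ≡ true → F ! f ≡ true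
      sub f f<m h with E′-elim f f<m h
      ... | inj₁ Ef   = E⊆F I f f<m Ef
      ... | inj₂ refl = Fe

  Closed : Bits × Bits → Set
  Closed s = nextEdge es F (proj₁ s) ≡ m

  crossing-true : ∀ V e → crossing es F V e ≡ true → F ! e ≡ true ×
    ∃[ x ] ∃[ y ] Joinsᴺ e x y × V ! x ≡ true × V ! y ≡ false
  crossing-true V e h with ∧-true h
  ... | Fe , c with ∨-true {V ! src es e ∧ not (V ! tgt es e)} c
  ...   | inj₁ c′ = Fe , _ , _ , inj₁ (refl , refl) , proj₁ (∧-true c′) , not-true (proj₂ (∧-true c′))
  ...   | inj₂ c′ = Fe , _ , _ , inj₂ (refl , refl) , proj₂ (∧-true {not (V ! src es e)} c′) , not-true (proj₁ (∧-true c′))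

  progress : ∀ {s} → Invariant s → Invariant (growStep n es F s) ×
             ((Closed s × growStep n es F s ≡ s) ⊎ count n (proj₁ (growStep n es F s) !_) ≡ suc (count n (proj₁ s !_)))
  progress {s} I with bool? (nextEdge es F (proj₁ s) <ᵇ m)
  ... | inj₂ f rewrite f = I , inj₁ (≤-antisym (find≤ m _) (<ᵇ-false f) , refl)
  ... | inj₁ t with crossing-true (proj₁ s) (nextEdge es F (proj₁ s)) (find-true m _ (<ᵇ-true t))
  ...   | Fe , x , y , j , Vx , Vy rewrite t = extended , inj₂ (count-insert n y y<n Vy V′-char)
    where open Extend I (nextEdge es F (proj₁ s)) (<ᵇ-true t) Fe j Vx Vy

  stable : ∀ s → Closed s → growStep n es F s ≡ s
  stable s cl rewrite ≥-intro {nextEdge es F (proj₁ s)} {m} (≤-reflexive (sym cl)) = refl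

  -- The start has one node and every step that is not idle adds one. After `n` rounds a set that is
  -- not closed would have more than `n` nodes.
  Advanced : ℕ → Bits × Bits → Set
  Advanced i s = Invariant s × (Closed s ⊎ i < count n (proj₁ s !_))

  advance : ∀ {i s} → Advanced i s → Advanced (suc i) (growStep n es F s)
  advance {i} {s} (I , c) with progress I
  ... | I′ , inj₁ (cl , eq) = I′ , inj₁ (subst Closed (sym eq) cl)
  ... | I′ , inj₂ eq with c
  ...   | inj₂ lt = I′ , inj₂ (subst (suc i <_) (sym eq) (s≤s lt))
  ...   | inj₁ cl = I′ , inj₁ (subst Closed (sym (stable s cl)) cl)

  grown-so-far : ∀ i → Advanced i (iter (growStep n es F) (growStart n es r) i)
  grown-so-far zero    = start , inj₂ (subst (0 <_) (sym (counts start)) (s≤s z≤n))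
  grown-so-far (suc i) = advance (grown-so-far i)

  invariant : Invariant (grow n es F r)
  invariant = proj₁ (grown-so-far n)

  closed : Closed (grow n es F r)
  closed with proj₂ (grown-so-far n)
  ... | inj₁ c  = c
  ... | inj₂ lt = ⊥-elim (<⇒≱ lt (count≤ n _))

  -- The first step of a walk that leaves the grown set would be a crossing edge, and none is left.
  spans : ∀ {x} → Conn F r x → spanned n es F r ! x ≡ true
  spans = from (has-root invariant)
    where
    W = spanned n es F r
    no-crossing : ∀ e → e < m → crossing es F W e ≡ false
    no-crossing e e<m = find-min m _ e (subst (e <_) (sym closed) e<m)
    same : ∀ a b → (a ∧ not b) ∨ (not a ∧ b) ≡ false → a ≡ b
    same true  true  _ = refl
    same false false _ = refl
    from : ∀ {u x} → W ! u ≡ true → Conn F u x → W ! x ≡ true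
    from Wu stop = Wu
    from {u} Wu (step {v = v} e Fe e<m j p) = from (trans (sym (Wu≡Wv j)) Wu) p
      where
      ends≡ : W ! src es e ≡ W ! tgt es e
      ends≡ = same _ _ (subst (λ b → b ∧ ((W ! src es e ∧ not (W ! tgt es e)) ∨ (not (W ! src es e) ∧ W ! tgt es e)) ≡ false) Fe (no-crossing e e<m))
      Wu≡Wv : Joinsᴺ e u v → W ! u ≡ W ! v
      Wu≡Wv (inj₁ (refl , refl)) = ends≡
      Wu≡Wv (inj₂ (refl , refl)) = sym ends≡

-- The constructed graph

nth-∈ : ∀ {A : Set} (d : A) xs {i} → i < length xs → nth d xs i ∈ xs
nth-∈ d (x ∷ xs) {zero}  h = here refl
nth-∈ d (x ∷ xs) {suc i} h = there (nth-∈ d xs (≤-pred h))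

∈-nth : ∀ {A : Set} (d : A) {xs x} → x ∈ xs → ∃[ i ] i < length xs × nth d xs i ≡ x
∈-nth d (here refl) = 0 , s≤s z≤n , refl
∈-nth d (there p)   = let i , i< , eq = ∈-nth d p in suc i , s≤s i< , eq

nth-injective : ∀ {A : Set} (d : A) {xs} → Unique xs → ∀ {i j} → i < length xs → j < length xs → nth d xs i ≡ nth d xs j → i ≡ j
nth-injective d (p ∷ u) {zero}  {zero}  _ _ _  = refl
nth-injective d (p ∷ u) {zero}  {suc j} _ h eq = ⊥-elim (All.lookup p (nth-∈ d _ (≤-pred h)) eq)
nth-injective d (p ∷ u) {suc i} {zero}  h _ eq = ⊥-elim (All.lookup p (nth-∈ d _ (≤-pred h)) (sym eq))
nth-injective d (p ∷ u) {suc i} {suc j} h k eq = cong suc (nth-injective d u (≤-pred h) (≤-pred k) eq)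

count-unique : ∀ n b → (∀ i j → i < n → j < n → b i ≡ true → b j ≡ true → i ≡ j) → count n b ≤ 1
count-unique n b h = ≤-trans (Sum-mono n at-first) (Sum-single n (find n b))
  where
  at-first : ∀ i → i < n → ι (b i) ≤ ι (find n b ≡ᵇ i)
  at-first i i<n = ι-mono λ bi → let f<n , bf = find-found n b i i<n bi in ≡ᵇ-intro (h _ i f<n i<n bf bi)

norm-cases : ∀ {x y a b} → norm x y ≡ (a , b) → (x ≡ a × y ≡ b) ⊎ (x ≡ b × y ≡ a)
norm-cases {x} {y} eq with x <ᵇ y | eq
... | true  | refl = inj₁ (refl , refl)
... | false | refl = inj₂ (refl , refl)

norm-match : ∀ {x y a b} → norm x y ≡ norm a b → (x ≡ a × y ≡ b) ⊎ (x ≡ b × y ≡ a)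
norm-match {x} {y} {a} {b} eq with norm-cases {a} {b} refl | norm-cases {x} {y} eq
... | inj₁ (p , q) | inj₁ (r , s) = inj₁ (trans r (sym p) , trans s (sym q))
... | inj₁ (p , q) | inj₂ (r , s) = inj₂ (trans r (sym q) , trans s (sym p))
... | inj₂ (p , q) | inj₁ (r , s) = inj₂ (trans r (sym q) , trans s (sym p))
... | inj₂ (p , q) | inj₂ (r , s) = inj₁ (trans r (sym p) , trans s (sym q))

norm-ordered : ∀ {x y} → x ≢ y → proj₁ (norm x y) < proj₂ (norm x y)
norm-ordered {x} {y} x≢y with bool? (x <ᵇ y)
... | inj₁ t rewrite t = <ᵇ-true t
... | inj₂ f rewrite f = ≤∧≢⇒< (<ᵇ-false f) (x≢y ∘ sym)

eqPair-true : ∀ {p q} → eqPair p q ≡ true → p ≡ q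
eqPair-true {a , b} {c , d} h = cong₂ _,_ (≡ᵇ-true (proj₁ (∧-true h))) (≡ᵇ-true (proj₂ (∧-true {a ≡ᵇ c} h)))

eqPair-intro : ∀ {p q} → p ≡ q → eqPair p q ≡ true
eqPair-intro {a , b} refl = ∧-intro (≡ᵇ-intro {a} refl) (≡ᵇ-intro {b} refl)

mixed-radix-< : ∀ L {e e′ a b} → e < e′ → a < L → e * L + a < e′ * L + b
mixed-radix-< L {e} {e′} {a} {b} e<e′ a<L = begin-strict
  e * L + a    <⟨ +-monoʳ-< (e * L) a<L ⟩
  e * L + L    ≡⟨ +-comm (e * L) L ⟩
  suc e * L    ≤⟨ *-monoˡ-≤ L e<e′ ⟩
  e′ * L       ≤⟨ m≤m+n _ b ⟩
  e′ * L + b   ∎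
  where open ≤-Reasoning

mixed-radix-injective : ∀ L {e e′ a b} → a < L → b < L → e * L + a ≡ e′ * L + b → e ≡ e′ × a ≡ b
mixed-radix-injective L {e} {e′} a<L b<L eq with <-cmp e e′
... | tri≈ _ refl _ = refl , +-cancelˡ-≡ (e * L) _ _ eq
... | tri< lt _ _ = ⊥-elim (<⇒≢ (mixed-radix-< L lt a<L) eq)
... | tri> _ _ lt = ⊥-elim (<⇒≢ (mixed-radix-< L lt b<L) (sym eq))

module Theory (n : ℕ) (es : Edges) (gs : List Bits) (L : ℕ) (kept : ℕ → Bool) (len : ℕ → ℕ)
              (ends< : ∀ e → e < length es → src es e < n × tgt es e < n)
              (len≤ : ∀ e → len e ≤ suc L) where

  open Reduction n es gs L kept len
  open Connection es using (Conn; stop; step; join; _▷_; back; Conn-mono; Joinsᴺ)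

  spanned⇒Conn : ∀ F {r x} → r < n → spanned n es F r ! x ≡ true → Conn F r x
  spanned⇒Conn F {r} {x} r<n h = Conn-mono (Growth.Invariant.E⊆F I) (Growth.Invariant.reachable I x h)
    where I = Growth.invariant n es ends< F r r<n

  Conn⇒spanned : ∀ F {r x} → r < n → Conn F r x → spanned n es F r ! x ≡ true
  Conn⇒spanned F {r} r<n = Growth.spans n es ends< F r r<n

  rep-spec : ∀ {v} → v < n → rep v < n × Conn zeroEdges v (rep v)
  rep-spec {v} v<n rewrite rep-def v = proj₁ found , spanned⇒Conn zeroEdges v<n (proj₂ found)
    where
    found = find-found n (λ w → spanned n es zeroEdges v ! w) v v<n (Conn⇒spanned zeroEdges v<n stop)

  rep-cong : ∀ {v w} → v < n → w < n → Conn zeroEdges v w → rep v ≡ rep w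
  rep-cong {v} {w} v<n w<n p = trans (rep-def v) (trans (find-cong n λ x _ → bool-ext
    (λ h → Conn⇒spanned zeroEdges {x = x} w<n (back p ▷ spanned⇒Conn zeroEdges {x = x} v<n h))
    (λ h → Conn⇒spanned zeroEdges {x = x} v<n (p ▷ spanned⇒Conn zeroEdges {x = x} w<n h))) (sym (rep-def w)))

  zeroEdge : ∀ {e} → e < m → kept e ≡ true → len e ≡ 0 → zeroEdges ! e ≡ true
  zeroEdge e<m ke l≡0 = trans (!-applyUpTo _ m e<m) (∧-intro ke (≡ᵇ-intro l≡0))

  zeroEdge-elim : ∀ {e} → e < m → zeroEdges ! e ≡ true → kept e ≡ true × len e ≡ 0
  zeroEdge-elim {e} e<m h with ∧-true {kept e} (trans (sym (!-applyUpTo _ m e<m)) h)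
  ... | ke , l = ke , ≡ᵇ-true l

  pathNode-start : ∀ e → pathNode e 0 ≡ rep (src es e)
  pathNode-start e = pathNode-def e 0

  pathNode-end : ∀ {e} → 0 < len e → pathNode e (len e) ≡ rep (tgt es e)
  pathNode-end {e} 0<l rewrite pathNode-def e (len e) | ≢-intro {len e} {0} (<⇒≢ 0<l ∘ sym) | ≡ᵇ-intro {len e} refl = refl

  inner : ℕ → ℕ → ℕ
  inner e i = n + k + (e * L + (i ∸ 1))

  pathNode-inner : ∀ {e i} → 0 < i → i < len e → pathNode e i ≡ inner e i
  pathNode-inner {e} {suc i} 0<i i<l rewrite pathNode-def e (suc i) | ≢-intro {suc i} {len e} (<⇒≢ i<l) = refl

  data Position (e : ℕ) : ℕ → Set where
    at-start : Position e 0
    at-end   : ∀ {i} → i ≡ len e → Position e i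
    inside   : ∀ {i} → 0 < i → i < len e → Position e i

  classify : ∀ {e i} → i ≤ len e → Position e i
  classify {e} {zero}  _ = at-start
  classify {e} {suc i} h with m≤n⇒m<n∨m≡n h
  ... | inj₁ lt = inside (s≤s z≤n) lt
  ... | inj₂ eq = at-end eq

  -- A path of length l has l - 1 inner nodes, so `len e ≤ suc L` makes `L` numbers per edge enough.
  offset< : ∀ {e i} → 0 < i → i < len e → i ∸ 1 < L
  offset< {e} {suc i} _ i<l = ≤-pred (≤-trans i<l (len≤ e))

  inner≥ : ∀ e i → n + k ≤ inner e i
  inner≥ e i = m≤m+n (n + k) _

  inner<N : ∀ {e i} → e < m → 0 < i → i < len e → inner e i < N
  inner<N {e} {i} e<m 0<i i<l = +-monoʳ-< (n + k) (begin-strict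
    e * L + (i ∸ 1)  <⟨ +-monoʳ-< (e * L) (offset< 0<i i<l) ⟩
    e * L + L        ≡⟨ +-comm (e * L) L ⟩
    suc e * L        ≤⟨ *-monoˡ-≤ L e<m ⟩
    m * L            ∎)
    where open ≤-Reasoning

  inner-injective : ∀ {e i e′ i′} → 0 < i → i < len e → 0 < i′ → i′ < len e′ → inner e i ≡ inner e′ i′ → e ≡ e′ × i ≡ i′
  inner-injective {e} {suc i} {e′} {suc i′} 0<i i<l 0<i′ i′<l eq
    with mixed-radix-injective L (offset< 0<i i<l) (offset< 0<i′ i′<l) (+-cancelˡ-≡ (n + k) _ _ eq)
  ... | e≡e′ , i≡i′ = e≡e′ , cong suc i≡i′

  repSrc< : ∀ {e} → e < m → rep (src es e) < n
  repSrc< e<m = proj₁ (rep-spec (proj₁ (ends< _ e<m)))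

  repTgt< : ∀ {e} → e < m → rep (tgt es e) < n
  repTgt< e<m = proj₁ (rep-spec (proj₂ (ends< _ e<m)))

  -- The nodes in Q.
  Allowed : ℕ → Set
  Allowed x = x < N × (x < n ⊎ n + k ≤ x)

  n≤N : n ≤ N
  n≤N = ≤-trans (m≤m+n n k) (m≤m+n (n + k) _)

  original : ∀ {x} → x < n → Allowed x
  original x<n = ≤-trans x<n n≤N , inj₁ x<n

  pathNode-allowed : ∀ {e i} → e < m → 0 < len e → i ≤ len e → Allowed (pathNode e i)
  pathNode-allowed {e} {i} e<m 0<l i≤l with classify {e} i≤l
  ... | at-start       = subst Allowed (sym (pathNode-start e)) (original (repSrc< e<m))
  ... | at-end refl    = subst Allowed (sym (pathNode-end {e} 0<l)) (original (repTgt< e<m))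
  ... | inside 0<i i<l = subst Allowed (sym (pathNode-inner 0<i i<l)) (inner<N e<m 0<i i<l , inj₂ (inner≥ e i))

  active-elim : ∀ {e} → active e ≡ true → kept e ≡ true × rep (src es e) ≢ rep (tgt es e)
  active-elim {e} h = proj₁ (∧-true h) , ≡ᵇ-false (not-true (proj₂ (∧-true {kept e} h)))

  -- The critical case is a path of length 1, which has no inner node; there `active` provides ends
  -- in different classes.
  pathNode-distinct : ∀ {e i} → e < m → active e ≡ true → i < len e → pathNode e i ≢ pathNode e (suc i)
  pathNode-distinct {e} {i} e<m act i<l eq with classify {e} {i} (<⇒≤ i<l) | classify {e} i<l
  ... | at-end refl    | _ = <-irrefl refl i<l
  ... | at-start       | at-end e₁ = proj₂ (active-elim act) (trans (sym (pathNode-start e)) (trans eq (trans (cong (pathNode e) e₁) (pathNode-end i<l))))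
  ... | at-start       | inside 0<i′ i′<l = <⇒≱ (repSrc< e<m)
          (≤-trans (m≤m+n n k) (≤-trans (inner≥ e 1) (≤-reflexive (trans (sym (pathNode-inner 0<i′ i′<l)) (trans (sym eq) (pathNode-start e))))))
  ... | inside 0<i _   | inside 0<i′ i′<l with inner-injective 0<i i<l 0<i′ i′<l (trans (sym (pathNode-inner 0<i i<l)) (trans eq (pathNode-inner 0<i′ i′<l)))
  ...   | _ , ()
  pathNode-distinct {e} {i} e<m act i<l eq | inside 0<i _ | at-end e₁ = <⇒≱ (repTgt< e<m)
          (≤-trans (m≤m+n n k) (≤-trans (inner≥ e i) (≤-reflexive (trans (sym (pathNode-inner 0<i i<l)) (trans eq (trans (cong (pathNode e) e₁) (pathNode-end (≤-<-trans z≤n i<l))))))))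

  onPath-elim : ∀ {e i h} → onPath e i h ≡ true → active e ≡ true × norm (pathNode e i) (pathNode e (suc i)) ≡ h
  onPath-elim {e} {i} {h} t = proj₁ (∧-true t) , eqPair-true (proj₂ (∧-true {active e} t))

  onPath-intro : ∀ {e i} → active e ≡ true → onPath e i (norm (pathNode e i) (pathNode e (suc i))) ≡ true
  onPath-intro {e} {i} act = ∧-intro act (eqPair-intro {norm (pathNode e i) (pathNode e (suc i))} refl)

  hasEdge-elim : ∀ {e h} → hasEdge e h ≡ true → ∃[ i ] i < len e × onPath e i h ≡ true
  hasEdge-elim {e} t = or-true _ (len e) t

  owner-hasEdge : ∀ {h} → owner h < m → hasEdge (owner h) h ≡ true
  owner-hasEdge {h} o<m = subst (λ e → hasEdge e h ≡ true) (sym (owner-def h))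
    (find-true m (λ e → hasEdge e h) (subst (_< m) (owner-def h) o<m))

  owner< : ∀ {e h} → e < m → hasEdge e h ≡ true → owner h < m
  owner< {e} {h} e<m t = subst (_< m) (sym (owner-def h)) (proj₁ (find-found m (λ e → hasEdge e h) e e<m t))

  position-spec : ∀ {e h} → hasEdge e h ≡ true → position e h < len e × onPath e (position e h) h ≡ true
  position-spec {e} {h} t rewrite position-def e h with hasEdge-elim {e} t
  ... | i , i<l , on = find-found (len e) (λ i → onPath e i h) i i<l on

  -- Edges of the constructed graph and their translation in both directions

  h : ℕ → ℕ × ℕ
  h j = nth (0 , 0) cdsEdges j

  m′ : ℕ
  m′ = length cdsEdges

  edge∈ : ∀ {j} → j < m′ → proj₁ (h j) < N × proj₂ (h j) < N × isEdge (h j) ≡ true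
  edge∈ {j} j<m′ = ∈-upTo⁻ (proj₁ x∈,y∈) , ∈-upTo⁻ (proj₂ x∈,y∈) , T→≡ (proj₂ h∈)
    where
    h∈ : h j ∈ cartesianProduct (upTo N) (upTo N) × T (isEdge (h j))
    h∈ = ∈-filter⁻ (T? ∘ isEdge) (subst (h j ∈_) cdsEdges-def (nth-∈ (0 , 0) cdsEdges j<m′))
    x∈,y∈ : proj₁ (h j) ∈ upTo N × proj₂ (h j) ∈ upTo N
    x∈,y∈ = ∈-cartesianProduct⁻ (upTo N) (upTo N) (proj₁ h∈)

  edge-ordered : ∀ {j} → j < m′ → proj₁ (h j) < proj₂ (h j)
  edge-ordered j<m′ = <ᵇ-true (proj₁ (∧-true (proj₂ (proj₂ (edge∈ j<m′)))))

  edge-index : ∀ {x y} → x < y → y < N → (owner (x , y) < m ⊎ groupEdge (x , y) ≡ true) → ∃[ j ] j < m′ × h j ≡ (x , y)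
  edge-index {x} {y} x<y y<N o = ∈-nth (0 , 0) (subst (_ ∈_) (sym cdsEdges-def) (∈-filter⁺ (T? ∘ isEdge) (∈-cartesianProduct⁺ (∈-upTo⁺ (<-trans x<y y<N)) (∈-upTo⁺ y<N))
    (≡→T (∧-intro (<ᵇ-intro x<y) (case o)))))
    where
    case : owner (x , y) < m ⊎ groupEdge (x , y) ≡ true → (owner (x , y) <ᵇ m) ∨ groupEdge (x , y) ≡ true
    case (inj₁ lt) = ∨-introˡ (<ᵇ-intro lt)
    case (inj₂ t)  = ∨-introʳ {owner (x , y) <ᵇ m} t

  cdsEdges-unique : Unique cdsEdges
  cdsEdges-unique = subst Unique (sym cdsEdges-def) (filter⁺ (T? ∘ isEdge) (cartesianProduct⁺ (upTo⁺ N) (upTo⁺ N)))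

  groupEdge-elim : ∀ {x y} → groupEdge (x , y) ≡ true → n ≤ y × y < n + k × ∃[ w ] w < n × nth [] gs (y ∸ n) ! w ≡ true × rep w ≡ x
  groupEdge-elim {x} {y} t with ∧-true t
  ... | a , b with ∧-true b
  ...   | c , d with or-true (λ w → nth [] gs (y ∸ n) ! w ∧ (rep w ≡ᵇ x)) n d
  ...     | w , w<n , e with ∧-true e
  ...       | gw , rw = <ᵇ-false (not-true a) , <ᵇ-true c , w , w<n , gw , ≡ᵇ-true rw

  groupEdge-intro : ∀ {i w} → i < k → w < n → nth [] gs i ! w ≡ true → groupEdge (rep w , n + i) ≡ true
  groupEdge-intro {i} {w} i<k w<n gw = ∧-intro (not-intro (≥-intro (m≤m+n n i))) (∧-intro (<ᵇ-intro (+-monoʳ-< n i<k))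
    (or-intro _ n w<n (∧-intro (trans (cong (λ z → nth [] gs z ! w) (m+n∸m≡n n i)) gw) (≡ᵇ-intro {rep w} refl))))

  module Back (B : Bits) (allowed : ∀ j → j < m′ → B ! j ≡ true → Allowed (proj₂ (h j))) where

    F : Bits
    F = liftBack cdsEdges B

    -- In a group edge the larger end is the group node, which is not in Q. So allowed larger ends
    -- already force all edges of `B` to come from paths.
    owned : ∀ {j} → j < m′ → B ! j ≡ true → owner (h j) < m
    owned {j} j<m′ Bj with ∨-true (proj₂ (∧-true {proj₁ (h j) <ᵇ proj₂ (h j)} (proj₂ (proj₂ (edge∈ j<m′)))))
    ... | inj₁ o = <ᵇ-true o
    ... | inj₂ g with groupEdge-elim {proj₁ (h j)} g | proj₂ (allowed j j<m′ Bj)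
    ...   | n≤y , y<nk , _ | inj₁ y<n  = ⊥-elim (<⇒≱ y<n n≤y)
    ...   | n≤y , y<nk , _ | inj₂ nk≤y = ⊥-elim (<⇒≱ y<nk nk≤y)

    covered-intro : ∀ {j} → j < m′ → B ! j ≡ true → covered cdsEdges B (owner (h j)) (position (owner (h j)) (h j)) ≡ true
    covered-intro {j} j<m′ Bj = or-intro _ m′ j<m′ (∧-intro Bj (∧-intro (≡ᵇ-intro {owner (h j)} refl) (≡ᵇ-intro {position (owner (h j)) (h j)} refl)))

    located : ∀ {j} → j < m′ → B ! j ≡ true → let e = owner (h j) ; i = position e (h j) in
              i < len e × active e ≡ true × norm (pathNode e i) (pathNode e (suc i)) ≡ h j
    located {j} j<m′ Bj = proj₁ p , onPath-elim {owner (h j)} (proj₂ p)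
      where p = position-spec (owner-hasEdge {h j} (owned j<m′ Bj))

    F-char : ∀ {e} → e < m → F ! e ≡ kept e ∧ ((len e ≡ᵇ 0) ∨ and (applyUpTo (covered cdsEdges B e) (len e)))
    F-char e<m = !-applyUpTo _ m e<m

    F⊆kept : ∀ {e} → e < m → F ! e ≡ true → kept e ≡ true
    F⊆kept e<m t = proj₁ (∧-true (trans (sym (F-char e<m)) t))

    F-zero : ∀ e → e < m → zeroEdges ! e ≡ true → F ! e ≡ true
    F-zero e e<m z with zeroEdge-elim e<m z
    ... | ke , l≡0 = trans (F-char e<m) (∧-intro ke (∨-introˡ (≡ᵇ-intro l≡0)))

    F-full : ∀ {e} → e < m → kept e ≡ true → (∀ i → i < len e → covered cdsEdges B e i ≡ true) → F ! e ≡ true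
    F-full {e} e<m ke c = trans (F-char e<m) (∧-intro ke (∨-introʳ {len e ≡ᵇ 0} (and-intro _ (len e) c)))

    -- An edge of positive length that is taken back owns an edge of `B` at every position of its
    -- path. Owner and position are functions of the edge of `B`, so none is charged twice.
    total : Sum m (λ e → if F ! e then len e else 0) ≤ count m′ (B !_)
    total = Sum≤-by-fibres m m′ (B !_) (owner ∘ h) _ λ e e<m → bound e e<m
      where
      b : ℕ → ℕ → Bool
      b e j = B ! j ∧ (owner (h j) ≡ᵇ e)
      one : ∀ e i → covered cdsEdges B e i ≡ true → 1 ≤ count m′ (λ j → b e j ∧ (position e (h j) ≡ᵇ i))
      one e i c with or-true _ m′ c
      ... | j , j<m′ , t with ∧-true {B ! j} t
      ...   | Bj , t′ with ∧-true {owner (h j) ≡ᵇ e} t′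
      ...     | o , p = ≤-trans (≤-reflexive (sym (cong ι (∧-intro (∧-intro Bj o) p)))) (term≤Sum m′ (λ j → ι (b e j ∧ (position e (h j) ≡ᵇ i))) j j<m′)
      bound : ∀ e → e < m → (if F ! e then len e else 0) ≤ count m′ (b e)
      bound e e<m with bool? (F ! e)
      ... | inj₂ f rewrite f = z≤n
      ... | inj₁ t rewrite t with ∨-true {len e ≡ᵇ 0} (proj₂ (∧-true {kept e} (trans (sym (F-char e<m)) t)))
      ...   | inj₁ l≡0 = ≤-trans (≤-reflexive (≡ᵇ-true l≡0)) z≤n
      ...   | inj₂ all = ≤-trans (≤-reflexive (sym (trans (Sum-const (len e) 1) (*-identityʳ (len e)))))
                (Sum≤-by-fibres (len e) m′ (b e) (λ j → position e (h j)) (λ _ → 1) (λ i i<l → one e i (and-true _ (len e) all i<l)))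

    module _ (v₀ : ℕ) (v₀<n : v₀ < n) where

      open Connection cdsEdges using () renaming (Conn to Conn′; stop to stop′; step to step′)

      reps : ∀ {v} → v < n → Conn F v (rep v)
      reps v<n = Conn-mono F-zero (proj₂ (rep-spec v<n))

      -- What has been traversed of the path of e when its i-th node is reached.
      Progress : ℕ → ℕ → Set
      Progress e i =
        (Conn F v₀ (src es e) × (∀ i′ → i′ < i → covered cdsEdges B e i′ ≡ true)) ⊎
        (Conn F v₀ (tgt es e) × (∀ i′ → i ≤ i′ → i′ < len e → covered cdsEdges B e i′ ≡ true))

      -- The invariant of a walk in the tree, by the kind of node it stands at. At an inner node,
      -- whose edge and position are unique, connection in `F` cannot be claimed yet; `Progress`
      -- remembers from which end the path was entered.
      Reached : ℕ → Set
      Reached x = (x < n → Conn F v₀ x) ×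
                  (∀ {e i} → e < m → 0 < i → i < len e → inner e i ≡ x → Progress e i)

      not-inner : ∀ {x e i} → x < n → inner e i ≢ x
      not-inner {e = e} {i} x<n refl = <⇒≱ x<n (≤-trans (m≤m+n n k) (inner≥ e i))

      progress-at : ∀ {e i} → e < m → 0 < len e → i ≤ len e → Reached (pathNode e i) → Progress e i
      progress-at {e} {i} e<m 0<l i≤l (R , R′) with classify {e} i≤l
      ... | at-start = inj₁ (R₀ ▷ back (reps (proj₁ (ends< e e<m))) , λ _ ())
        where
        R₀ : Conn F v₀ (rep (src es e))
        R₀ = subst (Conn F v₀) (pathNode-start e) (R (subst (_< n) (sym (pathNode-start e)) (repSrc< e<m)))
      ... | at-end refl = inj₂ (R (subst (_< n) (sym (pathNode-end {e} 0<l)) (repTgt< e<m)) ▷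
                             subst (λ z → Conn F z (tgt es e)) (sym (pathNode-end {e} 0<l)) (back (reps (proj₂ (ends< e e<m))))
                           , λ i′ l≤i′ i′<l → ⊥-elim (<⇒≱ i′<l l≤i′))
      ... | inside 0<i i<l = R′ e<m 0<i i<l (sym (pathNode-inner 0<i i<l))

      reached-at : ∀ {e i} → e < m → kept e ≡ true → 0 < len e → i ≤ len e → Progress e i → Reached (pathNode e i)
      reached-at {e} {i} e<m ke 0<l i≤l p with classify {e} i≤l
      ... | at-start = subst Reached (sym (pathNode-start e))
          ((λ _ → to-src p ▷ reps (proj₁ (ends< e e<m))) , λ {e′} {i′} _ _ _ eq → ⊥-elim (not-inner {e = e′} {i′} (repSrc< e<m) eq))
        where
        to-src : Progress e 0 → Conn F v₀ (src es e)
        to-src (inj₁ (c , _))   = c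
        to-src (inj₂ (c , all)) = c ▷ back (join e (F-full e<m ke (λ i → all i z≤n)) e<m (inj₁ (refl , refl)))
      ... | at-end refl = subst Reached (sym (pathNode-end {e} 0<l))
          ((λ _ → to-tgt p ▷ reps (proj₂ (ends< e e<m))) , λ {e′} {i′} _ _ _ eq → ⊥-elim (not-inner {e = e′} {i′} (repTgt< e<m) eq))
        where
        to-tgt : Progress e (len e) → Conn F v₀ (tgt es e)
        to-tgt (inj₂ (c , _))   = c
        to-tgt (inj₁ (c , all)) = c ▷ join e (F-full e<m ke all) e<m (inj₁ (refl , refl))
      ... | inside 0<i i<l = subst Reached (sym (pathNode-inner 0<i i<l))
          ((λ lt → ⊥-elim (not-inner {e = e} {i} lt refl)) , λ {e′} {i′} e′<m 0<i′ i′<l eq → same e′<m 0<i′ i′<l eq)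
        where
        same : ∀ {e′ i′} → e′ < m → 0 < i′ → i′ < len e′ → inner e′ i′ ≡ inner e i → Progress e′ i′
        same e′<m 0<i′ i′<l eq with inner-injective 0<i′ i′<l 0<i i<l eq
        ... | refl , refl = p

      -- `covered` is a property of the tree and not of the walk, so a walk may turn round inside a
      -- path: a step away from the end it came from adds one covered edge, a step back weakens the
      -- claim.
      forwards : ∀ {e i} → covered cdsEdges B e i ≡ true → Progress e i → Progress e (suc i)
      forwards {e} {i} c (inj₁ (p , all)) = inj₁ (p , more)
        where
        more : ∀ i′ → i′ < suc i → covered cdsEdges B e i′ ≡ true
        more i′ lt with m≤n⇒m<n∨m≡n (≤-pred lt)
        ... | inj₁ lt′  = all i′ lt′
        ... | inj₂ refl = c
      forwards c (inj₂ (p , all)) = inj₂ (p , λ i′ lt → all i′ (<⇒≤ lt))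

      backwards : ∀ {e i} → covered cdsEdges B e i ≡ true → Progress e (suc i) → Progress e i
      backwards c (inj₁ (p , all)) = inj₁ (p , λ i′ lt → all i′ (m≤n⇒m≤1+n lt))
      backwards {e} {i} c (inj₂ (p , all)) = inj₂ (p , more)
        where
        more : ∀ i′ → i ≤ i′ → i′ < len e → covered cdsEdges B e i′ ≡ true
        more i′ le with m≤n⇒m<n∨m≡n le
        ... | inj₁ lt   = all i′ lt
        ... | inj₂ refl = λ _ → c

      along : ∀ {x y j} → j < m′ → B ! j ≡ true → norm x y ≡ h j → Reached x → Reached y
      along {x} {y} {j} j<m′ Bj eq R with located j<m′ Bj
      ... | i<l , act , on with norm-match (trans on (sym eq))
      ...   | inj₁ (p , q) = subst Reached q (reached-at (owned j<m′ Bj) (proj₁ (active-elim act)) (≤-<-trans z≤n i<l) i<l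
                (forwards (covered-intro j<m′ Bj) (progress-at (owned j<m′ Bj) (≤-<-trans z≤n i<l) (<⇒≤ i<l) (subst Reached (sym p) R))))
      ...   | inj₂ (p , q) = subst Reached p (reached-at (owned j<m′ Bj) (proj₁ (active-elim act)) (≤-<-trans z≤n i<l) (<⇒≤ i<l)
                (backwards (covered-intro j<m′ Bj) (progress-at (owned j<m′ Bj) (≤-<-trans z≤n i<l) i<l (subst Reached (sym q) R))))

      reached : ∀ {x y} → Reached x → Conn′ B x y → Reached y
      reached R stop′ = R
      reached R (step′ {u = x} {v = y} j Bj j<m′ J p) = reached (along j<m′ Bj (normalised J) R) p
        where
        normalised : (src cdsEdges j ≡ x × tgt cdsEdges j ≡ y) ⊎ (src cdsEdges j ≡ y × tgt cdsEdges j ≡ x) → norm x y ≡ h j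
        normalised (inj₁ (refl , refl)) rewrite <ᵇ-intro (edge-ordered j<m′) = refl
        normalised (inj₂ (refl , refl)) rewrite ≥-intro (<⇒≤ (edge-ordered j<m′)) = refl

      translate : ∀ {x} → Conn′ B v₀ x → x < n → Conn F v₀ x
      translate p = proj₁ (reached ((λ _ → stop) , λ {e′} {i′} _ _ _ eq → ⊥-elim (not-inner {e = e′} {i′} v₀<n eq)) p)

  hitsAll-intro : ∀ V → (∀ i → i < k → ∃[ v ] v < n × nth [] gs i ! v ≡ true × V ! v ≡ true) → hitsAll V ≡ true
  hitsAll-intro V hit = and-intro _ k λ i i<k → let v , v<n , g , Vv = hit i i<k in
    or-intro (λ v → nth [] gs i ! v ∧ V ! v) n v<n (∧-intro g Vv)

  hitsAll-elim : ∀ V → hitsAll V ≡ true → ∀ i → i < k → ∃[ v ] v < n × nth [] gs i ! v ≡ true × V ! v ≡ true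
  hitsAll-elim V t i i<k with or-true (λ v → nth [] gs i ! v ∧ V ! v) n (and-true _ k t i<k)
  ... | v , v<n , t′ = v , v<n , proj₁ (∧-true t′) , proj₂ (∧-true {nth [] gs i ! v} t′)

  root-intro : ∀ F {v} → v < n → (∀ i → i < k → ∃[ w ] w < n × nth [] gs i ! w ≡ true × Conn F v w) → root F < n
  root-intro F {v} v<n hit = proj₁ (find-found n (λ v → hitsAll (spanned n es F v)) v v<n
    (hitsAll-intro _ λ i i<k → let w , w<n , g , c = hit i i<k in w , w<n , g , Conn⇒spanned F v<n c))

  root-elim : ∀ F → root F < n → ∀ i → i < k → ∃[ w ] w < n × nth [] gs i ! w ≡ true × spanned n es F (root F) ! w ≡ true
  root-elim F r<n = hitsAll-elim _ (find-true n (λ v → hitsAll (spanned n es F v)) r<n)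

  module Forth (F₀ : Bits) (F₀⊆kept : ∀ e → e < m → F₀ ! e ≡ true → kept e ≡ true) where

    open Connection cdsEdges using () renaming (Conn to Conn′; stop to stop′; step to step′; _▷_ to _▷′_; join to join′; Joinsᴺ to Joins′)

    -- Any chosen edge whose path contains `h j` will do. The owner of `h j` would be the wrong
    -- test, as it may be a parallel edge outside `F₀`.
    inImage : ℕ → Bool
    inImage j = or (applyUpTo (λ e → F₀ ! e ∧ hasEdge e (h j)) m)

    image : Bits
    image = applyUpTo inImage m′

    image-elim : ∀ {j} → j < m′ → image ! j ≡ true →
                 ∃[ e ] ∃[ i ] e < m × F₀ ! e ≡ true × i < len e × onPath e i (h j) ≡ true
    image-elim {j} j<m′ t with or-true (λ e → F₀ ! e ∧ hasEdge e (h j)) m (trans (sym (!-applyUpTo inImage m′ j<m′)) t)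
    ... | e , e<m , t′ with hasEdge-elim {e} (proj₂ (∧-true {F₀ ! e} t′))
    ...   | i , i<l , on = e , i , e<m , proj₁ (∧-true t′) , i<l , on

    -- Each edge of the image is charged to a chosen edge and a position on its path; such a pair
    -- determines the edge, and `cdsEdges` lists it once.
    image-size : count m′ (image !_) ≤ Sum m (λ e → if F₀ ! e then len e else 0)
    image-size = begin
      count m′ (image !_)                                         ≤⟨ Sum-mono m′ (λ j j<m′ → split j<m′) ⟩
      Sum m′ (λ j → Sum m (λ e → Sum (len e) (λ i → g e i j)))    ≡⟨ Sum-swap m′ m _ ⟩
      Sum m (λ e → Sum m′ (λ j → Sum (len e) (λ i → g e i j)))    ≡⟨ Sum-cong m (λ e _ → Sum-swap m′ (len e) _) ⟩
      Sum m (λ e → Sum (len e) (λ i → Sum m′ (g e i)))            ≤⟨ Sum-mono m (λ e _ → collapse e) ⟩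
      Sum m (λ e → if F₀ ! e then len e else 0)                   ∎
      where
      open ≤-Reasoning
      g : ℕ → ℕ → ℕ → ℕ
      g e i j = ι (F₀ ! e ∧ onPath e i (h j))
      split : ∀ {j} → j < m′ → ι (image ! j) ≤ Sum m (λ e → Sum (len e) (λ i → g e i j))
      split {j} j<m′ with bool? (image ! j)
      ... | inj₂ f rewrite f = z≤n
      ... | inj₁ t with image-elim j<m′ t
      ...   | e , i , e<m , Fe , i<l , on = begin
        ι (image ! j)                                       ≤⟨ ι≤1 _ ⟩
        1                                                   ≡⟨ cong ι (∧-intro Fe on) ⟨
        g e i j                                             ≤⟨ term≤Sum (len e) (λ i → g e i j) i i<l ⟩
        Sum (len e) (λ i → g e i j)                         ≤⟨ term≤Sum m (λ e → Sum (len e) (λ i → g e i j)) e e<m ⟩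
        Sum m (λ e → Sum (len e) (λ i → g e i j))           ∎
      collapse : ∀ e → Sum (len e) (λ i → Sum m′ (g e i)) ≤ (if F₀ ! e then len e else 0)
      collapse e with F₀ ! e
      ... | false = ≤-reflexive (trans (Sum-cong (len e) (λ _ _ → Sum-0 m′)) (Sum-0 (len e)))
      ... | true  = ≤-trans (Sum-mono (len e) (λ i _ → count-unique m′ (λ j → onPath e i (h j)) λ j j′ j< j′< on on′ →
              nth-injective (0 , 0) cdsEdges-unique j< j′< (trans (sym (proj₂ (onPath-elim {e} on))) (proj₂ (onPath-elim {e} on′)))))
            (≤-reflexive (trans (Sum-const (len e) 1) (*-identityʳ (len e))))

    image-allowed : ∀ {j} → j < m′ → image ! j ≡ true → Allowed (src cdsEdges j) × Allowed (tgt cdsEdges j)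
    image-allowed {j} j<m′ t with image-elim j<m′ t
    ... | e , i , e<m , _ , i<l , on with norm-cases (proj₂ (onPath-elim {e} on)) | pathNode-allowed {e} {i} e<m (≤-<-trans z≤n i<l) (<⇒≤ i<l)
                                        | pathNode-allowed {e} {suc i} e<m (≤-<-trans z≤n i<l) i<l
    ...   | inj₁ (p , q) | a | b = subst Allowed p a , subst Allowed q b
    ...   | inj₂ (p , q) | a | b = subst Allowed q b , subst Allowed p a

    path-step : ∀ {e i} → e < m → F₀ ! e ≡ true → active e ≡ true → i < len e → Conn′ image (pathNode e i) (pathNode e (suc i))
    path-step {e} {i} e<m Fe act i<l with edge-index (norm-ordered {pathNode e i} {pathNode e (suc i)} (pathNode-distinct {e} {i} e<m act i<l)) y<N (inj₁ (owner< e<m on))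
      where
      on : hasEdge e (norm (pathNode e i) (pathNode e (suc i))) ≡ true
      on = or-intro (λ i′ → onPath e i′ (norm (pathNode e i) (pathNode e (suc i)))) (len e) i<l (onPath-intro {e} {i} act)
      y<N : proj₂ (norm (pathNode e i) (pathNode e (suc i))) < N
      y<N with norm-cases {pathNode e i} {pathNode e (suc i)} refl
      ... | inj₁ (_ , q) = subst (_< N) q (proj₁ (pathNode-allowed {e} e<m (≤-<-trans z≤n i<l) i<l))
      ... | inj₂ (p , _) = subst (_< N) p (proj₁ (pathNode-allowed {e} e<m (≤-<-trans z≤n i<l) (<⇒≤ i<l)))
    ... | j , j<m′ , eq = join′ j
        (trans (!-applyUpTo inImage m′ j<m′) (or-intro (λ e → F₀ ! e ∧ hasEdge e (h j)) m e<m (∧-intro Fe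
          (or-intro (λ i′ → onPath e i′ (h j)) (len e) i<l (subst (λ z → onPath e i z ≡ true) (sym eq) (onPath-intro {e} {i} act))))))
        j<m′ joins
      where
      joins : Joins′ j (pathNode e i) (pathNode e (suc i))
      joins with norm-cases {pathNode e i} {pathNode e (suc i)} (sym eq)
      ... | inj₁ (p , q) = inj₁ (sym p , sym q)
      ... | inj₂ (p , q) = inj₂ (sym q , sym p)

    path : ∀ {e} → e < m → F₀ ! e ≡ true → active e ≡ true → ∀ i → i ≤ len e → Conn′ image (pathNode e 0) (pathNode e i)
    path e<m Fe act zero    _   = stop′
    path e<m Fe act (suc i) i<l = path e<m Fe act i (<⇒≤ i<l) ▷′ path-step e<m Fe act i<l

    -- Ends in the same class need no path. Otherwise the length is positive, since an edge of
    -- length 0 would have merged its ends, and the edge is active.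
    across : ∀ {e} → e < m → F₀ ! e ≡ true → Conn′ image (rep (src es e)) (rep (tgt es e))
    across {e} e<m Fe with rep (src es e) ≟ rep (tgt es e)
    ... | yes eq rewrite eq = stop′
    ... | no ≢ with len e ≟ 0
    ...   | yes l≡0 = ⊥-elim (≢ (rep-cong (proj₁ (ends< e e<m)) (proj₂ (ends< e e<m))
              (join e (zeroEdge e<m (F₀⊆kept e e<m Fe) l≡0) e<m (inj₁ (refl , refl)))))
    ...   | no l≢0 = subst₂ (Conn′ image) (pathNode-start e) (pathNode-end {e} (n≢0⇒n>0 l≢0))
              (path e<m Fe (∧-intro (F₀⊆kept e e<m Fe) (not-intro (≢-intro ≢))) (len e) ≤-refl)

    transport : ∀ {u v} → Conn F₀ u v → Conn′ image (rep u) (rep v)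
    transport stop = stop′
    transport (step e Fe e<m (inj₁ (refl , refl)) p) = across e<m Fe ▷′ transport p
    transport (step e Fe e<m (inj₂ (refl , refl)) p) = Connection.back cdsEdges (across e<m Fe) ▷′ transport p

    stays-allowed : ∀ {x y} → Allowed x → Conn′ image x y → Allowed y
    stays-allowed a stop′ = a
    stays-allowed a (step′ j t j<m′ (inj₁ (refl , refl)) p) = stays-allowed (proj₂ (image-allowed j<m′ t)) p
    stays-allowed a (step′ j t j<m′ (inj₂ (refl , refl)) p) = stays-allowed (proj₁ (image-allowed j<m′ t)) p

  groupEdge-index : ∀ {i w} → i < k → w < n → nth [] gs i ! w ≡ true → ∃[ j ] j < m′ × h j ≡ (rep w , n + i)
  groupEdge-index {i} {w} i<k w<n g = edge-index (≤-trans (proj₁ (rep-spec w<n)) (m≤m+n n i))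
    (≤-trans (+-monoʳ-< n i<k) (m≤m+n (n + k) _)) (inj₂ (groupEdge-intro i<k w<n g))

  not-allowed : ∀ {i} → i < k → ¬ Allowed (n + i)
  not-allowed {i} i<k (_ , inj₁ lt) = <⇒≱ lt (m≤m+n n i)
  not-allowed {i} i<k (_ , inj₂ ge) = <⇒≱ (+-monoʳ-< n i<k) ge

  path-allowed : ∀ {h} → owner h < m → Allowed (proj₁ h) × Allowed (proj₂ h)
  path-allowed {h} o<m with hasEdge-elim {owner h} (owner-hasEdge {h} o<m)
  ... | i , i<l , on with norm-cases (proj₂ (onPath-elim {owner h} {i} on))
                        | pathNode-allowed {owner h} {i} o<m (≤-<-trans z≤n i<l) (<⇒≤ i<l)
                        | pathNode-allowed {owner h} {suc i} o<m (≤-<-trans z≤n i<l) i<l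
  ...   | inj₁ (p , q) | a | b = subst Allowed p a , subst Allowed q b
  ...   | inj₂ (p , q) | a | b = subst Allowed q b , subst Allowed p a

  -- Edges of paths have both ends in Q, so an edge at a group node is a group edge. This extracts
  -- from domination a member of the group whose class is visited by the tree.
  group-neighbour : ∀ {i x y} → i < k → Allowed y → isEdge (x , y) ≡ true ⊎ isEdge (y , x) ≡ true → x ≡ n + i →
                    ∃[ w ] w < n × nth [] gs i ! w ≡ true × rep w ≡ y
  group-neighbour {i} {.(n + i)} {y} i<k ay (inj₁ t) refl with ∨-true (proj₂ (∧-true {n + i <ᵇ y} t))
  ... | inj₁ o = ⊥-elim (not-allowed i<k (proj₁ (path-allowed {n + i , y} (<ᵇ-true o))))
  ... | inj₂ gr with groupEdge-elim {n + i} gr | proj₂ ay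
  ...   | n≤y , y<nk , _ | inj₁ lt = ⊥-elim (<⇒≱ lt n≤y)
  ...   | n≤y , y<nk , _ | inj₂ ge = ⊥-elim (<⇒≱ y<nk ge)
  group-neighbour {i} {.(n + i)} {y} i<k ay (inj₂ t) refl with ∨-true (proj₂ (∧-true {y <ᵇ n + i} t))
  ... | inj₁ o = ⊥-elim (not-allowed i<k (proj₂ (path-allowed {y , n + i} (<ᵇ-true o))))
  ... | inj₂ gr with groupEdge-elim {y} gr
  ...   | _ , _ , w , w<n , gw , rw = w , w<n , subst (λ z → nth [] gs z ! w ≡ true) (m+n∸m≡n n i) gw , rw

-- Graphs as lists of edges

!-toList : ∀ {n} (s : Subset n) i → toList s ! toℕ i ≡ Vec.lookup s i
!-toList (x ∷ s) zero    = refl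
!-toList (x ∷ s) (suc i) = !-toList s i

∈⇒! : ∀ {n} {s : Subset n} {i} → i ∈ˢ s → toList s ! toℕ i ≡ true
∈⇒! {s = s} {i} i∈s = trans (!-toList s i) ([]=⇒lookup i∈s)

!⇒∈ : ∀ {n} {s : Subset n} {i} → toList s ! toℕ i ≡ true → i ∈ˢ s
!⇒∈ {s = s} {i} h = lookup⇒[]= i s (trans (sym (!-toList s i)) h)

card≡count : ∀ {n} (s : Subset n) → card s ≡ count n (toList s !_)
card≡count []          = refl
card≡count (true ∷ s)  = cong suc (card≡count s)
card≡count (false ∷ s) = card≡count s

length-toList : ∀ {n} (s : Subset n) → length (toList s) ≡ n
length-toList []      = refl
length-toList (_ ∷ s) = cong suc (length-toList s)

subset : ∀ n → Bits → Subset n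
subset zero    _        = []
subset (suc n) []       = false ∷ subset n []
subset (suc n) (b ∷ bs) = b ∷ subset n bs

toList-subset : ∀ n bs → length bs ≡ n → toList (subset n bs) ≡ bs
toList-subset zero    []       _  = refl
toList-subset (suc n) (b ∷ bs) eq = cong (b ∷_) (toList-subset n bs (suc-injective eq))

bitsOf : ℕᵇ → Bits
bitsOf ℕᵇ.zero  = []
bitsOf 2[1+ b ] = false ∷ bitsOf b
bitsOf 1+[2 b ] = true ∷ bitsOf b

enc-bitsOf : ∀ b → enc bits (bitsOf b) ≡ encBinary b
enc-bitsOf ℕᵇ.zero  = refl
enc-bitsOf 2[1+ b ] = cong (nil ∙_) (enc-bitsOf b)
enc-bitsOf 1+[2 b ] = cong ((nil ∙ nil) ∙_) (enc-bitsOf b)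

val-bitsOf : ∀ b → val (bitsOf b) ≡ ℕᵇ.toℕ b
val-bitsOf ℕᵇ.zero  = refl
val-bitsOf 2[1+ b ] = cong (λ z → 2 * suc z) (val-bitsOf b)
val-bitsOf 1+[2 b ] = cong (λ z → suc (2 * z)) (val-bitsOf b)

encList-tabulate : ∀ {A B : Set} (f : A → Val) (g : B → Val) {n} (a : Fin n → A) (b : Fin n → B) →
                   (∀ i → f (a i) ≡ g (b i)) → encList f (tabulate a) ≡ encList g (tabulate b)
encList-tabulate f g {zero}  a b h = refl
encList-tabulate f g {suc n} a b h = cong₂ _∙_ (h zero) (encList-tabulate f g (a ∘ suc) (b ∘ suc) (h ∘ suc))

endsᴺ : (G : Graph) → Graph.Edge G → ℕ × ℕ
endsᴺ G e = toℕ (proj₁ (Graph.ends G e)) , toℕ (proj₂ (Graph.ends G e))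

edgeData : Graph → Edges
edgeData G = tabulate (endsᴺ G)

enc-edgeData : ∀ G → encList (Graph.encEdge G) (tabulate id) ≡ enc edgesᵗ (edgeData G)
enc-edgeData G = encList-tabulate (Graph.encEdge G) (enc pair) id (endsᴺ G) (λ _ → refl)

module OnGraph (G : Graph) (es : Edges) (es≡ : es ≡ edgeData G) where

  open Graph G hiding (m)
  open Connection es

  length-es : length es ≡ Graph.m G
  length-es = trans (cong length es≡) (length-tabulate (endsᴺ G))

  toℕ<m : ∀ (e : Edge) → toℕ e < m
  toℕ<m e = subst (toℕ e <_) (sym length-es) (toℕ<n e)

  nth-es : ∀ e → nth (0 , 0) es (toℕ e) ≡ endsᴺ G e
  nth-es e = trans (cong (λ z → nth (0 , 0) z (toℕ e)) es≡) (nth-tabulate (0 , 0) _ (endsᴺ G) e)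

  src-es : ∀ e → src es (toℕ e) ≡ toℕ (proj₁ (ends e))
  src-es e = cong proj₁ (nth-es e)

  tgt-es : ∀ e → tgt es (toℕ e) ≡ toℕ (proj₂ (ends e))
  tgt-es e = cong proj₂ (nth-es e)

  edge-at : ∀ {j} → j < m → ∃[ e ] toℕ {Graph.m G} e ≡ j
  edge-at {j} j<m = fromℕ< (subst (j <_) length-es j<m) , toℕ-fromℕ< _

  ends< : ∀ j → j < m → src es j < n × tgt es j < n
  ends< j j<m with edge-at j<m
  ... | e , refl = subst (_< n) (sym (src-es e)) (toℕ<n _) , subst (_< n) (sym (tgt-es e)) (toℕ<n _)

  toJoins : ∀ {e u v} → Joins e u v → Joinsᴺ (toℕ e) (toℕ u) (toℕ v)
  toJoins {e} (inj₁ eq) = inj₁ (trans (src-es e) (cong (toℕ ∘ proj₁) eq) , trans (tgt-es e) (cong (toℕ ∘ proj₂) eq))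
  toJoins {e} (inj₂ eq) = inj₂ (trans (src-es e) (cong (toℕ ∘ proj₁) eq) , trans (tgt-es e) (cong (toℕ ∘ proj₂) eq))

  fromJoins : ∀ {e u v} → Joinsᴺ (toℕ e) (toℕ u) (toℕ v) → Joins e u v
  fromJoins {e} (inj₁ (p , q)) = inj₁ (cong₂ _,_ (toℕ-injective (trans (sym (src-es e)) p)) (toℕ-injective (trans (sym (tgt-es e)) q)))
  fromJoins {e} (inj₂ (p , q)) = inj₂ (cong₂ _,_ (toℕ-injective (trans (sym (src-es e)) p)) (toℕ-injective (trans (sym (tgt-es e)) q)))

  source-adjacent : ∀ e {r} → toℕ (proj₂ (ends e)) ≡ toℕ r → Adjacent r (proj₁ (ends e))
  source-adjacent e eq = e , inj₂ (cong (proj₁ (ends e) ,_) (toℕ-injective eq))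

  toConn : ∀ {F B} → (∀ e → e ∈ˢ F → B ! toℕ e ≡ true) → ∀ {u v} → Walk F u v → Conn B (toℕ u) (toℕ v)
  toConn h stop             = stop
  toConn h (step e e∈ j w)  = step (toℕ e) (h e e∈) (toℕ<m e) (toJoins j) (toConn h w)

  trail-toConn : ∀ {F B} (h : ∀ e → e ∈ˢ F → B ! toℕ e ≡ true) {u v} (w : Walk F u v) → trail (toConn h w) ≡ map toℕ (edgesOf w)
  trail-toConn h stop            = refl
  trail-toConn h (step e e∈ j w) = cong (toℕ e ∷_) (trail-toConn h w)

  -- The ends are given up to `toℕ`, because a node in the middle of the walk is known to be below
  -- `n` only through the edge that leads to it.
  fromConn : ∀ {F B} → (∀ e → B ! toℕ e ≡ true → e ∈ˢ F) → ∀ {x y} → Conn B x y → ∀ {u v} → toℕ u ≡ x → toℕ v ≡ y → Walk F u v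
  fromConn h stop p q with toℕ-injective (trans p (sym q))
  ... | refl = stop
  fromConn {F} {B} h (step {v = x′} j Bj j<m J c) {u} {v} p q with edge-at j<m
  ... | e , refl = step e (h e Bj) (fromJoins (subst₂ (Joinsᴺ (toℕ e)) (sym p) (sym (toℕ-fromℕ< x′<n)) J)) (fromConn h c (toℕ-fromℕ< x′<n) q)
    where
    target : Joinsᴺ (toℕ e) _ x′ → x′ < n
    target (inj₁ (_ , refl)) = proj₂ (ends< (toℕ e) j<m)
    target (inj₂ (refl , _)) = proj₁ (ends< (toℕ e) j<m)
    x′<n : x′ < n
    x′<n = target J

  subgraph : Bits × Bits → Subgraph
  subgraph (V , E) = record { V = subset n V ; E = subset (Graph.m G) E }

  module Grown (F : Bits) (r : ℕ) (r<n : r < n) where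

    open Growth n es ends< F r r<n using (Invariant; invariant)
    open Invariant invariant using (lengthV; lengthE; has-root; reachable; ends∈; acyclic; counts)

    V E : Bits
    V = spanned n es F r
    E = grown n es F r

    result : Subgraph
    result = subgraph (grow n es F r)

    toList-V : toList (Subgraph.V result) ≡ V
    toList-V = toList-subset n V lengthV

    toList-E : toList (Subgraph.E result) ≡ E
    toList-E = toList-subset (Graph.m G) E (trans lengthE length-es)

    ∈V⇒ : ∀ {v} → v ∈ˢ Subgraph.V result → V ! toℕ v ≡ true
    ∈V⇒ {v} v∈ = subst (λ z → z ! toℕ v ≡ true) toList-V (∈⇒! v∈)

    ⇒∈V : ∀ {v} → V ! toℕ v ≡ true → v ∈ˢ Subgraph.V result
    ⇒∈V {v} h = !⇒∈ (subst (λ z → z ! toℕ v ≡ true) (sym toList-V) h)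

    ∈E⇒ : ∀ {e} → e ∈ˢ Subgraph.E result → E ! toℕ e ≡ true
    ∈E⇒ {e} e∈ = subst (λ z → z ! toℕ e ≡ true) toList-E (∈⇒! e∈)

    ⇒∈E : ∀ {e} → E ! toℕ e ≡ true → e ∈ˢ Subgraph.E result
    ⇒∈E {e} h = !⇒∈ (subst (λ z → z ! toℕ e ≡ true) (sym toList-E) h)

    isSubtree : IsSubtree result
    isSubtree = record
      { ends-in   = λ e e∈ → let s , t = ends∈ (toℕ e) (toℕ<m e) (∈E⇒ e∈) in
          ⇒∈V (subst (λ z → V ! z ≡ true) (src-es e) s) , ⇒∈V (subst (λ z → V ! z ≡ true) (tgt-es e) t)
      ; nonempty  = fromℕ< r<n , ⇒∈V (subst (λ z → V ! z ≡ true) (sym (toℕ-fromℕ< r<n)) has-root)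
      ; connected = λ u v u∈ v∈ → fromConn {B = E} (λ e → ⇒∈E) (back (reachable _ (∈V⇒ u∈)) ▷ reachable _ (∈V⇒ v∈)) refl refl
      ; acyclic   = λ u w (≢[] , unique , _) → ≢[] (empty (edgesOf w) (trans (sym (trail-toConn (λ _ → ∈E⇒) w))
          (acyclic _ (toConn (λ _ → ∈E⇒) w) (subst Unique (sym (trail-toConn (λ _ → ∈E⇒) w)) (map⁺ toℕ-injective unique)))))
      }
      where
      empty : ∀ (xs : List Edge) → map toℕ xs ≡ [] → xs ≡ []
      empty [] _ = refl

    enc-result : encSubgraph result ≡ enc tree (grow n es F r)
    enc-result = cong₂ (λ V E → encList encBool V ∙ encList encBool E) toList-V toList-E

    edgeCount≡ : edgeCount result ≡ count m (E !_)
    edgeCount≡ = trans (card≡count (Subgraph.E result)) (cong₂ (λ z k → count k (z !_)) toList-E (sym length-es))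

    nodeCount≡ : nodeCount result ≡ suc (edgeCount result)
    nodeCount≡ = trans (card≡count (Subgraph.V result)) (trans (cong (λ z → count n (z !_)) toList-V) (trans counts (cong suc (sym edgeCount≡))))

module MakeGraph (n : ℕ) (es : Edges) (bounded : ∀ j → j < length es → src es j < tgt es j × tgt es j < n) (unique : Unique es) where

  edge : Fin (length es) → ℕ × ℕ
  edge e = nth (0 , 0) es (toℕ e)

  graph : Graph
  graph = record
    { n         = n
    ; m         = length es
    ; ends      = λ e → fromℕ< (s<n e) , fromℕ< (t<n e)
    ; ordered   = λ e → subst₂ _<_ (sym (toℕ-fromℕ< (s<n e))) (sym (toℕ-fromℕ< (t<n e))) (proj₁ (bounded _ (toℕ<n e)))
    ; injective = λ {e} {e′} eq → toℕ-injective (nth-injective (0 , 0) unique (toℕ<n e) (toℕ<n e′)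
        (cong₂ _,_ (trans (sym (toℕ-fromℕ< (s<n e))) (trans (cong toℕ (proj₁ (,-injective eq))) (toℕ-fromℕ< (s<n e′))))
                   (trans (sym (toℕ-fromℕ< (t<n e))) (trans (cong toℕ (proj₂ (,-injective eq))) (toℕ-fromℕ< (t<n e′))))))
    }
    where
    t<n : ∀ e → tgt es (toℕ e) < n
    t<n e = proj₂ (bounded _ (toℕ<n e))
    s<n : ∀ e → src es (toℕ e) < n
    s<n e = <-trans (proj₁ (bounded _ (toℕ<n e))) (t<n e)

  edgeData-graph : es ≡ edgeData graph
  edgeData-graph = sym (trans (tabulate-cong (λ e → cong₂ _,_ (toℕ-fromℕ< _) (toℕ-fromℕ< _))) (tabulate-nth es))
    where
    tabulate-nth : ∀ (xs : Edges) → tabulate {n = length xs} (λ e → nth (0 , 0) xs (toℕ e)) ≡ xs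
    tabulate-nth []       = refl
    tabulate-nth (x ∷ xs) = cong (x ∷_) (tabulate-nth xs)

-- Translating instances and solutions

ratOf : ℚ → Rat
ratOf q = bitsOf (fromℕ ℤ.∣ ↥ q ∣) , bitsOf (fromℕ (↧ₙ q))

enc-ratOf : ∀ q → enc rat (ratOf q) ≡ encℚ q
enc-ratOf q = cong₂ _∙_ (enc-bitsOf (fromℕ ℤ.∣ ↥ q ∣)) (enc-bitsOf (fromℕ (↧ₙ q)))

gstData : GSTInstance → Gst
gstData I = n , tabulate (λ e → endsᴺ graph e , ratOf (cost e)) , tabulate (toList ∘ group)
  where open GSTInstance I

enc-gstData : ∀ I → enc gst (gstData I) ≡ MinimizationProblem.encInstance GroupSteinerTree I
enc-gstData I = cong (encUnary n ∙_) (cong₂ _∙_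
  (encList-tabulate (enc (pair ⊗ rat)) (λ e → encEdge e ∙ encℚ (cost e)) _ id (λ e → cong (encEdge e ∙_) (enc-ratOf (cost e))))
  (encList-tabulate (enc bits) encSubset _ group (λ _ → refl)))
  where open GSTInstance I

≤-min : ∀ {c} a b → c ≤ a → c ≤ b → c ≤ (if a <ᵇ b then a else b)
≤-min a b c≤a c≤b with a <ᵇ b
... | true  = c≤a
... | false = c≤b

if-mono : ∀ {a b} x → (a ≡ true → b ≡ true) → (if a then x else 0) ≤ (if b then x else 0)
if-mono {false} x h = z≤n
if-mono {true}  x h rewrite h refl = ≤-refl

module ForInstance (εₙ εᵈ : ℕ) (I : GSTInstance) (M : Rat) where

  open Algorithm εₙ εᵈ hiding (cost)
  open GSTInstance I using (n; graph; cost; group) renaming (m to edgeNumber; k to groupNumber)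
  private
    module G = GSTInstance I

  g : Gst
  g = gstData I

  es : Edges
  es = edges g

  gs : List Bits
  gs = groups g

  es≡ : es ≡ edgeData graph
  es≡ = map-tabulate (λ e → endsᴺ graph e , ratOf (cost e)) proj₁

  module OG = OnGraph graph es es≡

  ke : ℕ → Bool
  ke = keep g M

  ln : ℕ → ℕ
  ln = len g M

  maxL : ℕ
  maxL = maxLen g

  ln≤ : ∀ e → ln e ≤ suc (maxL ∸ 1)
  ln≤ e = ≤-trans (find≤ maxL _) (lem maxL)
    where
    lem : ∀ x → x ≤ suc (x ∸ 1)
    lem zero    = z≤n
    lem (suc x) = ≤-refl

  module R  = Reduction n es gs (maxL ∸ 1) ke ln
  module Th = Theory n es gs (maxL ∸ 1) ke ln OG.ends< ln≤

  open Connection es using (Conn) renaming (_▷_ to _▷ᵍ_; back to backᵍ)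

  length-gs : R.k ≡ groupNumber
  length-gs = length-tabulate (toList ∘ group)

  group-bit : ∀ i (v : Fin n) → nth [] gs (toℕ i) ! toℕ v ≡ toList (group i) ! toℕ v
  group-bit i v = cong (λ z → z ! toℕ v) (nth-tabulate [] groupNumber (toList ∘ group) i)

  group-at : ∀ {i} → i < R.k → ∃[ i′ ] toℕ {groupNumber} i′ ≡ i
  group-at {i} i<k = fromℕ< (subst (i <_) length-gs i<k) , toℕ-fromℕ< _

  toℕ<k : ∀ (i : Fin groupNumber) → toℕ i < R.k
  toℕ<k i = subst (toℕ i <_) (sym length-gs) (toℕ<n i)

  Hits : Bits → ℕ → Set
  Hits F v = ∀ i → i < R.k → ∃[ w ] w < n × nth [] gs i ! w ≡ true × Conn F v w

  treeHits : ∀ {H} → G.IsGroupSteinerTree H → Σ G.Node λ v → Hits (toList (G.Subgraph.E H)) (toℕ v)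
  treeHits {H} H✓ = proj₁ nonempty , λ i i<k → let i′ , eq = group-at i<k ; w , w∈i , w∈V = hits i′ in
      toℕ w , toℕ<n w , trans (cong (λ z → nth [] gs z ! toℕ w) (sym eq)) (trans (group-bit i′ w) (∈⇒! w∈i)) ,
      OG.toConn (λ _ → ∈⇒!) (connected _ _ (proj₂ nonempty) w∈V)
    where
    open G.IsGroupSteinerTree H✓
    open G.IsSubtree subtree

  bounded : ∀ j → j < Th.m′ → src R.cdsEdges j < tgt R.cdsEdges j × tgt R.cdsEdges j < R.N
  bounded j j<m′ = Th.edge-ordered j<m′ , proj₁ (proj₂ (Th.edge∈ j<m′))

  module MG = MakeGraph R.N R.cdsEdges bounded Th.cdsEdges-unique

  instanceᶜ : CDSInstance
  instanceᶜ = record { graph = MG.graph ; Q = subset R.N R.cdsQ }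

  private
    module C = CDSInstance instanceᶜ

  module OC = OnGraph MG.graph R.cdsEdges MG.edgeData-graph

  toList-Q : toList C.Q ≡ R.cdsQ
  toList-Q = toList-subset R.N R.cdsQ (length-applyUpTo _ R.N)

  enc-instance : enc cdsᵗ (cds g M) ≡ MinimizationProblem.encInstance UnitEdgeCostsCDS instanceᶜ
  enc-instance = cong (encUnary R.N ∙_) (cong₂ _∙_
    (trans (cong (enc edgesᵗ) MG.edgeData-graph) (sym (enc-edgeData MG.graph)))
    (cong (encList encBool) (sym toList-Q)))

  Q-bit : ∀ x → toList C.Q ! toℕ x ≡ (toℕ x <ᵇ n) ∨ not (toℕ x <ᵇ n + R.k)
  Q-bit x = trans (cong (λ z → z ! toℕ x) toList-Q) (!-applyUpTo _ R.N (toℕ<n x))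

  ∈Q⇒allowed : ∀ {x} → x ∈ˢ C.Q → Th.Allowed (toℕ x)
  ∈Q⇒allowed {x} x∈ with ∨-true {toℕ x <ᵇ n} (trans (sym (Q-bit x)) (∈⇒! x∈))
  ... | inj₁ lt = toℕ<n x , inj₁ (<ᵇ-true lt)
  ... | inj₂ ge = toℕ<n x , inj₂ (<ᵇ-false (not-true ge))

  allowed⇒∈Q : ∀ {x} → Th.Allowed (toℕ x) → x ∈ˢ C.Q
  allowed⇒∈Q {x} (_ , a) = !⇒∈ (trans (Q-bit x) (case a))
    where
    case : toℕ x < n ⊎ n + R.k ≤ toℕ x → (toℕ x <ᵇ n) ∨ not (toℕ x <ᵇ n + R.k) ≡ true
    case (inj₁ lt) = ∨-introˡ (<ᵇ-intro lt)
    case (inj₂ ge) = ∨-introʳ {toℕ x <ᵇ n} (not-intro (≥-intro ge))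

  module Forward (F₀ : Bits) (F₀⊆kept : ∀ e → e < R.m → F₀ ! e ≡ true → ke e ≡ true)
                 (v₀ : ℕ) (v₀<n : v₀ < n) (hits : Hits F₀ v₀) where

    open Th.Forth F₀ F₀⊆kept

    r<N : Th.Allowed (R.rep v₀)
    r<N = Th.original (proj₁ (Th.rep-spec v₀<n))

    module Gr = OC.Grown image (R.rep v₀) (proj₁ r<N)
    open Growth.Invariant (Growth.invariant R.N R.cdsEdges OC.ends< image (R.rep v₀) (proj₁ r<N)) using (reachable; E⊆F)

    solution : C.Subgraph
    solution = Gr.result

    isSolution : C.IsSteinerCDS solution
    isSolution = record
      { subtree   = Gr.isSubtree
      ; inside    = λ {x} x∈ → allowed⇒∈Q (stays-allowed r<N (Connection.Conn-mono R.cdsEdges E⊆F (reachable _ (Gr.∈V⇒ x∈))))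
      ; dominates = dominated
      }
      where
      dominated : ∀ r → r ∈ˢ C.R → ∃[ v ] v ∈ˢ C.Subgraph.V solution × C.Adjacent r v
      dominated r r∈R = v , v∈ , OC.source-adjacent e t≡
        where
        r∉Q : ¬ r ∈ˢ C.Q
        r∉Q = x∈∁p⇒x∉p {p = C.Q} r∈R
        n≤r : n ≤ toℕ r
        n≤r = ≮⇒≥ λ lt → r∉Q (allowed⇒∈Q (toℕ<n r , inj₁ lt))
        r<n+k : toℕ r < n + R.k
        r<n+k = ≰⇒> λ ge → r∉Q (allowed⇒∈Q (toℕ<n r , inj₂ ge))
        r≡ : n + (toℕ r ∸ n) ≡ toℕ r
        r≡ = m+[n∸m]≡n n≤r
        i<k : toℕ r ∸ n < R.k
        i<k = +-cancelˡ-< n _ _ (subst (_< n + R.k) (sym r≡) r<n+k)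
        hit : ∃[ w ] w < n × nth [] gs (toℕ r ∸ n) ! w ≡ true × Conn F₀ v₀ w
        hit = hits (toℕ r ∸ n) i<k
        w : ℕ
        w = proj₁ hit
        index : ∃[ j ] j < Th.m′ × Th.h j ≡ (R.rep w , n + (toℕ r ∸ n))
        index = Th.groupEdge-index i<k (proj₁ (proj₂ hit)) (proj₁ (proj₂ (proj₂ hit)))
        e : C.Edge
        e = proj₁ (OC.edge-at (proj₁ (proj₂ index)))
        ends≡ : endsᴺ MG.graph e ≡ (R.rep w , n + (toℕ r ∸ n))
        ends≡ = trans (sym (OC.nth-es e)) (trans (cong Th.h (proj₂ (OC.edge-at (proj₁ (proj₂ index))))) (proj₂ (proj₂ index)))
        t≡ : toℕ (proj₂ (C.ends e)) ≡ toℕ r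
        t≡ = trans (cong proj₂ ends≡) r≡
        v : C.Node
        v = proj₁ (C.ends e)
        v∈ : v ∈ˢ C.Subgraph.V solution
        v∈ = Gr.⇒∈V (subst (λ z → Gr.V ! z ≡ true) (sym (cong proj₁ ends≡))
          (Growth.spans R.N R.cdsEdges OC.ends< image (R.rep v₀) (proj₁ r<N) (transport (proj₂ (proj₂ (proj₂ hit))))))

    edgeCount-bound : C.edgeCount solution ≤ Sum R.m (λ e → if F₀ ! e then ln e else 0)
    edgeCount-bound = ≤-trans (≤-reflexive Gr.edgeCount≡) (≤-trans (count-mono _ E⊆F) image-size)

    nodeCount-bound : C.nodeCount solution ≤ suc (Sum R.m (λ e → if F₀ ! e then ln e else 0))
    nodeCount-bound = ≤-trans (≤-reflexive Gr.nodeCount≡) (s≤s edgeCount-bound)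

  solutionData : C.Subgraph → Tree
  solutionData S = toList (C.Subgraph.V S) , toList (C.Subgraph.E S)

  module Backward (S : C.Subgraph) (S✓ : C.IsSteinerCDS S) (n>0 : 0 < n) where

    open C.IsSteinerCDS S✓
    open C.IsSubtree subtree

    VS ES : Bits
    VS = toList (C.Subgraph.V S)
    ES = toList (C.Subgraph.E S)

    start : ℕ
    start = find R.N (VS !_)

    found : start < R.N × VS ! start ≡ true
    found = find-found R.N (VS !_) (toℕ (proj₁ nonempty)) (toℕ<n _) (∈⇒! (proj₂ nonempty))

    module Gr = OC.Grown ES start (proj₁ found)
    open Growth.Invariant (Growth.invariant R.N R.cdsEdges OC.ends< ES start (proj₁ found)) using (reachable; E⊆F; counts)

    B : Bits
    B = prune g M R.cdsEdges (VS , ES)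

    startFin : Σ C.Node λ x → toℕ x ≡ start × x ∈ˢ C.Subgraph.V S
    startFin = fromℕ< (proj₁ found) , toℕ-fromℕ< _ , !⇒∈ (subst (λ z → VS ! z ≡ true) (sym (toℕ-fromℕ< (proj₁ found))) (proj₂ found))

    open Connection R.cdsEdges using () renaming (Conn to Conn′; _▷_ to _▷′_; back to back′; stop to stop′; step to step′; Conn-mono to Conn′-mono)

    connected-B : ∀ {x} → x ∈ˢ C.Subgraph.V S → Conn′ B start (toℕ x)
    connected-B {x} x∈ = reachable _ (Growth.spans R.N R.cdsEdges OC.ends< ES start (proj₁ found)
      (subst (λ z → Conn′ ES z (toℕ x)) (proj₁ (proj₂ startFin)) (OC.toConn (λ _ → ∈⇒!) (connected (proj₁ startFin) x (proj₂ (proj₂ startFin)) x∈))))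

    B⊆ES : ∀ j → j < Th.m′ → B ! j ≡ true → ES ! j ≡ true
    B⊆ES = E⊆F

    ES-ends : ∀ j → j < Th.m′ → ES ! j ≡ true → VS ! src R.cdsEdges j ≡ true × VS ! tgt R.cdsEdges j ≡ true
    ES-ends j j<m′ = subst (λ j → ES ! j ≡ true → VS ! src R.cdsEdges j ≡ true × VS ! tgt R.cdsEdges j ≡ true)
      (proj₂ (OC.edge-at j<m′)) (at-edge (proj₁ (OC.edge-at j<m′)))
      where
      at-edge : ∀ e → ES ! toℕ e ≡ true → VS ! src R.cdsEdges (toℕ e) ≡ true × VS ! tgt R.cdsEdges (toℕ e) ≡ true
      at-edge e h = subst (λ z → VS ! z ≡ true) (sym (OC.src-es e)) (∈⇒! (proj₁ (ends-in e (!⇒∈ h))))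
                  , subst (λ z → VS ! z ≡ true) (sym (OC.tgt-es e)) (∈⇒! (proj₂ (ends-in e (!⇒∈ h))))

    VS-allowed : ∀ x → VS ! x ≡ true → Th.Allowed x
    VS-allowed x h = subst Th.Allowed x≡ (∈Q⇒allowed (inside (!⇒∈ {i = fromℕ< x<N} (subst (λ z → VS ! z ≡ true) (sym x≡) h))))
      where
      x<N : x < R.N
      x<N = subst (x <_) (length-toList (C.Subgraph.V S)) (!-bounded VS h)
      x≡ : toℕ (fromℕ< x<N) ≡ x
      x≡ = toℕ-fromℕ< x<N

    B-allowed : ∀ j → j < Th.m′ → B ! j ≡ true → Th.Allowed (proj₂ (Th.h j))
    B-allowed j j<m′ h = VS-allowed _ (proj₂ (ES-ends j j<m′ (B⊆ES j j<m′ h)))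

    open Th.Back B B-allowed hiding (F)

    F : Bits
    F = backEdges g M R.cdsEdges (VS , ES)

    dominator : ∀ i → i < R.k → ∃[ w ] w < n × nth [] gs i ! w ≡ true × Conn′ B start (R.rep w)
    dominator i i<k = proj₁ found-w , proj₁ (proj₂ found-w) , proj₁ (proj₂ (proj₂ found-w)) ,
        subst (Conn′ B start) (sym (proj₂ (proj₂ (proj₂ found-w)))) (connected-B v∈)
      where
      r<N : n + i < R.N
      r<N = ≤-trans (+-monoʳ-< n i<k) (m≤m+n (n + R.k) _)
      r : C.Node
      r = fromℕ< r<N
      r≡ : toℕ r ≡ n + i
      r≡ = toℕ-fromℕ< r<N
      dominated : ∃[ v ] v ∈ˢ C.Subgraph.V S × C.Adjacent r v
      dominated = dominates r (x∉p⇒x∈∁p (λ r∈Q → Th.not-allowed i<k (subst Th.Allowed r≡ (∈Q⇒allowed r∈Q))))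
      v : C.Node
      v = proj₁ dominated
      v∈ : v ∈ˢ C.Subgraph.V S
      v∈ = proj₁ (proj₂ dominated)
      e : C.Edge
      e = proj₁ (proj₂ (proj₂ dominated))
      edge : ∀ {x y} → C.ends e ≡ (x , y) → R.isEdge (toℕ x , toℕ y) ≡ true
      edge eq = subst (λ h → R.isEdge h ≡ true) (trans (OC.nth-es e) (cong (λ p → toℕ (proj₁ p) , toℕ (proj₂ p)) eq))
        (proj₂ (proj₂ (Th.edge∈ (OC.toℕ<m e))))
      found-w : ∃[ w ] w < n × nth [] gs i ! w ≡ true × R.rep w ≡ toℕ v
      found-w = Th.group-neighbour i<k (∈Q⇒allowed (inside v∈)) (⊎.map edge edge (proj₂ (proj₂ (proj₂ dominated)))) r≡

    -- The tree may begin at an inner node of a path, so the translation starts from the class that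
    -- dominates the first group. Without groups the tree may avoid the original nodes altogether,
    -- and then node 0 serves.
    anchor : ∃[ v ] v < n × Hits F v
    anchor = by-cases R.k refl
      where
      by-cases : ∀ k → R.k ≡ k → ∃[ v ] v < n × Hits F v
      by-cases zero    k≡ = 0 , n>0 , λ i i<k → ⊥-elim (n≮0 (subst (i <_) k≡ i<k))
      by-cases (suc _) k≡ = R.rep w₀ , v₀<n , λ i i<k → let w , w<n , gw , c = dominator i i<k in
          w , w<n , gw , (translate (R.rep w₀) v₀<n (back′ c₀ ▷′ c) (proj₁ (Th.rep-spec w<n)) ▷ᵍ backᵍ (reps (R.rep w₀) v₀<n w<n))
        where
        first : ∃[ w ] w < n × nth [] gs 0 ! w ≡ true × Conn′ B start (R.rep w)
        first = dominator 0 (subst (0 <_) (sym k≡) (s≤s z≤n))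
        w₀ : ℕ
        w₀ = proj₁ first
        c₀ : Conn′ B start (R.rep w₀)
        c₀ = proj₂ (proj₂ (proj₂ first))
        v₀<n : R.rep w₀ < n
        v₀<n = proj₁ (Th.rep-spec (proj₁ (proj₂ first)))

    root<n : R.root F < n
    root<n = let v , v<n , hits = anchor in Th.root-intro F v<n hits

    module GT = OG.Grown F (R.root F) root<n
    module Inv = Growth.Invariant (Growth.invariant n es OG.ends< F (R.root F) root<n)

    result : G.Subgraph
    result = GT.result

    isResult : G.IsGroupSteinerTree result
    isResult = record { subtree = GT.isSubtree ; hits = hit }
      where
      hit : ∀ i → ∃[ v ] v ∈ˢ group i × v ∈ˢ G.Subgraph.V result
      hit i = fromℕ< w<n
        , !⇒∈ (trans (sym (group-bit i (fromℕ< w<n))) (trans (cong (nth [] gs (toℕ i) !_) (toℕ-fromℕ< w<n)) (proj₁ (proj₂ (proj₂ found-w)))))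
        , GT.⇒∈V (subst (λ z → GT.V ! z ≡ true) (sym (toℕ-fromℕ< w<n)) (proj₂ (proj₂ (proj₂ found-w))))
        where
        found-w : ∃[ w ] w < n × nth [] gs (toℕ i) ! w ≡ true × GT.V ! w ≡ true
        found-w = Th.root-elim F root<n (toℕ i) (toℕ<k i)
        w<n : proj₁ found-w < n
        w<n = proj₁ (proj₂ found-w)

    enc-result : G.encSubgraph result ≡ enc tree (backTree g M R.cdsEdges (VS , ES))
    enc-result = trans GT.enc-result (cong (enc tree) (sym (backTree-def g M R.cdsEdges (VS , ES))))

    result-kept : ∀ e → e < R.m → GT.E ! e ≡ true → ke e ≡ true
    result-kept e e<m h = F⊆kept e<m (Inv.E⊆F e e<m h)

    result-edges : count R.m (GT.E !_) ≤ rank g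
    result-edges = ≤-min n (length es) (≤-trans (n≤1+n _) (≤-trans (≤-reflexive (sym Inv.counts)) (count≤ n _))) (count≤ R.m _)

    pruned-nodes : suc (count Th.m′ (B !_)) ≤ C.nodeCount S
    pruned-nodes = begin
      suc (count Th.m′ (B !_))           ≡⟨ counts ⟨
      count R.N (Gr.V !_)                ≤⟨ count-mono R.N (λ x _ h → closed-V (Conn′-mono E⊆F (reachable x h)) (proj₂ found)) ⟩
      count R.N (VS !_)                  ≡⟨ card≡count (C.Subgraph.V S) ⟨
      C.nodeCount S                      ∎
      where
      open ≤-Reasoning
      closed-V : ∀ {x y} → Conn′ ES x y → VS ! x ≡ true → VS ! y ≡ true
      closed-V stop′ h = h
      closed-V (step′ j t j<m′ (inj₁ (refl , refl)) c) h = closed-V c (proj₂ (ES-ends j j<m′ t))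
      closed-V (step′ j t j<m′ (inj₂ (refl , refl)) c) h = closed-V c (proj₁ (ES-ends j j<m′ t))

    pruned-edges : count Th.m′ (B !_) ≤ C.edgeCount S
    pruned-edges = ≤-trans (count-mono Th.m′ B⊆ES) (≤-reflexive (sym (card≡count (C.Subgraph.E S))))

    result-score : score g M (backTree g M R.cdsEdges (VS , ES)) ≡ Sum R.m (λ e → if GT.E ! e then ln e else 0) + rank g
    result-score = trans (cong (score g M) (backTree-def g M R.cdsEdges (VS , ES))) (score-def g M _)

    result-length : Sum R.m (λ e → if GT.E ! e then ln e else 0) ≤ count Th.m′ (B !_)
    result-length = ≤-trans (Sum-mono R.m λ e e<m → if-mono (ln e) (Inv.E⊆F e e<m)) total

-- Scaled costs

opaque
  -- The embedding of the natural numbers, not a floor function.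
  ⌊_⌋ : ℕ → ℚ
  ⌊_⌋ = fromℕℚ

  ⌊⌋-def : ∀ k → ⌊ k ⌋ ≡ fromℕℚ k
  ⌊⌋-def k = refl

  ⌊0⌋≡0 : ⌊ 0 ⌋ ≡ 0ℚ
  ⌊0⌋≡0 = refl

  ⌊1⌋* : ∀ q → ⌊ 1 ⌋ *q q ≡ q
  ⌊1⌋* q = ℚP.*-identityˡ q

  toℚᵘ-⌊⌋ : ∀ k → toℚᵘ ⌊ k ⌋ ℚᵘ.≃ mkℚᵘ (ℤ.+ k) 0
  toℚᵘ-⌊⌋ k = ℚP.toℚᵘ-fromℚᵘ (mkℚᵘ (ℤ.+ k) 0)

⌊⌋-+ : ∀ m n → ⌊ m + n ⌋ ≡ ⌊ m ⌋ +q ⌊ n ⌋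
⌊⌋-+ m n = ℚP.toℚᵘ-injective (begin
  toℚᵘ ⌊ m + n ⌋                              ≈⟨ toℚᵘ-⌊⌋ (m + n) ⟩
  mkℚᵘ (ℤ.+ (m + n)) 0                        ≈⟨ *≡* (cong (ℤ._* ℤ.+ 1) (cong₂ ℤ._+_ (sym (ℤ.*-identityʳ (ℤ.+ m))) (sym (ℤ.*-identityʳ (ℤ.+ n))))) ⟩
  mkℚᵘ (ℤ.+ m) 0 ℚᵘ.+ mkℚᵘ (ℤ.+ n) 0          ≈⟨ ℚᵘP.+-cong (toℚᵘ-⌊⌋ m) (toℚᵘ-⌊⌋ n) ⟨
  toℚᵘ ⌊ m ⌋ ℚᵘ.+ toℚᵘ ⌊ n ⌋                  ≈⟨ ℚP.toℚᵘ-homo-+ ⌊ m ⌋ ⌊ n ⌋ ⟨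
  toℚᵘ (⌊ m ⌋ +q ⌊ n ⌋)                       ∎)
  where open ℚᵘP.≃-Reasoning

⌊⌋-* : ∀ m n → ⌊ m * n ⌋ ≡ ⌊ m ⌋ *q ⌊ n ⌋
⌊⌋-* m n = ℚP.toℚᵘ-injective (begin
  toℚᵘ ⌊ m * n ⌋                              ≈⟨ toℚᵘ-⌊⌋ (m * n) ⟩
  mkℚᵘ (ℤ.+ (m * n)) 0                        ≈⟨ *≡* (cong (ℤ._* ℤ.+ 1) (ℤ.pos-* m n)) ⟩
  mkℚᵘ (ℤ.+ m) 0 ℚᵘ.* mkℚᵘ (ℤ.+ n) 0          ≈⟨ ℚᵘP.*-cong (toℚᵘ-⌊⌋ m) (toℚᵘ-⌊⌋ n) ⟨
  toℚᵘ ⌊ m ⌋ ℚᵘ.* toℚᵘ ⌊ n ⌋                  ≈⟨ ℚP.toℚᵘ-homo-* ⌊ m ⌋ ⌊ n ⌋ ⟨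
  toℚᵘ (⌊ m ⌋ *q ⌊ n ⌋)                       ∎)
  where open ℚᵘP.≃-Reasoning

⌊⌋-mono-≤ : ∀ {m n} → m ≤ n → ⌊ m ⌋ ≤q ⌊ n ⌋
⌊⌋-mono-≤ {m} {n} m≤n = ℚP.toℚᵘ-cancel-≤ (ℚᵘP.≤-respˡ-≃ (ℚᵘP.≃-sym (toℚᵘ-⌊⌋ m)) (ℚᵘP.≤-respʳ-≃ (ℚᵘP.≃-sym (toℚᵘ-⌊⌋ n))
  (*≤* (ℤ.*-monoʳ-≤-nonNeg (ℤ.+ 1) (ℤ.+≤+ m≤n)))))

⌊⌋-mono-< : ∀ {m n} → m < n → ⌊ m ⌋ <q ⌊ n ⌋
⌊⌋-mono-< {m} {n} m<n = ℚP.toℚᵘ-cancel-< (ℚᵘP.<-respˡ-≃ (ℚᵘP.≃-sym (toℚᵘ-⌊⌋ m)) (ℚᵘP.<-respʳ-≃ (ℚᵘP.≃-sym (toℚᵘ-⌊⌋ n))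
  (*<* (ℤ.*-monoʳ-<-pos (ℤ.+ 1) (ℤ.+<+ m<n)))))

0≤⌊⌋ : ∀ k → 0ℚ ≤q ⌊ k ⌋
0≤⌊⌋ k = subst (_≤q ⌊ k ⌋) ⌊0⌋≡0 (⌊⌋-mono-≤ {0} {k} z≤n)

⌊⌋-pos : ∀ k → Positive ⌊ suc k ⌋
⌊⌋-pos k = positive (subst (_<q ⌊ suc k ⌋) ⌊0⌋≡0 (⌊⌋-mono-< {0} {suc k} (s≤s z≤n)))

*-monoˡ : ∀ {r p q} → 0ℚ ≤q r → p ≤q q → r *q p ≤q r *q q
*-monoˡ {r} 0≤r = ℚP.*-monoˡ-≤-nonNeg r {{nonNegative 0≤r}}

*-monoʳ : ∀ {r p q} → 0ℚ ≤q r → p ≤q q → p *q r ≤q q *q r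
*-monoʳ {r} 0≤r = ℚP.*-monoʳ-≤-nonNeg r {{nonNegative 0≤r}}

*-nonNeg : ∀ {p q} → 0ℚ ≤q p → 0ℚ ≤q q → 0ℚ ≤q p *q q
*-nonNeg {p} {q} 0≤p 0≤q = subst (_≤q p *q q) (ℚP.*-zeroʳ p) (*-monoˡ 0≤p 0≤q)

*-⌊0⌋ : ∀ q → q *q ⌊ 0 ⌋ ≡ 0ℚ
*-⌊0⌋ q = trans (cong (q *q_) ⌊0⌋≡0) (ℚP.*-zeroʳ q)

numerator : ℚ → ℕ
numerator q = ℤ.∣ ↥ q ∣

clear-denominator : ∀ q → 0ℚ ≤q q → q *q ⌊ ↧ₙ q ⌋ ≡ ⌊ numerator q ⌋
clear-denominator (ℚ.mkℚ (ℤ.-[1+ a ]) d c) 0≤q with ℚP.drop-*≤* 0≤q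
... | ()
clear-denominator q@(ℚ.mkℚ (ℤ.+ a) d c) _ = ℚP.toℚᵘ-injective (begin
  toℚᵘ (q *q ⌊ suc d ⌋)                       ≈⟨ ℚP.toℚᵘ-homo-* q ⌊ suc d ⌋ ⟩
  mkℚᵘ (ℤ.+ a) d ℚᵘ.* toℚᵘ ⌊ suc d ⌋          ≈⟨ ℚᵘP.*-cong (ℚᵘP.≃-refl {mkℚᵘ (ℤ.+ a) d}) (toℚᵘ-⌊⌋ (suc d)) ⟩
  mkℚᵘ (ℤ.+ a) d ℚᵘ.* mkℚᵘ (ℤ.+ suc d) 0      ≈⟨ *≡* (trans (ℤ.*-identityʳ (ℤ.+ a ℤ.* ℤ.+ suc d)) (cong (λ z → ℤ.+ a ℤ.* ℤ.+ suc z) (sym (*-identityʳ d)))) ⟩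
  mkℚᵘ (ℤ.+ a) 0                              ≈⟨ toℚᵘ-⌊⌋ a ⟨
  toℚᵘ ⌊ a ⌋                                  ∎)
  where open ℚᵘP.≃-Reasoning

val-fromℕ : ∀ k → val (bitsOf (fromℕ k)) ≡ k
val-fromℕ k = trans (val-bitsOf (fromℕ k)) (toℕ-fromℕ k)

module _ {x y : ℚ} (0≤x : 0ℚ ≤q x) (0≤y : 0ℚ ≤q y) (j i : ℕ) where

  private
    b d a c : ℕ
    a = numerator x
    b = ↧ₙ x
    c = numerator y
    d = ↧ₙ y

    common : ℚ
    common = ⌊ b * d ⌋

    common-pos : Positive common
    common-pos = ⌊⌋-pos (ℚ.denominator-1 y + ℚ.denominator-1 x * d)

    lhs : (⌊ j ⌋ *q x) *q common ≡ ⌊ j * (a * d) ⌋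
    lhs = begin
      (⌊ j ⌋ *q x) *q ⌊ b * d ⌋            ≡⟨ cong ((⌊ j ⌋ *q x) *q_) (⌊⌋-* b d) ⟩
      (⌊ j ⌋ *q x) *q (⌊ b ⌋ *q ⌊ d ⌋)     ≡⟨ ℚP.*-assoc ⌊ j ⌋ x _ ⟩
      ⌊ j ⌋ *q (x *q (⌊ b ⌋ *q ⌊ d ⌋))     ≡⟨ cong (⌊ j ⌋ *q_) (ℚP.*-assoc x ⌊ b ⌋ ⌊ d ⌋) ⟨
      ⌊ j ⌋ *q (x *q ⌊ b ⌋ *q ⌊ d ⌋)       ≡⟨ cong (λ z → ⌊ j ⌋ *q (z *q ⌊ d ⌋)) (clear-denominator x 0≤x) ⟩
      ⌊ j ⌋ *q (⌊ a ⌋ *q ⌊ d ⌋)            ≡⟨ cong (⌊ j ⌋ *q_) (⌊⌋-* a d) ⟨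
      ⌊ j ⌋ *q ⌊ a * d ⌋                   ≡⟨ ⌊⌋-* j (a * d) ⟨
      ⌊ j * (a * d) ⌋                      ∎
      where open ≡-Reasoning

    rhs : (⌊ i ⌋ *q y) *q common ≡ ⌊ i * (c * b) ⌋
    rhs = begin
      (⌊ i ⌋ *q y) *q ⌊ b * d ⌋            ≡⟨ cong (λ z → (⌊ i ⌋ *q y) *q ⌊ z ⌋) (*-comm b d) ⟩
      (⌊ i ⌋ *q y) *q ⌊ d * b ⌋            ≡⟨ cong ((⌊ i ⌋ *q y) *q_) (⌊⌋-* d b) ⟩
      (⌊ i ⌋ *q y) *q (⌊ d ⌋ *q ⌊ b ⌋)     ≡⟨ ℚP.*-assoc ⌊ i ⌋ y _ ⟩
      ⌊ i ⌋ *q (y *q (⌊ d ⌋ *q ⌊ b ⌋))     ≡⟨ cong (⌊ i ⌋ *q_) (ℚP.*-assoc y ⌊ d ⌋ ⌊ b ⌋) ⟨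
      ⌊ i ⌋ *q (y *q ⌊ d ⌋ *q ⌊ b ⌋)       ≡⟨ cong (λ z → ⌊ i ⌋ *q (z *q ⌊ b ⌋)) (clear-denominator y 0≤y) ⟩
      ⌊ i ⌋ *q (⌊ c ⌋ *q ⌊ b ⌋)            ≡⟨ cong (⌊ i ⌋ *q_) (⌊⌋-* c b) ⟨
      ⌊ i ⌋ *q ⌊ c * b ⌋                   ≡⟨ ⌊⌋-* i (c * b) ⟨
      ⌊ i * (c * b) ⌋                      ∎
      where open ≡-Reasoning

    integral : scaledLess j (ratOf x) i (ratOf y) ≡ (j * (a * d) <ᵇ i * (c * b))
    integral = trans (scaledLess-correct j (bitsOf (fromℕ a)) (bitsOf (fromℕ b)) i (bitsOf (fromℕ c)) (bitsOf (fromℕ d)))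
      (cong₂ _<ᵇ_ (cong₂ (λ u v → j * (u * v)) (val-fromℕ a) (val-fromℕ d)) (cong₂ (λ u v → i * (u * v)) (val-fromℕ c) (val-fromℕ b)))

  scaledLess-true : scaledLess j (ratOf x) i (ratOf y) ≡ true → ⌊ j ⌋ *q x <q ⌊ i ⌋ *q y
  scaledLess-true t = ℚP.*-cancelʳ-<-nonNeg common {{ℚP.pos⇒nonNeg common {{common-pos}}}}
    (subst₂ _<q_ (sym lhs) (sym rhs) (⌊⌋-mono-< {j * (a * d)} {i * (c * b)} (<ᵇ-true (trans (sym integral) t))))

  scaledLess-false : scaledLess j (ratOf x) i (ratOf y) ≡ false → ⌊ i ⌋ *q y ≤q ⌊ j ⌋ *q x
  scaledLess-false f = ℚP.*-cancelʳ-≤-pos common {{common-pos}}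
    (subst₂ _≤q_ (sym rhs) (sym lhs) (⌊⌋-mono-≤ {i * (c * b)} {j * (a * d)} (<ᵇ-false (trans (sym integral) f))))

  scaledLess-outro : ⌊ i ⌋ *q y ≤q ⌊ j ⌋ *q x → scaledLess j (ratOf x) i (ratOf y) ≡ false
  scaledLess-outro ge with bool? (scaledLess j (ratOf x) i (ratOf y))
  ... | inj₂ f = f
  ... | inj₁ t = ⊥-elim (ℚP.<-irrefl refl (ℚP.<-≤-trans (scaledLess-true t) ge))

-- Costs and lengths of subgraphs

Σq : ∀ {m} → (Fin m → ℚ) → ℚ
Σq = MonoidSum.sum ℚP.+-0-monoid

Σq-mono : ∀ {m} {f g : Fin m → ℚ} → (∀ i → f i ≤q g i) → Σq f ≤q Σq g
Σq-mono {zero}  h = ℚP.≤-refl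
Σq-mono {suc m} h = ℚP.+-mono-≤ (h zero) (Σq-mono (h ∘ suc))

Σq-scale : ∀ {m} r (f : Fin m → ℚ) → Σq (λ i → r *q f i) ≡ r *q Σq f
Σq-scale {zero}  r f = sym (ℚP.*-zeroʳ r)
Σq-scale {suc m} r f = trans (cong (r *q f zero +q_) (Σq-scale r (f ∘ suc))) (sym (ℚP.*-distribˡ-+ r _ _))

Σq-⌊⌋ : ∀ m (h : ℕ → ℕ) → Σq {m} (λ i → ⌊ h (toℕ i) ⌋) ≡ ⌊ Sum m h ⌋
Σq-⌊⌋ zero    h = sym ⌊0⌋≡0
Σq-⌊⌋ (suc m) h = trans (cong (⌊ h 0 ⌋ +q_) (Σq-⌊⌋ m (h ∘ suc))) (sym (⌊⌋-+ (h 0) _))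

if-upper : ∀ {P : Set} {K c q : ℚ} {l} (d : Dec P) b → (P → b ≡ true) → (b ≡ true → P) → (b ≡ true → K *q c ≤q q *q ⌊ suc l ⌋) →
           K *q (if does d then c else 0ℚ) ≤q q *q ⌊ (if b then l else 0) + ι b ⌋
if-upper {K = K} {c} {q} (yes p) b f g h rewrite f p = subst (λ z → K *q c ≤q q *q ⌊ z ⌋) (+-comm 1 _) (h refl)
if-upper {K = K} {q = q} (no ¬p) true  f g h = ⊥-elim (¬p (g refl))
if-upper {K = K} {q = q} (no ¬p) false f g h = ℚP.≤-reflexive (trans (ℚP.*-zeroʳ K) (sym (*-⌊0⌋ q)))

if-lower : ∀ {P : Set} {K c q : ℚ} {l} (d : Dec P) b → (P → b ≡ true) → (b ≡ true → P) → q *q ⌊ l ⌋ ≤q K *q c →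
           q *q ⌊ (if b then l else 0) ⌋ ≤q K *q (if does d then c else 0ℚ)
if-lower {K = K} {q = q} (yes p) b f g h rewrite f p = h
if-lower {K = K} {q = q} (no ¬p) true  f g h = ⊥-elim (¬p (g refl))
if-lower {K = K} {q = q} (no ¬p) false f g h = ℚP.≤-reflexive (trans (*-⌊0⌋ q) (sym (ℚP.*-zeroʳ K)))

if-does : ∀ {P A : Set} {x y : A} (d : Dec P) → P → (if does d then x else y) ≡ x
if-does (yes _) p = refl
if-does (no ¬p) p = ⊥-elim (¬p p)

min≤ˡ : ∀ a b → (if a <ᵇ b then a else b) ≤ a
min≤ˡ a b with bool? (a <ᵇ b)
... | inj₁ t rewrite t = ≤-refl
... | inj₂ f rewrite f = <ᵇ-false f

min≤ʳ : ∀ a b → (if a <ᵇ b then a else b) ≤ b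
min≤ʳ a b with bool? (a <ᵇ b)
... | inj₁ t rewrite t = <⇒≤ (<ᵇ-true t)
... | inj₂ f rewrite f = ≤-refl

module Costs (εₙ εᵈ : ℕ) (I : GSTInstance) (q : ℚ) (0≤q : 0ℚ ≤q q) where

  open Algorithm εₙ εᵈ using (maxLen; rank; keep; len)
  open ForInstance εₙ εᵈ I (ratOf q)
  open GSTInstance I using (cost; nonnegative; totalCost; Subgraph) renaming (m to edgeNumber)

  private
    module G = GSTInstance I

  K : ℕ
  K = suc maxL

  cost-at : ∀ e → Algorithm.cost εₙ εᵈ g (toℕ e) ≡ ratOf (cost e)
  cost-at e = trans (cong (λ cs → nth rat₀ cs (toℕ e)) (map-tabulate (λ e → endsᴺ (GSTInstance.graph I) e , ratOf (cost e)) proj₂))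
    (nth-tabulate rat₀ edgeNumber (ratOf ∘ cost) e)

  kept⇒≤ : ∀ e → ke (toℕ e) ≡ true → cost e ≤q q
  kept⇒≤ e h = subst₂ _≤q_ (⌊1⌋* _) (⌊1⌋* _) (scaledLess-false 0≤q (nonnegative e) 1 1
    (subst (λ z → scaledLess 1 (ratOf q) 1 z ≡ false) (cost-at e) (not-true h)))

  ≤⇒kept : ∀ e → cost e ≤q q → ke (toℕ e) ≡ true
  ≤⇒kept e le = not-intro (subst (λ z → scaledLess 1 (ratOf q) 1 z ≡ false) (sym (cost-at e))
    (scaledLess-outro 0≤q (nonnegative e) 1 1 (subst₂ _≤q_ (sym (⌊1⌋* _)) (sym (⌊1⌋* _)) le)))

  -- A positive length means that the search rejected its predecessor, and this rejection is the
  -- claim with a strict inequality.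
  len-lower : ∀ e → q *q ⌊ ln (toℕ e) ⌋ ≤q ⌊ K ⌋ *q cost e
  len-lower e = go (ln (toℕ e)) refl
    where
    go : ∀ l → ln (toℕ e) ≡ l → q *q ⌊ l ⌋ ≤q ⌊ K ⌋ *q cost e
    go zero    _  = subst (_≤q ⌊ K ⌋ *q cost e) (sym (*-⌊0⌋ q)) (*-nonNeg (0≤⌊⌋ K) (nonnegative e))
    go (suc l) eq = subst (_≤q ⌊ K ⌋ *q cost e) (ℚP.*-comm ⌊ suc l ⌋ q) (ℚP.<⇒≤ (scaledLess-true 0≤q (nonnegative e) (suc l) K
      (subst (λ z → scaledLess (suc l) (ratOf q) K z ≡ true) (cost-at e)
        (not-false (find-min maxL (λ j → not (scaledLess (suc j) (ratOf q) K (Algorithm.cost εₙ εᵈ g (toℕ e)))) l (≤-reflexive (sym eq)))))))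

  -- If the search succeeded, its test is the claim. If it ran out of candidates, the length plus 1
  -- is `K`, and the claim follows from c(e) ≤ q.
  len-upper : ∀ e → ke (toℕ e) ≡ true → ⌊ K ⌋ *q cost e ≤q q *q ⌊ suc (ln (toℕ e)) ⌋
  len-upper e kept = by-cases (m≤n⇒m<n∨m≡n (find≤ maxL too-long))
    where
    too-long : ℕ → Bool
    too-long j = not (scaledLess (suc j) (ratOf q) K (Algorithm.cost εₙ εᵈ g (toℕ e)))
    by-cases : ln (toℕ e) < maxL ⊎ ln (toℕ e) ≡ maxL → ⌊ K ⌋ *q cost e ≤q q *q ⌊ suc (ln (toℕ e)) ⌋
    by-cases (inj₁ lt) = subst (⌊ K ⌋ *q cost e ≤q_) (ℚP.*-comm _ q) (scaledLess-false 0≤q (nonnegative e) (suc (ln (toℕ e))) K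
      (subst (λ z → scaledLess (suc (ln (toℕ e))) (ratOf q) K z ≡ false) (cost-at e) (not-true (find-true maxL too-long lt))))
    by-cases (inj₂ eq) = subst (⌊ K ⌋ *q cost e ≤q_) (trans (cong (λ z → ⌊ suc z ⌋ *q q) (sym eq)) (ℚP.*-comm _ q)) (*-monoˡ (0≤⌊⌋ K) (kept⇒≤ e kept))

  len<K : ∀ e → suc (ln e) ≤ K
  len<K e = s≤s (find≤ maxL _)

  chosen : Subgraph → Bits
  chosen H = toList (G.Subgraph.E H)

  costIn : Subgraph → Fin edgeNumber → ℚ
  costIn H e = if does (e ∈? G.Subgraph.E H) then cost e else 0ℚ

  lengthIn : Subgraph → ℕ → ℕ
  lengthIn H e = if chosen H ! e then ln e else 0

  term-upper : ∀ H e → (chosen H ! toℕ e ≡ true → ke (toℕ e) ≡ true) →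
               ⌊ K ⌋ *q costIn H e ≤q q *q ⌊ lengthIn H (toℕ e) + ι (chosen H ! toℕ e) ⌋
  term-upper H e kept = if-upper {K = ⌊ K ⌋} {cost e} {q} {ln (toℕ e)} (e ∈? G.Subgraph.E H) (chosen H ! toℕ e) ∈⇒! !⇒∈ (λ t → len-upper e (kept t))

  term-lower : ∀ H e → q *q ⌊ lengthIn H (toℕ e) ⌋ ≤q ⌊ K ⌋ *q costIn H e
  term-lower H e = if-lower {K = ⌊ K ⌋} {cost e} {q} {ln (toℕ e)} (e ∈? G.Subgraph.E H) (chosen H ! toℕ e) ∈⇒! !⇒∈ (len-lower e)

  cost-upper : ∀ H → (∀ e → chosen H ! toℕ e ≡ true → ke (toℕ e) ≡ true) →
               ⌊ K ⌋ *q totalCost H ≤q q *q ⌊ Sum edgeNumber (lengthIn H) + count edgeNumber (chosen H !_) ⌋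
  cost-upper H kept = subst₂ _≤q_ (Σq-scale ⌊ K ⌋ (costIn H))
    (trans (Σq-scale {edgeNumber} q (λ e → ⌊ lengthIn H (toℕ e) + ι (chosen H ! toℕ e) ⌋)) (cong (q *q_) (trans (Σq-⌊⌋ edgeNumber (λ e → lengthIn H e + ι (chosen H ! e))) (cong ⌊_⌋ (Sum-+ edgeNumber _ _)))))
    (Σq-mono (λ e → term-upper H e (kept e)))

  -- An edge of cost q in H makes up for the difference between nodes and edges of a tree.
  cost-lower : ∀ H f → f ∈ˢ G.Subgraph.E H → cost f ≡ q →
               q *q ⌊ suc (Sum edgeNumber (lengthIn H)) ⌋ ≤q ⌊ K ⌋ *q totalCost H
  cost-lower H f f∈ f≡q = ℚP.≤-trans (*-monoˡ 0≤q (⌊⌋-mono-≤ one-more)) (subst₂ _≤q_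
      (trans (Σq-scale {edgeNumber} q (λ e → ⌊ lengthIn H (toℕ e) + ι (toℕ f ≡ᵇ toℕ e) ⌋)) (cong (q *q_) (Σq-⌊⌋ edgeNumber (λ e → lengthIn H e + ι (toℕ f ≡ᵇ e))))) (Σq-scale ⌊ K ⌋ (costIn H)) (Σq-mono term))
    where
    one-more : suc (Sum edgeNumber (lengthIn H)) ≤ Sum edgeNumber (λ e → lengthIn H e + ι (toℕ f ≡ᵇ e))
    one-more = ≤-trans (≤-trans (≤-reflexive (+-comm 1 _)) (+-monoʳ-≤ _ (≤-trans (≤-reflexive (cong ι (sym (≡ᵇ-intro {toℕ f} refl))))
      (term≤Sum edgeNumber (λ e → ι (toℕ f ≡ᵇ e)) (toℕ f) (toℕ<n f))))) (≤-reflexive (sym (Sum-+ edgeNumber _ _)))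
    -- As `f` costs exactly `q`, its bound K c(f) is K q, which leaves room for one unit more than
    -- its length, itself at most K - 1.
    at-f : q *q ⌊ suc (ln (toℕ f)) ⌋ ≤q ⌊ K ⌋ *q q
    at-f = subst (q *q ⌊ suc (ln (toℕ f)) ⌋ ≤q_) (ℚP.*-comm q ⌊ K ⌋) (*-monoˡ 0≤q (⌊⌋-mono-≤ (len<K (toℕ f))))
    term : ∀ e → q *q ⌊ lengthIn H (toℕ e) + ι (toℕ f ≡ᵇ toℕ e) ⌋ ≤q ⌊ K ⌋ *q costIn H e
    term e = by-cases (bool? (toℕ f ≡ᵇ toℕ e))
      where
      by-cases : (toℕ f ≡ᵇ toℕ e) ≡ true ⊎ (toℕ f ≡ᵇ toℕ e) ≡ false → q *q ⌊ lengthIn H (toℕ e) + ι (toℕ f ≡ᵇ toℕ e) ⌋ ≤q ⌊ K ⌋ *q costIn H e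
      by-cases (inj₂ no-f) = subst (λ z → q *q ⌊ z ⌋ ≤q ⌊ K ⌋ *q costIn H e) (sym (trans (cong (λ b → lengthIn H (toℕ e) + ι b) no-f) (+-identityʳ _))) (term-lower H e)
      by-cases (inj₁ is-f) = subst (λ e → q *q ⌊ lengthIn H (toℕ e) + ι (toℕ f ≡ᵇ toℕ e) ⌋ ≤q ⌊ K ⌋ *q costIn H e) (toℕ-injective (≡ᵇ-true {toℕ f} is-f))
        (subst₂ (λ u v → q *q ⌊ u ⌋ ≤q ⌊ K ⌋ *q v)
          (trans (+-comm 1 _) (cong₂ (λ b c → (if b then ln (toℕ f) else 0) + ι c) (sym (∈⇒! f∈)) (sym (≡ᵇ-intro {toℕ f} refl))))
          (trans (sym f≡q) (sym (if-does (f ∈? G.Subgraph.E H) f∈))) at-f)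

  -- The search range contains a solution, namely j + 1 = rank · εᵈ, because εₙ ≥ 1. Here K ε is at
  -- least the rank, which bounds the rounding error.
  maxLen-enough : 0 < εₙ → rank g * εᵈ ≤ K * εₙ
  maxLen-enough 0<εₙ = go (rank g * εᵈ) refl
    where
    p : ℕ → Bool
    p j = not (suc j * εₙ <ᵇ rank g * εᵈ)
    go : ∀ x → rank g * εᵈ ≡ x → x ≤ K * εₙ
    go zero    _  = z≤n
    go (suc x) eq = subst (_≤ K * εₙ) eq (<ᵇ-false (not-true (proj₂ (find-found (rank g * εᵈ) p x (≤-reflexive (sym eq))
      (not-intro (≥-intro (≤-trans (≤-reflexive eq) (m≤m*n (suc x) εₙ {{>-nonZero 0<εₙ}}))))))))

  -- Minimality of K: the value K - 1 falls short of rank/ε. This is what limits the number of inner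
  -- nodes.
  maxLen-tight : ∀ {l} → maxL ≡ suc l → suc l * εₙ < rank g * εᵈ
  maxLen-tight {l} eq = <ᵇ-true (not-false (find-min (rank g * εᵈ) (λ j → not (suc j * εₙ <ᵇ rank g * εᵈ)) l (≤-reflexive (sym eq))))

  rank≤nodes : rank g ≤ GSTInstance.n I
  rank≤nodes = min≤ˡ (GSTInstance.n I) (length es)

  rank≤edges : rank g ≤ edgeNumber
  rank≤edges = subst (rank g ≤_) OG.length-es (min≤ʳ (GSTInstance.n I) (length es))

  open Algorithm εₙ εᵈ using (score; backTree; feasible)
  private
    module C = CDSInstance instanceᶜ

  zero-if : ∀ b {x} → x ≡ 0 → (if b then x else 0) ≡ 0
  zero-if true  eq = eq
  zero-if false eq = refl

  -- `ℓ` is the length of the tree taken back. It is bounded through the edges and through the nodes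
  -- of the CDS tree, so that one argument serves both measures.
  record BackSolution (S : C.Subgraph) : Set where
    field
      H       : Subgraph
      H✓      : G.IsGroupSteinerTree H
      enc-H   : G.encSubgraph H ≡ enc tree (backTree g (ratOf q) R.cdsEdges (solutionData S))
      ℓ       : ℕ
      score≡  : score g (ratOf q) (backTree g (ratOf q) R.cdsEdges (solutionData S)) ≡ ℓ + rank g
      ℓ≤edges : ℓ ≤ C.edgeCount S
      ℓ<nodes : suc ℓ ≤ C.nodeCount S
      ℓ≡0     : maxLen g ≡ 0 → ℓ ≡ 0
      cost≤   : ⌊ K ⌋ *q totalCost H ≤q q *q ⌊ ℓ + rank g ⌋

  opaque
    back-solution : ∀ S → C.IsSteinerCDS S → 0 < G.n → BackSolution S
    back-solution S S✓ n>0 = record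
      { H       = B.result
      ; H✓      = B.isResult
      ; enc-H   = B.enc-result
      ; ℓ       = ℓ
      ; score≡  = B.result-score
      ; ℓ≤edges = ≤-trans B.result-length B.pruned-edges
      ; ℓ<nodes = ≤-trans (s≤s B.result-length) B.pruned-nodes
      ; ℓ≡0     = λ L≡0 → trans (Sum-cong R.m (λ e _ → zero-if (B.GT.E ! e) (n≤0⇒n≡0 (subst (ln e ≤_) L≡0 (find≤ maxL _))))) (Sum-0 R.m)
      ; cost≤   = ℚP.≤-trans (cost-upper B.result λ e h → B.result-kept (toℕ e) (OG.toℕ<m e) (subst (λ z → z ! toℕ e ≡ true) B.GT.toList-E h))
          (*-monoˡ 0≤q (⌊⌋-mono-≤ (+-mono-≤
            (≤-reflexive (cong₂ (λ z k → Sum k (λ e → if z ! e then ln e else 0)) B.GT.toList-E (sym OG.length-es)))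
            (≤-trans (≤-reflexive (cong₂ (λ z k → count k (z !_)) B.GT.toList-E (sym OG.length-es))) B.result-edges))))
      }
      where
      module B = Backward S S✓ n>0
      ℓ : ℕ
      ℓ = Sum R.m (λ e → if B.GT.E ! e then ln e else 0)

  module _ {O : Subgraph} (O✓ : G.IsGroupSteinerTree O) (below : ∀ e → e ∈ˢ G.Subgraph.E O → cost e ≤q q) where

    chosen-kept : ∀ j → j < R.m → chosen O ! j ≡ true → ke j ≡ true
    chosen-kept j j<m = subst (λ j → chosen O ! j ≡ true → ke j ≡ true) (proj₂ (OG.edge-at j<m))
      (λ h → ≤⇒kept (proj₁ (OG.edge-at j<m)) (below _ (!⇒∈ h)))

    is-feasible : feasible g (ratOf q) ≡ true
    is-feasible = <ᵇ-intro (Th.root-intro R.keptEdges (toℕ<n (proj₁ (treeHits O✓)))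
      λ i i<k → let w , w<n , gw , c = proj₂ (treeHits O✓) i i<k in
        w , w<n , gw , Connection.Conn-mono es (λ j j<m h → trans (!-applyUpTo ke R.m j<m) (chosen-kept j j<m h)) c)

    opaque
      cds-solution : Σ C.Subgraph λ H → C.IsSteinerCDS H ×
                     C.edgeCount H ≤ Sum edgeNumber (lengthIn O) × C.nodeCount H ≤ suc (Sum edgeNumber (lengthIn O))
      cds-solution = Fwd.solution , Fwd.isSolution
        , subst (λ m → C.edgeCount Fwd.solution ≤ Sum m (lengthIn O)) OG.length-es Fwd.edgeCount-bound
        , subst (λ m → C.nodeCount Fwd.solution ≤ suc (Sum m (lengthIn O))) OG.length-es Fwd.nodeCount-bound
        where
        module Fwd = Forward (chosen O) chosen-kept (toℕ (proj₁ (treeHits O✓))) (toℕ<n (proj₁ (treeHits O✓))) (proj₂ (treeHits O✓))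

-- Calling the assumed algorithm

-- The assumption supplies two runs, one with a time bound and one with a correct output.
-- Determinism makes them agree on the output.
deterministic : ∀ {p x y y′ s s′} → p ⊢ x ⇓ y [ s ] → p ⊢ x ⇓ y′ [ s′ ] → y ≡ y′
deterministic skip skip = refl
deterministic const-nil const-nil = refl
deterministic hd hd = refl
deterministic tl tl = refl
deterministic (seq a b) (seq a′ b′) with deterministic a a′
... | refl = deterministic b b′
deterministic (cons a b) (cons a′ b′) = cong₂ _∙_ (deterministic a a′) (deterministic b b′)
deterministic (cond-true a b) (cond-true a′ b′) = deterministic b b′
deterministic (cond-true a b) (cond-false a′ b′) with deterministic a a′
... | ()
deterministic (cond-false a b) (cond-true a′ b′) with deterministic a a′
... | ()
deterministic (cond-false a b) (cond-false a′ b′) = deterministic b b′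
deterministic (while-stop a) (while-stop a′) = refl
deterministic (while-stop a) (while-step a′ b′ c′) with deterministic a a′
... | ()
deterministic (while-step a b c) (while-stop a′) with deterministic a a′
... | ()
deterministic (while-step a b c) (while-step a′ b′ c′) with deterministic b b′
... | refl = deterministic c c′

size-encSubset : ∀ {n} (s : Subset n) → size (encSubset s) ≤ 1 + n * 4
size-encSubset []      = ≤-refl
size-encSubset (b ∷ s) = s≤s (≤-trans (+-mono-≤ (encBool≤3 b) (size-encSubset s)) (≤-reflexive (+-suc 3 _)))

module Solver (measure : (J : CDSInstance) → CDSInstance.Subgraph J → ℕ) where

  P : MinimizationProblem
  P = SubsetSteinerCDS measure

  open MinimizationProblem P using (encInstance; FeasibleInstance)

  module _ (prog : Prog) (fast : RunsInPolyTime prog encInstance)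
           (solve : ∀ J → FeasibleInstance J → Σ (CDSInstance.Subgraph J) λ S → ∃[ t ] prog ⊢ encInstance J ⇓ CDSInstance.encSubgraph J S [ t ])
           where

    -- Only feasible instances belong to the domain, as only they have a specified output. The size
    -- of the output is read off its form, two bit lists with an entry per node and per edge.
    oracle : Computes {Σ CDSInstance FeasibleInstance} (encInstance ∘ proj₁) (λ (J , F) → CDSInstance.encSubgraph J (proj₁ (solve J F)))
    oracle = computes prog (monomial c d ⊕ (con 3 ⊕ X ⊛ con 4 ⊕ X ⊛ con 4)) runs smalls
      where
      c = proj₁ fast
      d = proj₁ (proj₂ fast)
      runs : ∀ JF → prog ⊢ encInstance (proj₁ JF) ⇓ _ ≤[ _ ]
      runs (J , F) = let y , t , r , t≤ = proj₂ (proj₂ fast) J ; S , t′ , r′ = solve J F in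
        t , subst (λ y → prog ⊢ _ ⇓ y [ t ]) (deterministic r r′) r
          , m≤n⇒m≤n+o _ (≤-trans t≤ (≤-reflexive (sym (⟪monomial⟫ c d _))))
      smalls : ∀ JF → size (CDSInstance.encSubgraph (proj₁ JF) (proj₁ (solve (proj₁ JF) (proj₂ JF)))) ≤ _
      smalls (J , F) = m≤n⇒m≤o+n (⟪ monomial c d ⟫ (size (encInstance J))) (begin
        suc (size (encSubset V) + size (encSubset E))      ≤⟨ s≤s (+-mono-≤ (size-encSubset V) (size-encSubset E)) ⟩
        suc (suc (n * 4) + suc (m * 4))                    ≡⟨ cong suc (+-suc (suc (n * 4)) (m * 4)) ⟩
        3 + n * 4 + m * 4                                  ≤⟨ +-mono-≤ (+-monoʳ-≤ 3 (*-monoˡ-≤ 4 n≤)) (*-monoˡ-≤ 4 m≤) ⟩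
        3 + size (encInstance J) * 4 + size (encInstance J) * 4 ∎)
        where
        open ≤-Reasoning
        open CDSInstance J using (n; m; encEdge; Q; module Subgraph)
        open Subgraph (proj₁ (solve J F)) using (V; E)
        es : Val
        es = encList encEdge (tabulate id)
        n≤ : n ≤ size (encInstance J)
        n≤ = ≤-trans (n≤size-encUnary n) (m≤n⇒m≤1+n (m≤m+n _ (size (es ∙ encSubset Q))))
        m≤ : m ≤ size (encInstance J)
        m≤ = ≤-trans (≤-trans (≤-reflexive (sym (length-tabulate id))) (length≤size encEdge (tabulate id)))
          (m≤n⇒m≤1+n (m≤n⇒m≤o+n (size (encUnary n)) (m≤n⇒m≤1+n (m≤m+n (size es) _))))

    Query : Set
    Query = Rat × Σ CDSInstance FeasibleInstance

    -- The question is returned together with the answer, since the translation back needs the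
    -- threshold and the edge list of the new graph.
    encQuery encReply : Query → Val
    encQuery (M , J , F) = enc rat M ∙ encInstance J
    encReply (M , J , F) = (enc rat M ∙ encInstance J) ∙ CDSInstance.encSubgraph J (proj₁ (solve J F))

    reply : Computes encQuery encReply
    reply = idᶜ ∙ᶜ (reindex proj₂ oracle ∘ᶜ tlᶜ idᶜ)

    module _ (εₙ εᵈ : ℕ) where

      open Algorithm εₙ εᵈ using (feasible; thresholds; questions; answer; cds; nodes)

      instanceFor : GSTInstance → Rat → CDSInstance
      instanceFor I M = ForInstance.instanceᶜ εₙ εᵈ I M

      opaque
        -- The forward translation is applied to all kept edges at once: their component at the root
        -- meets every group, and its image contains a feasible tree.
        feasibleFor : ∀ I M → feasible (gstData I) M ≡ true → FeasibleInstance (instanceFor I M)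
        feasibleFor I M φ = Fwd.solution , Fwd.isSolution
          where
          open ForInstance εₙ εᵈ I M
          r<n : R.root R.keptEdges < GSTInstance.n I
          r<n = <ᵇ-true φ
          hits : Hits R.keptEdges (R.root R.keptEdges)
          hits i i<k = let w , w<n , gw , sw = Th.root-elim R.keptEdges r<n i i<k in w , w<n , gw , Th.spanned⇒Conn R.keptEdges r<n sw
          kept : ∀ e → e < R.m → R.keptEdges ! e ≡ true → ke e ≡ true
          kept e e<m h = trans (sym (!-applyUpTo ke R.m e<m)) h
          module Fwd = Forward R.keptEdges kept (R.root R.keptEdges) r<n hits

      module _ (I : GSTInstance) where

        g : Gst
        g = gstData I

        Feasibleᵇ : Rat → Set
        Feasibleᵇ M = feasible g M ≡ true

        query : ∀ M → Feasibleᵇ M → Query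
        query M φ = M , instanceFor I M , feasibleFor I M φ

        solutionOf : ∀ M → Feasibleᵇ M → CDSInstance.Subgraph (instanceFor I M)
        solutionOf M φ = proj₁ (solve (instanceFor I M) (feasibleFor I M φ))

        entry : ∀ M → Feasibleᵇ M → (Rat × Cds) × Tree
        entry M φ = (M , cds g M) , ForInstance.solutionData εₙ εᵈ I M (solutionOf M φ)

        queries : ∀ Ms → All Feasibleᵇ Ms → List Query
        queries []       []       = []
        queries (M ∷ Ms) (φ ∷ φs) = query M φ ∷ queries Ms φs

        entries : ∀ Ms → All Feasibleᵇ Ms → List ((Rat × Cds) × Tree)
        entries []       []       = []
        entries (M ∷ Ms) (φ ∷ φs) = entry M φ ∷ entries Ms φs

        enc-query : ∀ M φ → enc (rat ⊗ cdsᵗ) (M , cds g M) ≡ encQuery (query M φ)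
        enc-query M φ = cong (enc rat M ∙_) (ForInstance.enc-instance εₙ εᵈ I M)

        enc-queries : ∀ Ms φs → enc (list (rat ⊗ cdsᵗ)) (map (λ M → M , cds g M) Ms) ≡ encList encQuery (queries Ms φs)
        enc-queries []       []       = refl
        enc-queries (M ∷ Ms) (φ ∷ φs) = cong₂ _∙_ (enc-query M φ) (enc-queries Ms φs)

        enc-replies : ∀ Ms φs → encList encReply (queries Ms φs) ≡ enc (list ((rat ⊗ cdsᵗ) ⊗ tree)) (entries Ms φs)
        enc-replies []       []       = refl
        enc-replies (M ∷ Ms) (φ ∷ φs) = cong₂ _∙_ (cong (_∙ CDSInstance.encSubgraph (instanceFor I M) (solutionOf M φ)) (sym (enc-query M φ))) (enc-replies Ms φs)

        entry∈ : ∀ {M} Ms φs → M ∈ Ms → ∃[ φ ] entry M φ ∈ entries Ms φs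
        entry∈ (M ∷ Ms) (φ ∷ φs) (here refl) = φ , here refl
        entry∈ (M ∷ Ms) (φ ∷ φs) (there p)   = let φ , q = entry∈ Ms φs p in φ , there q

        entries-elim : ∀ {x} Ms φs → x ∈ entries Ms φs → ∃[ M ] M ∈ Ms × ∃[ φ ] x ≡ entry M φ
        entries-elim (M ∷ Ms) (φ ∷ φs) (here refl) = M , here refl , φ , refl
        entries-elim (M ∷ Ms) (φ ∷ φs) (there p)   = let M , q , φ , eq = entries-elim Ms φs p in M , there q , φ , eq

        all-feasible : All Feasibleᵇ (thresholds g)
        all-feasible = All.map T→≡ (all-filter (T? ∘ feasible g) _)

        replies : List ((Rat × Cds) × Tree)
        replies = entries (thresholds g) all-feasible

        output : Tree
        output = answer g replies

      open MinimizationProblem GroupSteinerTree using () renaming (encInstance to encGST)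
      open AlgorithmF εₙ εᵈ

      input : Computes encGST (λ I → encEnv {gst ∷ []} (gstData I , tt))
      input = idᶜ ∙ᶜ nilᶜ ≗ᶜ λ I → cong (_∙ nil) (sym (enc-gstData I))

      asked : Computes encGST (λ I → encList encQuery (queries I (thresholds (gstData I)) (all-feasible I)))
      asked = reindex (λ I → gstData I , tt) (compᶠ questionsC) ∘ᶜ input ≗ᶜ λ I → enc-queries I (thresholds (gstData I)) (all-feasible I)

      replied : Computes encGST (λ I → enc (list ((rat ⊗ cdsᵗ) ⊗ tree)) (replies I))
      replied = reindex (λ I → queries I (thresholds (gstData I)) (all-feasible I)) (mapᶜ reply) ∘ᶜ asked
        ≗ᶜ λ I → enc-replies I (thresholds (gstData I)) (all-feasible I)

      algorithm : Computes encGST (λ I → enc tree (output I))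
      algorithm = reindex (λ I → replies I , gstData I , tt) (compᶠ answerC) ∘ᶜ (replied ∙ᶜ input)

-- The approximation guarantee

open ℝ using (Lower; Upper)

-- The order of the reals is defined by lower cuts, whereas `_≤[_·_]` speaks of upper cuts. Openness
-- leaves a gap below `q`, in which locatedness decides.
upper-antitone : ∀ x y → x ≤ʳ y → ∀ {q} → Upper y q → Upper x q
upper-antitone x y x≤y u with ℝ.upper-open y u
... | p , p<q , u′ with ℝ.located x p<q
...   | inj₁ l  = ⊥-elim (ℝ.disjoint y (x≤y p l) u′)
...   | inj₂ u″ = u″

maximum : ∀ {m} (E : Subset m) (c : Fin m → ℚ) → (∀ e → ¬ e ∈ˢ E) ⊎ (∃[ f ] f ∈ˢ E × ∀ e → e ∈ˢ E → c e ≤q c f)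
maximum []      c = inj₁ λ _ ()
maximum (b ∷ E) c with maximum E (c ∘ suc)
maximum (false ∷ E) c | inj₁ none = inj₁ λ { (suc e) e∈ → none e (drop-there e∈) }
maximum (true ∷ E)  c | inj₁ none = inj₂ (zero , Vec.here , λ
  { zero    _  → ℚP.≤-refl
  ; (suc e) e∈ → ⊥-elim (none e (drop-there e∈)) })
maximum (false ∷ E) c | inj₂ (f , f∈ , max) = inj₂ (suc f , Vec.there f∈ , λ { (suc e) e∈ → max e (drop-there e∈) })
maximum (true ∷ E)  c | inj₂ (f , f∈ , max) with ℚP.≤-total (c (suc f)) (c zero)
... | inj₁ f≤0 = inj₂ (zero , Vec.here , λ
  { zero    _  → ℚP.≤-refl
  ; (suc e) e∈ → ℚP.≤-trans (max e (drop-there e∈)) f≤0 })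
... | inj₂ 0≤f = inj₂ (suc f , Vec.there f∈ , λ
  { zero    _  → 0≤f
  ; (suc e) e∈ → max e (drop-there e∈) })

-- The value belongs to a certificate and not to the element, so the least element is returned with
-- the certificate that was evaluated.
minimum : ∀ {A : Set} {G : A → Set} (v : ∀ {x} → G x → ℚ) xs → All G xs → ∀ {z} → z ∈ xs →
          ∃[ x ] x ∈ xs × Σ (G x) λ gx → ∀ {y} → y ∈ xs → Σ (G y) λ gy → v gx ≤q v gy
minimum v (x ∷ [])     (g ∷ []) _ = x , here refl , g , λ { (here refl) → g , ℚP.≤-refl }
minimum v (x ∷ y ∷ ys) (g ∷ gs) _ with minimum v (y ∷ ys) gs (here refl)
... | z , z∈ , gz , min with ℚP.≤-total (v g) (v gz)
...   | inj₁ g≤z = x , here refl , g , λ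
  { (here refl) → g , ℚP.≤-refl
  ; (there p)   → proj₁ (min p) , ℚP.≤-trans g≤z (proj₂ (min p)) }
...   | inj₂ z≤g = z , there z∈ , gz , λ
  { (here refl) → g , z≤g
  ; (there p)   → min p }

Σq-nonNeg : ∀ {m} (f : Fin m → ℚ) → (∀ i → 0ℚ ≤q f i) → 0ℚ ≤q Σq f
Σq-nonNeg {zero}  f pos = ℚP.≤-refl
Σq-nonNeg {suc m} f pos = subst (_≤q Σq f) (ℚP.+-identityʳ 0ℚ) (ℚP.+-mono-≤ (pos zero) (Σq-nonNeg (f ∘ suc) (pos ∘ suc)))

Σq-term : ∀ {m} (f : Fin m → ℚ) → (∀ i → 0ℚ ≤q f i) → ∀ i → f i ≤q Σq f
Σq-term {suc m} f pos zero    = subst (_≤q Σq f) (ℚP.+-identityʳ (f zero)) (ℚP.+-mono-≤ (ℚP.≤-refl {f zero}) (Σq-nonNeg (f ∘ suc) (pos ∘ suc)))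
Σq-term {suc m} f pos (suc i) = ℚP.≤-trans (Σq-term (f ∘ suc) (pos ∘ suc) i)
  (subst (_≤q Σq f) (ℚP.+-identityˡ (Σq (f ∘ suc))) (ℚP.+-mono-≤ (pos zero) (ℚP.≤-refl {Σq (f ∘ suc)})))

transfer : ∀ {a b c d x} → 0ℚ ≤q x → fromℕℚ a ≤q x *q fromℕℚ b → fromℕℚ b ≤q fromℕℚ c → c ≤ d → ⌊ a ⌋ ≤q x *q ⌊ d ⌋
transfer {a} {b} {c} {d} {x} 0≤x a≤xb b≤c c≤d rewrite sym (⌊⌋-def a) | sym (⌊⌋-def b) | sym (⌊⌋-def c) =
  ℚP.≤-trans a≤xb (*-monoˡ 0≤x (ℚP.≤-trans b≤c (⌊⌋-mono-≤ c≤d)))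

bestOf-minimal : ∀ {εₙ εᵈ} g cs {c} → c ∈ cs → Algorithm.noBetter εₙ εᵈ g cs c ≡ true →
                 ∃[ b ] b ∈ cs × Algorithm.noBetter εₙ εᵈ g cs b ≡ true × Algorithm.bestOf εₙ εᵈ g cs ≡ proj₂ (proj₂ b)
bestOf-minimal {εₙ} {εᵈ} g cs {c} c∈ nb = nth (none g) cs i , nth-∈ (none g) cs (proj₁ found) , proj₂ found , bestOf-def g cs
  where
  open Algorithm εₙ εᵈ
  p : ℕ → Bool
  p a = noBetter g cs (nth (none g) cs a)
  i : ℕ
  i = find (length cs) p
  found : i < length cs × p i ≡ true
  found = let a , a< , eq = ∈-nth (none g) c∈ in find-found (length cs) p a a< (trans (cong (noBetter g cs) eq) nb)

improves : ∀ {εₙ εᵈ g} → Algorithm.Candidate εₙ εᵈ g → Algorithm.Candidate εₙ εᵈ g → Bool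
improves c′ c = scaledLess (proj₁ (proj₂ c′)) (proj₁ c′) (proj₁ (proj₂ c)) (proj₁ c)

noBetter-intro : ∀ {εₙ εᵈ} g cs {c} → (∀ {c′} → c′ ∈ cs → improves {εₙ} {εᵈ} {g} c′ c ≡ false) → Algorithm.noBetter εₙ εᵈ g cs c ≡ true
noBetter-intro {εₙ} {εᵈ} g cs h = and-intro _ (length cs) λ i i< → not-intro (h (nth-∈ (Algorithm.none εₙ εᵈ g) cs i<))

noBetter-elim : ∀ {εₙ εᵈ} g cs {c} → Algorithm.noBetter εₙ εᵈ g cs c ≡ true → ∀ {c′} → c′ ∈ cs → improves {εₙ} {εᵈ} {g} c′ c ≡ false
noBetter-elim {εₙ} {εᵈ} g cs {c} nb c′∈ with ∈-nth (Algorithm.none εₙ εᵈ g) c′∈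
... | i , i< , refl = not-true (and-true (λ i → not (improves {εₙ} {εᵈ} {g} (nth (Algorithm.none εₙ εᵈ g) cs i) c)) (length cs) nb i<)

-- Write n = r + a. The r nodes and the inner nodes together satisfy r p + m l p ≤ m (l + 1) p ≤ m r
-- q by r ≤ m, and each of the other a + k nodes has p ≤ (l + 1) p ≤ r q ≤ m q. Both bounds on the
-- rank are used.
size-bound : ∀ n k m l {r p q} → suc l * p < r * q → r ≤ n → r ≤ m → (n + k + m * l) * p ≤ (m * (n + k)) * q
size-bound n k m l {r} {p} {q} tight r≤n r≤m = begin
  (n + k + m * l) * p                              ≡⟨ cong (λ z → (z + k + m * l) * p) (m+[n∸m]≡n r≤n) ⟨
  (r + a + k + m * l) * p                          ≡⟨ solve 6 (λ r a k m l p → (r :+ a :+ k :+ m :* l) :* p := (r :* p :+ m :* l :* p) :+ (a :+ k) :* p) refl r a k m l p ⟩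
  (r * p + m * l * p) + (a + k) * p                ≤⟨ +-mono-≤ (+-monoˡ-≤ (m * l * p) (*-monoˡ-≤ p r≤m)) (*-monoʳ-≤ (a + k) p≤mq) ⟩
  (m * p + m * l * p) + (a + k) * (m * q)          ≡⟨ cong (_+ (a + k) * (m * q)) (solve 3 (λ m l p → m :* p :+ m :* l :* p := m :* ((con 1 :+ l) :* p)) refl m l p) ⟩
  m * (suc l * p) + (a + k) * (m * q)              ≤⟨ +-monoˡ-≤ _ (*-monoʳ-≤ m (<⇒≤ tight)) ⟩
  m * (r * q) + (a + k) * (m * q)                  ≡⟨ solve 5 (λ m r q a k → m :* (r :* q) :+ (a :+ k) :* (m :* q) := m :* (r :+ a :+ k) :* q) refl m r q a k ⟩
  m * (r + a + k) * q                              ≡⟨ cong (λ z → m * (z + k) * q) (m+[n∸m]≡n r≤n) ⟩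
  m * (n + k) * q                                  ∎
  where
  open ≤-Reasoning
  open +-*-Solver
  a : ℕ
  a = n ∸ r
  p≤mq : p ≤ m * q
  p≤mq = ≤-trans (m≤m+n p (l * p)) (≤-trans (<⇒≤ tight) (*-monoˡ-≤ q r≤m))

-- Edges and nodes of a tree differ by one. The tree built from O is charged `suc L` in either
-- measure, and a returned tree only has to pay for its length; `cost-lower` makes up for the extra
-- unit.
module Reduce (measure : (J : CDSInstance) → CDSInstance.Subgraph J → ℕ)
              (εₙ εᵈ : ℕ)
              (measure≤ : ∀ J {H L} → CDSInstance.edgeCount J H ≤ L → CDSInstance.nodeCount J H ≤ suc L → measure J H ≤ suc L)
              (measure≥ : ∀ J {H L} → L ≤ CDSInstance.edgeCount J H → suc L ≤ CDSInstance.nodeCount J H → L ≤ measure J H)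
              where

  open Solver measure using (P)
  open MinimizationProblem P using (encInstance; FeasibleInstance; Optimal)
  open Algorithm εₙ εᵈ using (Candidate; candidate; thresholds; feasible; costs; noBetter; bestOf; score; rank; maxLen)

  module _ (prog : Prog) (fast : RunsInPolyTime prog encInstance)
           (ρ : CDSInstance → ℝ)
           (solve : ∀ J → FeasibleInstance J →
             Σ (CDSInstance.Subgraph J) λ S → (∃[ t ] prog ⊢ encInstance J ⇓ CDSInstance.encSubgraph J S [ t ]) ×
               CDSInstance.IsSteinerCDS J S × (∀ O → Optimal J O → fromℕℚ (measure J S) ≤[ ρ J · fromℕℚ (measure J O) ]))
           where

    module S = Solver measure
    solve₁ : ∀ J → FeasibleInstance J → Σ (CDSInstance.Subgraph J) λ S → ∃[ t ] prog ⊢ encInstance J ⇓ CDSInstance.encSubgraph J S [ t ]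
    solve₁ J F = proj₁ (solve J F) , proj₁ (proj₂ (solve J F))

    feasibleFor : ∀ I M → feasible (gstData I) M ≡ true → FeasibleInstance (ForInstance.instanceᶜ εₙ εᵈ I M)
    feasibleFor = S.feasibleFor prog fast solve₁ εₙ εᵈ

    -- The assumed ratio compares with optimal solutions only, so one is needed. A feasible solution
    -- that is not optimal would have a better one, and the measure cannot descend forever; no
    -- solution is searched for.
    optimum-exists : ∀ J → FeasibleInstance J → ¬ ¬ ∃ (Optimal J)
    optimum-exists J (S₀ , S₀✓) none = go (measure J S₀) S₀ S₀✓ ≤-refl
      where
      go : ∀ b S → CDSInstance.IsSteinerCDS J S → measure J S ≤ b → ⊥
      go b S S✓ le = none (S , S✓ , λ T T✓ → subst₂ _≤q_ (⌊⌋-def _) (⌊⌋-def _) (⌊⌋-mono-≤ (≮⇒≥ (smaller b le T T✓))))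
        where
        smaller : ∀ b → measure J S ≤ b → ∀ T → CDSInstance.IsSteinerCDS J T → ¬ measure J T < measure J S
        smaller zero    le T T✓ lt = n≮0 (<-≤-trans lt le)
        smaller (suc b) le T T✓ lt = go b T T✓ (≤-pred (<-≤-trans lt le))

    module _ (I : GSTInstance) where

      open GSTInstance I using (n; cost; nonnegative; totalCost; encSubgraph; IsGroupSteinerTree) renaming (m to edgeNumber; k to groupNumber)
      private
        module G = GSTInstance I

      g : Gst
      g = gstData I

      K : ℕ
      K = suc (maxLen g)

      ratios : All (λ M → ∃[ q ] 0ℚ ≤q q × M ≡ ratOf q) (rat₀ ∷ costs g)
      ratios = (0ℚ , ℚP.≤-refl , refl) ∷ All.tabulate λ {M} M∈ →
        let e , eq = ∈-tabulate⁻ (subst (M ∈_) (map-tabulate _ proj₂) M∈) in cost e , nonnegative e , eq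

      -- The two ways in which `q` can be the largest cost in a tree. Only an attained `q` is
      -- bounded by the cost of the tree and pays the extra unit of `cost-lower`; in the other case
      -- every product with `q` vanishes.
      data Threshold (q : ℚ) : G.Subgraph → Set where
        free   : ∀ {H} → q ≡ 0ℚ → (∀ e → ¬ e ∈ˢ G.Subgraph.E H) → Threshold q H
        attained : ∀ {H} f → f ∈ˢ G.Subgraph.E H → cost f ≡ q → Threshold q H

      threshold : ∀ {H} → IsGroupSteinerTree H → ∃[ q ] 0ℚ ≤q q × ratOf q ∈ thresholds g × Threshold q H × (∀ e → e ∈ˢ G.Subgraph.E H → cost e ≤q q)
      threshold {H} H✓ = by-cases (maximum (G.Subgraph.E H) cost)
        where
        by-cases : (∀ e → ¬ e ∈ˢ G.Subgraph.E H) ⊎ (∃[ f ] f ∈ˢ G.Subgraph.E H × ∀ e → e ∈ˢ G.Subgraph.E H → cost e ≤q cost f) →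
                   ∃[ q ] 0ℚ ≤q q × ratOf q ∈ thresholds g × Threshold q H × (∀ e → e ∈ˢ G.Subgraph.E H → cost e ≤q q)
        by-cases (inj₁ none) = 0ℚ , ℚP.≤-refl
          , ∈-filter⁺ (T? ∘ feasible g) (here refl) (≡→T (Costs.is-feasible εₙ εᵈ I 0ℚ ℚP.≤-refl H✓ (λ e e∈ → ⊥-elim (none e e∈)))) , free refl none , λ e e∈ → ⊥-elim (none e e∈)
        by-cases (inj₂ (f , f∈ , max)) = cost f , nonnegative f
          , ∈-filter⁺ (T? ∘ feasible g) (there (subst (ratOf (cost f) ∈_) (sym (map-tabulate _ proj₂)) (∈-tabulate⁺ f)))
              (≡→T (Costs.is-feasible εₙ εᵈ I (cost f) (nonnegative f) H✓ max))
          , attained f f∈ refl , max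

      entryOf : ∀ M → feasible g M ≡ true → (Rat × Cds) × Tree
      entryOf = S.entry prog fast solve₁ εₙ εᵈ I

      replies : List ((Rat × Cds) × Tree)
      replies = S.replies prog fast solve₁ εₙ εᵈ I

      candidates : List (Candidate g)
      candidates = map (candidate g) replies

      instanceAt : ℚ → CDSInstance
      instanceAt q = ForInstance.instanceᶜ εₙ εᵈ I (ratOf q)

      solved : ∀ q → feasible g (ratOf q) ≡ true → CDSInstance.Subgraph (instanceAt q)
      solved q φ = proj₁ (solve (instanceAt q) (feasibleFor I (ratOf q) φ))

      back : ∀ q 0≤q φ → Costs.BackSolution εₙ εᵈ I q 0≤q (solved q φ)
      back q 0≤q φ = Costs.back-solution εₙ εᵈ I q 0≤q (solved q φ)
        (proj₁ (proj₂ (proj₂ (solve (instanceAt q) (feasibleFor I (ratOf q) φ))))) (≤-<-trans z≤n (<ᵇ-true φ))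

      -- Ties the bare numbers that the program compares to a tree. The computed product is an upper
      -- bound on K times its cost, not that cost; minimising the bound is enough.
      record Good (c : Candidate g) : Set where
        field
          q      : ℚ
          0≤q    : 0ℚ ≤q q
          q≡     : proj₁ c ≡ ratOf q
          H      : G.Subgraph
          H✓     : IsGroupSteinerTree H
          enc-H  : encSubgraph H ≡ enc tree (proj₂ (proj₂ c))
          cost≤  : ⌊ K ⌋ *q totalCost H ≤q q *q ⌊ proj₁ (proj₂ c) ⌋

      value : ∀ {c} → Good c → ℚ
      value {c} G = Good.q G *q ⌊ proj₁ (proj₂ c) ⌋

      good : ∀ q (0≤q : 0ℚ ≤q q) (φ : feasible g (ratOf q) ≡ true) → Good (candidate g (entryOf (ratOf q) φ))
      good q 0≤q φ = record
        { q = q ; 0≤q = 0≤q ; q≡ = refl ; H = H ; H✓ = H✓ ; enc-H = enc-H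
        ; cost≤ = subst (λ z → ⌊ K ⌋ *q totalCost H ≤q q *q ⌊ z ⌋) (sym score≡) cost≤ }
        where open Costs.BackSolution (back q 0≤q φ)

      all-good : All Good candidates
      all-good = All.tabulate λ {c} c∈ → from-candidate (∈-map⁻ (candidate g) c∈)
        where
        from-candidate : ∀ {c} → (∃[ x ] x ∈ replies × c ≡ candidate g x) → Good c
        from-threshold : ∀ {M} (φ : feasible g M ≡ true) → (∃[ q ] 0ℚ ≤q q × M ≡ ratOf q) → Good (candidate g (entryOf M φ))
        from-threshold φ (q , 0≤q , refl) = good q 0≤q φ
        from-entry : ∀ {x} → (∃[ M ] M ∈ thresholds g × ∃[ φ ] x ≡ entryOf M φ) → Good (candidate g x)
        from-entry (M , M∈ , φ , eq) = subst (Good ∘ candidate g) (sym eq)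
          (from-threshold φ (All.lookup ratios (proj₁ (∈-filter⁻ (T? ∘ feasible g) {xs = rat₀ ∷ costs g} M∈))))
        from-candidate (x , x∈ , eq) = subst Good (sym eq)
          (from-entry (S.entries-elim prog fast solve₁ εₙ εᵈ I (thresholds g) (S.all-feasible prog fast solve₁ εₙ εᵈ I) x∈))

      candidate∈ : ∀ {q} → ratOf q ∈ thresholds g → ∃[ φ ] candidate g (entryOf (ratOf q) φ) ∈ candidates
      candidate∈ M∈ = let φ , x∈ = S.entry∈ prog fast solve₁ εₙ εᵈ I (thresholds g) (S.all-feasible prog fast solve₁ εₙ εᵈ I) M∈ in
        φ , ∈-map⁺ (candidate g) x∈

      value-order : ∀ {c c′} (G : Good c) (G′ : Good c′) →
                (value G ≤q value G′ → scaledLess (proj₁ (proj₂ c′)) (proj₁ c′) (proj₁ (proj₂ c)) (proj₁ c) ≡ false) ×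
                (scaledLess (proj₁ (proj₂ c′)) (proj₁ c′) (proj₁ (proj₂ c)) (proj₁ c) ≡ false → value G ≤q value G′)
      value-order {c} {c′} G G′ =
          (λ le → subst₂ (λ M′ M → scaledLess s′ M′ s M ≡ false) (sym (Good.q≡ G′)) (sym (Good.q≡ G))
            (scaledLess-outro (Good.0≤q G′) (Good.0≤q G) s′ s (subst₂ _≤q_ (ℚP.*-comm _ ⌊ s ⌋) (ℚP.*-comm _ ⌊ s′ ⌋) le)))
        , (λ h → subst₂ _≤q_ (ℚP.*-comm ⌊ s ⌋ _) (ℚP.*-comm ⌊ s′ ⌋ _) (scaledLess-false (Good.0≤q G′) (Good.0≤q G) s′ s
            (subst₂ (λ M′ M → scaledLess s′ M′ s M ≡ false) (Good.q≡ G′) (Good.q≡ G) h)))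
        where
        s s′ : ℕ
        s  = proj₁ (proj₂ c)
        s′ = proj₁ (proj₂ c′)

      best : ∀ {c₀} → c₀ ∈ candidates → Σ (Candidate g) λ b → bestOf g candidates ≡ proj₂ (proj₂ b) ×
             Σ (Good b) λ G → ∀ {c} → c ∈ candidates → (G′ : Good c) → value G ≤q value G′
      best c₀∈ = b , b≡ , All.lookup all-good b∈ , λ {c} c∈ G′ →
          proj₂ (value-order (All.lookup all-good b∈) G′) (noBetter-elim {εₙ} {εᵈ} g candidates {b} (proj₁ (proj₂ (proj₂ chosen))) c∈)
        where
        least : ∃[ x ] x ∈ candidates × Σ (Good x) λ gx → ∀ {y} → y ∈ candidates → Σ (Good y) λ gy → value gx ≤q value gy
        least = minimum value candidates all-good c₀∈
        least-noBetter : noBetter g candidates (proj₁ least) ≡ true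
        least-noBetter = noBetter-intro {εₙ} {εᵈ} g candidates {proj₁ least} λ {c′} c∈ → let G′ , le = proj₂ (proj₂ (proj₂ least)) c∈ in
          proj₁ (value-order (proj₁ (proj₂ (proj₂ least))) G′) le
        chosen : ∃[ b ] b ∈ candidates × noBetter g candidates b ≡ true × bestOf g candidates ≡ proj₂ (proj₂ b)
        chosen = bestOf-minimal {εₙ} {εᵈ} g candidates {proj₁ least} (proj₁ (proj₂ least)) least-noBetter
        b : Candidate g
        b = proj₁ chosen
        b∈ : b ∈ candidates
        b∈ = proj₁ (proj₂ chosen)
        b≡ : bestOf g candidates ≡ proj₂ (proj₂ b)
        b≡ = proj₂ (proj₂ (proj₂ chosen))

      answerFor : ∀ {H₀} → IsGroupSteinerTree H₀ → Σ G.Subgraph λ H → IsGroupSteinerTree H ×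
                  encSubgraph H ≡ enc tree (S.output prog fast solve₁ εₙ εᵈ I) ×
                  (∀ {c} → c ∈ candidates → (G′ : Good c) → ⌊ K ⌋ *q totalCost H ≤q value G′)
      answerFor H₀✓ = Good.H G′ , Good.H✓ G′ , trans (Good.enc-H G′) (cong (enc tree) (sym (proj₁ (proj₂ b)))) ,
          λ c∈ Gc → ℚP.≤-trans (Good.cost≤ G′) (proj₂ (proj₂ (proj₂ b)) c∈ Gc)
        where
        t = threshold H₀✓
        b = best (proj₂ (candidate∈ {proj₁ t} (proj₁ (proj₂ (proj₂ t)))))
        G′ = proj₁ (proj₂ (proj₂ b))

      rank≤εK : ∀ {ε} → 0 < εᵈ → 0 < εₙ → ε *q ⌊ εᵈ ⌋ ≡ ⌊ εₙ ⌋ → ⌊ rank g ⌋ ≤q ε *q ⌊ K ⌋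
      rank≤εK {ε} (s≤s {n = d} _) 0<εₙ ε≡ = ℚP.*-cancelʳ-≤-pos ⌊ suc d ⌋ {{⌊⌋-pos d}} (subst₂ _≤q_ (⌊⌋-* (rank g) εᵈ) rearranged
          (⌊⌋-mono-≤ (Costs.maxLen-enough εₙ εᵈ I 0ℚ ℚP.≤-refl 0<εₙ)))
        where
        rearranged : ⌊ K * εₙ ⌋ ≡ ε *q ⌊ K ⌋ *q ⌊ εᵈ ⌋
        rearranged = begin
          ⌊ K * εₙ ⌋                   ≡⟨ ⌊⌋-* K εₙ ⟩
          ⌊ K ⌋ *q ⌊ εₙ ⌋              ≡⟨ cong (⌊ K ⌋ *q_) ε≡ ⟨
          ⌊ K ⌋ *q (ε *q ⌊ εᵈ ⌋)       ≡⟨ ℚP.*-assoc ⌊ K ⌋ ε _ ⟨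
          ⌊ K ⌋ *q ε *q ⌊ εᵈ ⌋         ≡⟨ cong (_*q ⌊ εᵈ ⌋) (ℚP.*-comm ⌊ K ⌋ ε) ⟩
          ε *q ⌊ K ⌋ *q ⌊ εᵈ ⌋         ∎
          where open ≡-Reasoning

      instance-size : ∀ {ε} .{{_ : Positive ε}} M {l} → 0 < εᵈ → ε *q ⌊ εᵈ ⌋ ≡ ⌊ εₙ ⌋ → maxLen g ≡ suc l →
                      fromℕℚ (CDSInstance.n (ForInstance.instanceᶜ εₙ εᵈ I M)) ≤q fromℕℚ (edgeNumber * (n + groupNumber)) ÷⁺ ε
      instance-size {ε} M {l} (s≤s {n = d} _) ε≡ L≡ = subst₂ _≤q_ cancelled (cong (_*q inverse) (⌊⌋-def _))
          (*-monoʳ (ℚP.<⇒≤ (ℚP.positive⁻¹ inverse {{ℚP.1/pos⇒pos ε}})) scaled)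
        where
        N : ℕ
        N = CDSInstance.n (ForInstance.instanceᶜ εₙ εᵈ I M)
        inverse : ℚ
        inverse = ℚ.1/_ ε {{ℚP.pos⇒nonZero ε}}
        N≡ : N ≡ n + groupNumber + edgeNumber * l
        N≡ = cong₂ _+_ (cong (n +_) (ForInstance.length-gs εₙ εᵈ I M)) (cong₂ _*_ (ForInstance.OG.length-es εₙ εᵈ I M) (cong (_∸ 1) L≡))
        integral : N * εₙ ≤ edgeNumber * (n + groupNumber) * εᵈ
        integral = subst (λ N → N * εₙ ≤ edgeNumber * (n + groupNumber) * εᵈ) (sym N≡) (size-bound n groupNumber edgeNumber l
          (Costs.maxLen-tight εₙ εᵈ I 0ℚ ℚP.≤-refl L≡) (Costs.rank≤nodes εₙ εᵈ I 0ℚ ℚP.≤-refl) (Costs.rank≤edges εₙ εᵈ I 0ℚ ℚP.≤-refl))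
        scaled : ⌊ N ⌋ *q ε ≤q ⌊ edgeNumber * (n + groupNumber) ⌋
        scaled = ℚP.*-cancelʳ-≤-pos ⌊ suc d ⌋ {{⌊⌋-pos d}} (subst₂ _≤q_
          (trans (⌊⌋-* N εₙ) (trans (cong (⌊ N ⌋ *q_) (sym ε≡)) (sym (ℚP.*-assoc ⌊ N ⌋ ε _)))) (⌊⌋-* _ εᵈ) (⌊⌋-mono-≤ integral))
        cancelled : ⌊ N ⌋ *q ε *q inverse ≡ fromℕℚ N
        cancelled = trans (ℚP.*-assoc ⌊ N ⌋ ε inverse) (trans (cong (⌊ N ⌋ *q_) (ℚP.*-inverseʳ ε {{ℚP.pos⇒nonZero ε}}))
          (trans (ℚP.*-identityʳ ⌊ N ⌋) (⌊⌋-def N)))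

      module Guarantee (ε x : ℚ) (0≤ε : 0ℚ ≤q ε) (0≤x : 0ℚ ≤q x) (rank≤ : ⌊ rank g ⌋ ≤q ε *q ⌊ K ⌋)
                       (upper : ∀ M {l} → maxLen g ≡ suc l → Upper (ρ (ForInstance.instanceᶜ εₙ εᵈ I M)) x)
                       {O : G.Subgraph} (O✓ : IsGroupSteinerTree O) where

        t : ∃[ q ] 0ℚ ≤q q × ratOf q ∈ thresholds g × Threshold q O × (∀ e → e ∈ˢ G.Subgraph.E O → cost e ≤q q)
        t = threshold O✓

        q : ℚ
        q = proj₁ t

        0≤q : 0ℚ ≤q q
        0≤q = proj₁ (proj₂ t)

        listed : ∃[ φ ] candidate g (entryOf (ratOf q) φ) ∈ candidates
        listed = candidate∈ {q} (proj₁ (proj₂ (proj₂ t)))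

        φ : feasible g (ratOf q) ≡ true
        φ = proj₁ listed

        open Costs.BackSolution (back q 0≤q φ) using (ℓ; score≡; ℓ≤edges; ℓ<nodes; ℓ≡0)

        J : CDSInstance
        J = instanceAt q

        L : ℕ
        L = Sum edgeNumber (Costs.lengthIn εₙ εᵈ I q 0≤q O)

        costIn : Fin edgeNumber → ℚ
        costIn = Costs.costIn εₙ εᵈ I q 0≤q O

        below : ∀ e → e ∈ˢ G.Subgraph.E O → cost e ≤q q
        below = proj₂ (proj₂ (proj₂ (proj₂ t)))

        comparison : Σ (CDSInstance.Subgraph J) λ H → CDSInstance.IsSteinerCDS J H ×
                     CDSInstance.edgeCount J H ≤ L × CDSInstance.nodeCount J H ≤ suc L
        comparison = Costs.cds-solution εₙ εᵈ I q 0≤q O✓ below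

        measure-comparison : measure J (proj₁ comparison) ≤ suc L
        measure-comparison = measure≤ J (proj₁ (proj₂ (proj₂ comparison))) (proj₂ (proj₂ (proj₂ comparison)))

        ℓ≤measure : ℓ ≤ measure J (solved q φ)
        ℓ≤measure = measure≥ J ℓ≤edges ℓ<nodes

        measure-bound : ∀ {l} → maxLen g ≡ suc l → ⌊ measure J (solved q φ) ⌋ ≤q x *q ⌊ suc L ⌋
        -- The claim is an inequality of rationals, hence decidable, so the optimum may be used
        -- although it exists only under a double negation.
        measure-bound L≡ = decidable-stable (⌊ measure J (solved q φ) ⌋ ℚP.≤? x *q ⌊ suc L ⌋) λ ¬le →
          optimum-exists J (feasibleFor I (ratOf q) φ) λ (Opt , Opt✓) → ¬le (transfer {measure J (solved q φ)} {measure J Opt} {measure J (proj₁ comparison)} 0≤x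
            (proj₂ (proj₂ (proj₂ (solve J (feasibleFor I (ratOf q) φ)))) Opt Opt✓ x (upper (ratOf q) L≡))
            (proj₂ Opt✓ (proj₁ comparison) (proj₁ (proj₂ comparison))) measure-comparison)

        C KC : ℚ
        C  = totalCost O
        KC = ⌊ K ⌋ *q C

        costIn-nonNeg : ∀ e → 0ℚ ≤q costIn e
        costIn-nonNeg e with e ∈? G.Subgraph.E O
        ... | yes _ = nonnegative e
        ... | no _  = ℚP.≤-refl

        0≤C : 0ℚ ≤q C
        0≤C = Σq-nonNeg (costIn) costIn-nonNeg

        0≤KC : 0ℚ ≤q KC
        0≤KC = *-nonNeg (0≤⌊⌋ K) 0≤C

        -- The measure of the returned tree is at most x (L + 1), and q (L + 1) ≤ K c(O); thus the
        -- extra unit does not enter the ratio.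
        length-part : ∀ f → f ∈ˢ G.Subgraph.E O → cost f ≡ q → q *q ⌊ ℓ ⌋ ≤q x *q KC
        length-part f f∈ f≡ = by-cases (maxLen g) refl
          where
          by-cases : ∀ l → maxLen g ≡ l → q *q ⌊ ℓ ⌋ ≤q x *q KC
          by-cases zero    L≡ = subst (_≤q x *q KC) (sym (trans (cong (λ z → q *q ⌊ z ⌋) (ℓ≡0 L≡)) (*-⌊0⌋ q))) (*-nonNeg 0≤x 0≤KC)
          by-cases (suc l) L≡ = begin
            q *q ⌊ ℓ ⌋                          ≤⟨ *-monoˡ 0≤q (⌊⌋-mono-≤ ℓ≤measure) ⟩
            q *q ⌊ measure J (solved q φ) ⌋     ≤⟨ *-monoˡ 0≤q (measure-bound L≡) ⟩
            q *q (x *q ⌊ suc L ⌋)                   ≡⟨ ℚP.*-assoc q x _ ⟨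
            q *q x *q ⌊ suc L ⌋                     ≡⟨ cong (_*q ⌊ suc L ⌋) (ℚP.*-comm q x) ⟩
            x *q q *q ⌊ suc L ⌋                     ≡⟨ ℚP.*-assoc x q _ ⟩
            x *q (q *q ⌊ suc L ⌋)                   ≤⟨ *-monoˡ 0≤x (Costs.cost-lower εₙ εᵈ I q 0≤q O f f∈ f≡) ⟩
            x *q KC                                 ∎
            where open ℚP.≤-Reasoning

        q≤C : ∀ f → f ∈ˢ G.Subgraph.E O → cost f ≡ q → q ≤q C
        q≤C f f∈ f≡ = subst (_≤q C) (trans (if-does (f ∈? G.Subgraph.E O) f∈) f≡) (Σq-term (costIn) costIn-nonNeg f)

        rank-part : ∀ f → f ∈ˢ G.Subgraph.E O → cost f ≡ q → q *q ⌊ rank g ⌋ ≤q ε *q KC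
        rank-part f f∈ f≡ = begin
          q *q ⌊ rank g ⌋          ≤⟨ *-monoˡ 0≤q rank≤ ⟩
          q *q (ε *q ⌊ K ⌋)        ≤⟨ *-monoʳ (*-nonNeg 0≤ε (0≤⌊⌋ K)) (q≤C f f∈ f≡) ⟩
          C *q (ε *q ⌊ K ⌋)        ≡⟨ ℚP.*-comm C _ ⟩
          ε *q ⌊ K ⌋ *q C          ≡⟨ ℚP.*-assoc ε ⌊ K ⌋ C ⟩
          ε *q KC                  ∎
          where open ℚP.≤-Reasoning

        value-bound : q *q ⌊ ℓ + rank g ⌋ ≤q (x +q ε) *q KC
        value-bound = by-cases (proj₁ (proj₂ (proj₂ (proj₂ t))))
          where
          by-cases : Threshold q O → q *q ⌊ ℓ + rank g ⌋ ≤q (x +q ε) *q KC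
          by-cases (free q≡0 _) = subst (_≤q (x +q ε) *q KC) (sym (trans (cong (_*q ⌊ ℓ + rank g ⌋) q≡0) (ℚP.*-zeroˡ ⌊ ℓ + rank g ⌋)))
            (*-nonNeg (subst (_≤q x +q ε) (ℚP.+-identityˡ 0ℚ) (ℚP.+-mono-≤ 0≤x 0≤ε)) 0≤KC)
          by-cases (attained f f∈ f≡) = begin
            q *q ⌊ ℓ + rank g ⌋                 ≡⟨ cong (q *q_) (⌊⌋-+ ℓ (rank g)) ⟩
            q *q (⌊ ℓ ⌋ +q ⌊ rank g ⌋)          ≡⟨ ℚP.*-distribˡ-+ q _ _ ⟩
            q *q ⌊ ℓ ⌋ +q q *q ⌊ rank g ⌋       ≤⟨ ℚP.+-mono-≤ (length-part f f∈ f≡) (rank-part f f∈ f≡) ⟩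
            x *q KC +q ε *q KC                      ≡⟨ ℚP.*-distribʳ-+ KC x ε ⟨
            (x +q ε) *q KC                          ∎
            where open ℚP.≤-Reasoning

        guarantee : ∀ {H} → (∀ {c} → c ∈ candidates → (G′ : Good c) → ⌊ K ⌋ *q totalCost H ≤q value G′) → totalCost H ≤q (x +q ε) *q C
        guarantee {H} best≤ = ℚP.*-cancelˡ-≤-pos ⌊ K ⌋ {{⌊⌋-pos (maxLen g)}} (begin
          ⌊ K ⌋ *q totalCost H               ≤⟨ best≤ (proj₂ listed) (good q 0≤q φ) ⟩
          q *q ⌊ proj₁ (proj₂ (candidate g (entryOf (ratOf q) φ))) ⌋       ≡⟨ cong (λ z → q *q ⌊ z ⌋) score≡ ⟩
          q *q ⌊ ℓ + rank g ⌋                     ≤⟨ value-bound ⟩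
          (x +q ε) *q (⌊ K ⌋ *q C)           ≡⟨ ℚP.*-assoc (x +q ε) ⌊ K ⌋ C ⟨
          (x +q ε) *q ⌊ K ⌋ *q C             ≡⟨ cong (_*q C) (ℚP.*-comm (x +q ε) ⌊ K ⌋) ⟩
          ⌊ K ⌋ *q (x +q ε) *q C             ≡⟨ ℚP.*-assoc ⌊ K ⌋ _ C ⟩
          ⌊ K ⌋ *q ((x +q ε) *q C)           ∎)
          where open ℚP.≤-Reasoning

numerator-positive : ∀ {p} → 0ℚ <q p → 0 < numerator p
numerator-positive {ℚ.mkℚ (ℤ.+ suc _) _ _}  _ = s≤s z≤n
numerator-positive {ℚ.mkℚ (ℤ.-[1+ _ ]) _ _} _ = s≤s z≤n
numerator-positive {ℚ.mkℚ (ℤ.+ zero) _ _} (ℚ.*<* (ℤ.+<+ ()))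

reduction : (measure : (J : CDSInstance) → CDSInstance.Subgraph J → ℕ) →
  (∀ J {H L} → CDSInstance.edgeCount J H ≤ L → CDSInstance.nodeCount J H ≤ suc L → measure J H ≤ suc L) →
  (∀ J {H L} → L ≤ CDSInstance.edgeCount J H → suc L ≤ CDSInstance.nodeCount J H → L ≤ measure J H) →
  (ε : ℚ) .{{_ : Positive ε}} (α : ℚ → ℝ) → IsRatioFunction α →
  AdmitsRatio (SubsetSteinerCDS measure) (λ I → α (fromℕℚ (CDSInstance.n I))) →
  AdmitsRatio GroupSteinerTree (λ I → let open GSTInstance I in α (fromℕℚ (m * (n + k)) ÷⁺ ε) +ʳ ε)
reduction measure measure≤ measure≥ ε α αʳ (prog , fast , solve) =
  Computes.prog algorithm , runs-in-poly-time algorithm , λ I (_ , H₀✓) →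
    let H , H✓ , enc-H , best = answerFor prog fast ρ solve I H₀✓
        t , r , _ = Computes.run algorithm I
    in H , (t , subst (λ v → Computes.prog algorithm ⊢ MinimizationProblem.encInstance GroupSteinerTree I ⇓ v [ t ]) (sym enc-H) r) , H✓ ,
       λ O (O✓ , _) q above → subst (λ z → GSTInstance.totalCost I H ≤q z *q GSTInstance.totalCost I O) (minus-plus q)
         -- By definition of `_+ʳ_`, a rational `q` lies above α + ε if and only if x = q - ε lies
         -- above α. Ratios are at least 1, so x is positive.
         (Guarantee.guarantee prog fast ρ solve I ε (q -q ε) 0≤ε (ℚP.<⇒≤ (ℚP.<-trans (ℚP.positive⁻¹ 1ℚ) (upper-antitone (fromℚ 1ℚ) (bound I) (at-least-one _ (0≤size I)) above)))
           (rank≤εK prog fast ρ solve I {ε} (s≤s z≤n) (numerator-positive 0<ε) ε≡)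
           (λ M L≡ → upper-antitone (ρ (ForInstance.instanceᶜ εₙ εᵈ I M)) (bound I) (increasing _ _ (0≤fromℕℚ (CDSInstance.n (ForInstance.instanceᶜ εₙ εᵈ I M)))
             (instance-size prog fast ρ solve I {ε} M (s≤s z≤n) ε≡ L≡)) above)
           O✓ {H} best)
  where
  open IsRatioFunction αʳ
  εₙ εᵈ : ℕ
  εₙ = numerator ε
  εᵈ = ↧ₙ ε
  ρ : CDSInstance → ℝ
  ρ J = α (fromℕℚ (CDSInstance.n J))
  bound : GSTInstance → ℝ
  bound I = let open GSTInstance I in α (fromℕℚ (m * (n + k)) ÷⁺ ε)
  open Reduce measure εₙ εᵈ measure≤ measure≥
  0<ε : 0ℚ <q ε
  0<ε = ℚP.positive⁻¹ ε
  0≤ε : 0ℚ ≤q ε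
  0≤ε = ℚP.<⇒≤ 0<ε
  ε≡ : ε *q ⌊ εᵈ ⌋ ≡ ⌊ εₙ ⌋
  ε≡ = clear-denominator ε 0≤ε
  algorithm : Computes (MinimizationProblem.encInstance GroupSteinerTree)
                       (λ I → enc tree (Solver.output measure prog fast (solve₁ prog fast ρ solve) εₙ εᵈ I))
  algorithm = Solver.algorithm measure prog fast (solve₁ prog fast ρ solve) εₙ εᵈ
  0≤fromℕℚ : ∀ k → 0ℚ ≤q fromℕℚ k
  0≤fromℕℚ k = subst (0ℚ ≤q_) (⌊⌋-def k) (0≤⌊⌋ k)
  0≤size : ∀ I → let open GSTInstance I in 0ℚ ≤q fromℕℚ (m * (n + k)) ÷⁺ ε
  0≤size I = *-nonNeg (0≤fromℕℚ (m * (n + k))) (ℚP.<⇒≤ (ℚP.positive⁻¹ (ℚ.1/_ ε {{ℚP.pos⇒nonZero ε}}) {{ℚP.1/pos⇒pos ε}}))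
    where open GSTInstance I using (m; n; k)
  minus-plus : ∀ q → (q -q ε) +q ε ≡ q
  minus-plus q = trans (ℚP.+-assoc q (ℚ.- ε) ε) (trans (cong (q +q_) (ℚP.+-inverseˡ ε)) (ℚP.+-identityʳ q))

theorem3 :
  (ε : ℚ) .{{_ : Positive ε}} (α : ℚ → ℝ) → IsRatioFunction α →
  AdmitsRatio UnitEdgeCostsCDS (λ I → α (fromℕℚ (CDSInstance.n I)))
    ⊎ AdmitsRatio UnitNodeWeightsCDS (λ I → α (fromℕℚ (CDSInstance.n I))) →
  AdmitsRatio GroupSteinerTree
    (λ I → let open GSTInstance I in α (fromℕℚ (m *ⁿ (n +ⁿ k)) ÷⁺ ε) +ʳ ε)
theorem3 ε α αʳ (inj₁ edges) = reduction CDSInstance.edgeCount (λ _ e≤ _ → m≤n⇒m≤1+n e≤) (λ _ ≤e _ → ≤e) ε α αʳ edges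
theorem3 ε α αʳ (inj₂ nodes) = reduction CDSInstance.nodeCount (λ _ _ n≤ → n≤) (λ _ _ <n → <⇒≤ <n) ε α αʳ nodes
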